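{- For every positive integer $n$ and every positive divisor $k$ of $2n$, the number $o_V(\Lambda_n,k)$ of vertex orbits of $\Lambda_n$ of size $k$ equals \[ o_V(\Lambda_n, k)= \begin{cases} \displaystyle\sum_{d\mid k}\mu\!\left(\tfrac{k}{d}\right) F_{\lfloor d/2\rfloor + 2}, & k \mid n \text{ and } k \text{ odd},\\[2mm] \displaystyle\sum_{d\mid k}\mu\!\left(\tfrac{k}{d}\right) F_{\lfloor d/2\rfloor + 2} + \frac{1}{k} \sum_{d\mid k/2}\mu\!\left(\tfrac{k}{2d}\right)\Big(L_d - \tfrac{k}{2} F_{\lfloor d/2\rfloor + 2}\Big), & k \mid n \text{ and } k \text{ even},\\[2mm] \displaystyle\frac{1}{k} \sum_{d\mid k/2}\mu\!\left(\tfrac{k}{2d}\right)\Big(L_d - \tfrac{k}{2} F_{\lfloor d/2\rfloor + 2}\Big), & k\mid 2n \text{ and } k \nmid n. \end{cases} \]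
   Context: A Lucas string of length $n$ is a binary string $u_1\cdots u_n$ with no two consecutive 1s and not both $u_1=1$ and $u_n=1$. The Lucas cube $\Lambda_n$ is the subgraph of the $n$-cube $Q_n$ (binary strings of length $n$, adjacent iff they differ in exactly one position) induced by the Lucas strings of length $n$. $o_V(\Lambda_n,k)$ denotes the number of orbits of size $k$ of the natural action of the automorphism group ${\rm Aut}(\Lambda_n)$ on $V(\Lambda_n)$. $F_m$ are the Fibonacci numbers ($F_0=0$, $F_1=1$, $F_m=F_{m-1}+F_{m-2}$), $L_m$ the Lucas numbers ($L_0=2$, $L_1=1$, $L_m=L_{m-1}+L_{m-2}$), and $\mu$ is the Möbius function; sums over $d\mid m$ range over positive divisors $d$. -}

module Defs where

open import Data.Bool using (Bool; true; false; _∧_; not; T)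
open import Data.Nat as ℕ using (ℕ; zero; suc; _*_; _≤_; _∸_)
open import Data.Nat.DivMod using (_/_)
open import Data.Nat.Divisibility using (_∣_; _∣?_)
open import Data.Nat.Primality using (prime?)
open import Data.Integer as ℤ using (ℤ; +_)
open import Data.Rational as ℚ using (ℚ)
open import Data.List as List using (List; []; _∷_; filter; length; map; upTo)
open import Data.List.Relation.Unary.Unique.Propositional using (Unique)
open import Data.List.Relation.Unary.All using (All)
open import Data.List.Relation.Unary.AllPairs using (AllPairs)
open import Data.List.Relation.Unary.Any using (Any)
open import Data.List.Membership.Propositional using (_∈_)
open import Data.Vec as Vec using (Vec; toList)
open import Data.Product using (Σ; ∃; _×_; _,_)
open import Function.Bundles using (_↔_; _⇔_; Inverse)
open import Relation.Nullary using (¬_; does)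
open import Relation.Binary.PropositionalEquality using (_≡_)

noConsec : List Bool → Bool
noConsec []                 = true
noConsec (x ∷ [])           = true
noConsec (true ∷ true ∷ xs) = false
noConsec (x ∷ y ∷ xs)       = noConsec (y ∷ xs)

headB : List Bool → Bool
headB []      = false
headB (x ∷ _) = x

lastB : List Bool → Bool
lastB []           = false
lastB (x ∷ [])     = x
lastB (x ∷ y ∷ xs) = lastB (y ∷ xs)

isLucas : {n : ℕ} → Vec Bool n → Bool
isLucas u = noConsec (toList u) ∧ not (headB (toList u) ∧ lastB (toList u))

V : ℕ → Set
V n = Σ (Vec Bool n) (λ u → T (isLucas u))

hamming : {n : ℕ} → Vec Bool n → Vec Bool n → ℕ
hamming Vec.[] Vec.[] = 0
hamming (true  Vec.∷ xs) (false Vec.∷ ys) = suc (hamming xs ys)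
hamming (false Vec.∷ xs) (true  Vec.∷ ys) = suc (hamming xs ys)
hamming (_     Vec.∷ xs) (_     Vec.∷ ys) = hamming xs ys

Adj : (n : ℕ) → V n → V n → Set
Adj n (u , _) (v , _) = hamming u v ≡ 1

record Aut (n : ℕ) : Set where
  field
    perm      : V n ↔ V n
    preserves : ∀ u v → Adj n u v ⇔ Adj n (Inverse.to perm u) (Inverse.to perm v)

SameOrbit : (n : ℕ) → V n → V n → Set
SameOrbit n u v = ∃ λ (σ : Aut n) → Inverse.to (Aut.perm σ) u ≡ v

OrbitSize : (n : ℕ) → V n → ℕ → Set
OrbitSize n v k =
  ∃ λ (ws : List (V n)) → length ws ≡ k × Unique ws ×
    (∀ w → (w ∈ ws) ⇔ SameOrbit n v w)

IsOrbitCount : (n k N : ℕ) → Set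
IsOrbitCount n k N =
  ∃ λ (reps : List (V n)) → length reps ≡ N ×
    All (λ r → OrbitSize n r k) reps ×
    AllPairs (λ r s → ¬ SameOrbit n r s) reps ×
    (∀ v → OrbitSize n v k → Any (λ r → SameOrbit n r v) reps)

fib : ℕ → ℕ
fib 0 = 0
fib 1 = 1
fib (suc (suc m)) = fib (suc m) ℕ.+ fib m

lucas : ℕ → ℕ
lucas 0 = 2
lucas 1 = 1
lucas (suc (suc m)) = lucas (suc m) ℕ.+ lucas m

divisors : ℕ → List ℕ
divisors m = filter (λ d → d ∣? m) (List.map suc (upTo m))

primeDivisors : ℕ → List ℕ
primeDivisors m = filter (λ p → prime? p) (divisors m)

squarefree : ℕ → Bool
squarefree m = List.foldr _∧_ true (List.map (λ d → not (does ((d * d) ∣? m))) (List.map (λ i → suc (suc i)) (upTo m)))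

-- Möbius function (for m ≥ 1): 0 if m not squarefree, else (-1)^(number of prime factors)
mobius : ℕ → ℤ
mobius m with squarefree m
... | false = + 0
... | true  = (ℤ.- (+ 1)) ℤ.^ length (primeDivisors m)

-- truncated division (only ever used with nonzero divisor dividing the numerator)
_÷_ : ℕ → ℕ → ℕ
m ÷ zero  = 0
m ÷ suc d = m / suc d

sumℤ : List ℤ → ℤ
sumℤ = List.foldr ℤ._+_ (+ 0)

firstSum : ℕ → ℤ
firstSum k = sumℤ (map (λ d → mobius (k ÷ d) ℤ.* + fib (d / 2 ℕ.+ 2)) (divisors k))

secondSum : ℕ → ℤ
secondSum k = sumℤ (map (λ d → mobius (k ÷ (2 * d)) ℤ.*
                            (+ lucas d ℤ.- + ((k / 2) * fib (d / 2 ℕ.+ 2))))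
                        (divisors (k / 2)))

A : ℕ → ℚ
A k = firstSum k ℚ./ 1

-- (1/k) · secondSum k   (k ≥ 1; value at k = 0 is irrelevant)
B : ℕ → ℚ
B zero    = ℚ.0ℚ
B (suc j) = secondSum (suc j) ℚ./ suc j

ℕtoℚ : ℕ → ℚ
ℕtoℚ N = (+ N) ℚ./ 1

{-# OPTIONS --safe #-}
-- Automorphisms of Λ_n are isometries for the Hamming distance that fix the only vertex of degree n, so that they
-- permute the unit words; two units are cyclically adjacent iff their union is not a Lucas word, hence the permutation
-- is a rotation or a reflection of ℤ/n.  An orbit is therefore a rotation class of size p, its period, if it is closed
-- under reflection, and a union of two such classes otherwise.  Words of period dividing d are counted by L_d, and the
-- fixed points of the d reflections among them by d F_{⌊d/2⌋+2} altogether, where each achiral class of period p ∣ d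
-- contributes p (d/p) = d.  Möbius inversion gives the number of achiral classes and of chiral words of a given period.
module Submission where

open import Defs
open import Algebra.Properties.AbelianGroup using (∙-cancelˡ)
open import Data.Bool using (Bool; true; false; if_then_else_; _∧_; _∨_; not)
import Data.Bool.Properties as Boolₚ
open import Data.Empty using (⊥; ⊥-elim)
open import Data.Fin as Fin using (Fin; toℕ)
import Data.Fin.Properties as Finₚ
open import Data.Integer as ℤ using (ℤ; +_; 0ℤ; 1ℤ; -1ℤ)
import Data.Integer.Properties as ℤₚ
open import Data.Integer.Tactic.RingSolver using (solve-∀)
open import Data.List as List using (List; []; _∷_; filter; length; map; upTo; _++_)
import Data.List.Properties as Listₚ
open import Data.List.Membership.Propositional using (_∈_; _∉_; find; lose)
open import Data.List.Membership.Propositional.Properties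
open import Data.List.Relation.Unary.All as All using (All; []; _∷_)
open import Data.List.Relation.Unary.AllPairs as AllPairs using (AllPairs; []; _∷_)
open import Data.List.Relation.Unary.Any as Any using (Any; here; there; any?)
open import Data.List.Relation.Unary.Unique.Propositional using (Unique)
import Data.List.Relation.Unary.Unique.Propositional.Properties as Uniqueₚ
open import Data.Nat as ℕ using (ℕ; zero; suc; pred; _+_; _*_; _∸_; _≤_; _<_; z≤n; s≤s; NonZero)
open import Data.Nat.Divisibility hiding (quotient)
open import Data.Nat.DivMod
open import Data.Nat.Primality using (Prime; prime?; euclidsLemma; prime⇒nonZero; prime⇒irreducible; prime⇒nonTrivial)
open import Data.Nat.Primality.Factorisation using (factorise)
import Data.Nat.Properties as ℕₚ
open import Data.Nat.Tactic.RingSolver using () renaming (solve-∀ to ℕ-solve-∀)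
open import Data.Product using (Σ; ∃; _×_; _,_; proj₁; proj₂)
open import Data.Rational as ℚ using (ℚ)
import Data.Rational.Properties as ℚₚ
open import Data.Rational.Unnormalised using (mkℚᵘ; *≡*)
import Data.Rational.Unnormalised.Properties as ℚᵘₚ
open import Data.Sum as Sum using (_⊎_; inj₁; inj₂; [_,_]′)
open import Data.Unit using (⊤; tt)
open import Data.Vec using (Vec; []; _∷_; lookup; tabulate; toList; updateAt; replicate)
import Data.Vec.Properties as Vecₚ
open import Function using (_∘_; id)
open import Function.Bundles using (Equivalence; Inverse; mk⇔; mk↔ₛ′)
open import Function.Construct.Composition using (_↔-∘_)
open import Function.Construct.Identity using (↔-id)
open import Function.Construct.Symmetry using (↔-sym)
open import Relation.Binary using (DecidableEquality)
open import Relation.Binary.PropositionalEquality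
open import Relation.Nullary using (¬_; Dec; yes; no; does; contradiction; _×-dec_; _⊎-dec_; ¬?)
open import Relation.Nullary.Decidable using (map′)

-- Λ_n is an isometric subgraph of the cube, so preserving adjacency means preserving distances, and
-- the letter of a word at i can be read off from its distances to the origin and to the unit at i.
-- Counting is done with words instead of orbits: an orbit of size k holds k words, and the division
-- by k comes last. An achiral orbit of period p has size p, a chiral one size 2 p, and p divides n.
-- Hence an odd k meets only achiral classes, a k not dividing n only chiral ones with p = k / 2,
-- and an even k dividing n both; this is the origin of the three cases. The obstacle is that a
-- single reflection has no uniform number of fixed words: the number depends on whether the
-- reflection fixes positions or exchanges neighbours, hence on the parity of d and of its index.
-- Only the sum of two consecutive numbers is constant, namely 2 F_{⌊d/2⌋+2}, and this yields the
-- total over all d reflections. An achiral word of period p is fixed by exactly one reflection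
-- index modulo p, hence by d / p of the d indices; this is where the factor d / p comes from.

private variable
  X Y : Set

-- Finite sums in ℤ

∑ : List X → (X → ℤ) → ℤ
∑ xs f = sumℤ (map f xs)

-- Iverson bracket. With it every cardinality is a sum, and every double count is an exchange of two
-- sums.
⟦_⟧ : {P : Set} → Dec P → ℤ
⟦ p ⟧ = if does p then 1ℤ else 0ℤ

⟦⟧-yes : {P : Set} (p? : Dec P) → P → ⟦ p? ⟧ ≡ 1ℤ
⟦⟧-yes (yes _) _ = refl
⟦⟧-yes (no ¬p) p = contradiction p ¬p

⟦⟧-no : {P : Set} (p? : Dec P) → ¬ P → ⟦ p? ⟧ ≡ 0ℤ
⟦⟧-no (yes p) ¬p = contradiction p ¬p
⟦⟧-no (no _)  _  = refl

⟦⟧-cong : {P Q : Set} (p? : Dec P) (q? : Dec Q) → (P → Q) → (Q → P) → ⟦ p? ⟧ ≡ ⟦ q? ⟧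
⟦⟧-cong (yes p) q? to from = sym (⟦⟧-yes q? (to p))
⟦⟧-cong (no ¬p) q? to from = sym (⟦⟧-no q? (¬p ∘ from))

∑-cong : (xs : List X) {f g : X → ℤ} → (∀ {x} → x ∈ xs → f x ≡ g x) → ∑ xs f ≡ ∑ xs g
∑-cong []       _   = refl
∑-cong (x ∷ xs) f≡g = cong₂ ℤ._+_ (f≡g (here refl)) (∑-cong xs (f≡g ∘ there))

∑-zero : (xs : List X) → ∑ xs (λ _ → 0ℤ) ≡ 0ℤ
∑-zero []       = refl
∑-zero (x ∷ xs) = trans (ℤₚ.+-identityˡ _) (∑-zero xs)

∑-const : (xs : List X) (c : ℤ) → ∑ xs (λ _ → c) ≡ + length xs ℤ.* c
∑-const []       c = sym (ℤₚ.*-zeroˡ c)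
∑-const (x ∷ xs) c = trans (cong (λ s → c ℤ.+ s) (∑-const xs c)) (sym (ℤₚ.suc-* (+ length xs) c))

∑-+ : (xs : List X) (f g : X → ℤ) → ∑ xs (λ x → f x ℤ.+ g x) ≡ ∑ xs f ℤ.+ ∑ xs g
∑-+ []       f g = refl
∑-+ (x ∷ xs) f g = trans (cong (λ s → f x ℤ.+ g x ℤ.+ s) (∑-+ xs f g)) (shuffle (f x) (g x) (∑ xs f) (∑ xs g))
  where
  shuffle : ∀ a b c d → a ℤ.+ b ℤ.+ (c ℤ.+ d) ≡ a ℤ.+ c ℤ.+ (b ℤ.+ d)
  shuffle = solve-∀

∑-*ˡ : (xs : List X) (c : ℤ) (f : X → ℤ) → ∑ xs (λ x → c ℤ.* f x) ≡ c ℤ.* ∑ xs f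
∑-*ˡ []       c f = sym (ℤₚ.*-zeroʳ c)
∑-*ˡ (x ∷ xs) c f = trans (cong (λ s → c ℤ.* f x ℤ.+ s) (∑-*ˡ xs c f)) (sym (ℤₚ.*-distribˡ-+ c (f x) (∑ xs f)))

∑-swap : (xs : List X) (ys : List Y) (f : X → Y → ℤ) →
         ∑ xs (λ x → ∑ ys (f x)) ≡ ∑ ys (λ y → ∑ xs (λ x → f x y))
∑-swap []       ys f = sym (∑-zero ys)
∑-swap (x ∷ xs) ys f = trans (cong (λ s → ∑ ys (f x) ℤ.+ s) (∑-swap xs ys f))
                             (sym (∑-+ ys (f x) (λ y → ∑ xs (λ z → f z y))))

∑-filter : {P : X → Set} (P? : ∀ x → Dec (P x)) (xs : List X) (f : X → ℤ) →
           ∑ (filter P? xs) f ≡ ∑ xs (λ x → ⟦ P? x ⟧ ℤ.* f x)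
∑-filter P? []       f = refl
∑-filter P? (x ∷ xs) f with P? x
... | yes _ = cong₂ ℤ._+_ (sym (ℤₚ.*-identityˡ (f x))) (∑-filter P? xs f)
... | no  _ = trans (∑-filter P? xs f) (sym (trans (cong (λ s → s ℤ.+ ∑ xs (λ x → ⟦ P? x ⟧ ℤ.* f x)) (ℤₚ.*-zeroˡ (f x))) (ℤₚ.+-identityˡ _)))

length≡∑ : (xs : List X) → ∑ xs (λ _ → 1ℤ) ≡ + length xs
length≡∑ xs = trans (∑-const xs 1ℤ) (ℤₚ.*-identityʳ _)

length-filter≡∑ : {P : X → Set} (P? : ∀ x → Dec (P x)) (xs : List X) →
                  + length (filter P? xs) ≡ ∑ xs (λ x → ⟦ P? x ⟧)
length-filter≡∑ P? xs = begin
  + length (filter P? xs)             ≡⟨ length≡∑ (filter P? xs) ⟨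
  ∑ (filter P? xs) (λ _ → 1ℤ)         ≡⟨ ∑-filter P? xs (λ _ → 1ℤ) ⟩
  ∑ xs (λ x → ⟦ P? x ⟧ ℤ.* 1ℤ)        ≡⟨ ∑-cong xs (λ {x} _ → ℤₚ.*-identityʳ ⟦ P? x ⟧) ⟩
  ∑ xs (λ x → ⟦ P? x ⟧)               ∎
  where open ≡-Reasoning

∑-map : (h : X → Y) (xs : List X) (f : Y → ℤ) → ∑ (map h xs) f ≡ ∑ xs (f ∘ h)
∑-map h xs f = cong sumℤ (sym (Listₚ.map-∘ xs))

∑-++ : (xs ys : List X) (f : X → ℤ) → ∑ (xs ++ ys) f ≡ ∑ xs f ℤ.+ ∑ ys f
∑-++ []       ys f = sym (ℤₚ.+-identityˡ _)
∑-++ (x ∷ xs) ys f = trans (cong (λ s → f x ℤ.+ s) (∑-++ xs ys f)) (sym (ℤₚ.+-assoc (f x) _ _))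

∑-∉ : (_≟_ : DecidableEquality X) (xs : List X) (f : X → ℤ) {c : X} → c ∉ xs →
      ∑ xs (λ x → ⟦ x ≟ c ⟧ ℤ.* f x) ≡ 0ℤ
∑-∉ _≟_ xs f {c} c∉xs = trans (∑-cong xs vanish) (∑-zero xs)
  where
  vanish : ∀ {x} → x ∈ xs → ⟦ x ≟ c ⟧ ℤ.* f x ≡ 0ℤ
  vanish {x} x∈xs = trans (cong (ℤ._* f x) (⟦⟧-no (x ≟ c) λ { refl → c∉xs x∈xs })) (ℤₚ.*-zeroˡ (f x))

∑-∈ : (_≟_ : DecidableEquality X) {xs : List X} → Unique xs → (f : X → ℤ) {c : X} → c ∈ xs →
      ∑ xs (λ x → ⟦ x ≟ c ⟧ ℤ.* f x) ≡ f c
∑-∈ _≟_ {x ∷ xs} (x∉xs ∷ _) f (here refl) =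
  trans (cong₂ ℤ._+_ (trans (cong (ℤ._* f x) (⟦⟧-yes (x ≟ x) refl)) (ℤₚ.*-identityˡ (f x)))
                     (∑-∉ _≟_ xs f λ x∈xs → All.lookup x∉xs x∈xs refl))
        (ℤₚ.+-identityʳ (f x))
∑-∈ _≟_ {x ∷ xs} (x∉xs ∷ uxs) f {c} (there c∈xs) =
  trans (cong₂ ℤ._+_ (trans (cong (ℤ._* f x) (⟦⟧-no (x ≟ c) (All.lookup x∉xs c∈xs))) (ℤₚ.*-zeroˡ (f x)))
                     (∑-∈ _≟_ uxs f c∈xs))
        (ℤₚ.+-identityˡ (f c))

-- Expanding `g (to x)` as a sum over `ys` against the bracket of y ≡ `to x` reduces the claim to an
-- exchange of sums, because y ≡ `to x` and x ≡ `from y` are the same condition. No permutation of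
-- lists has to be constructed.
∑-bij : (_≟ᴬ_ : DecidableEquality X) (_≟ᴮ_ : DecidableEquality Y) {xs : List X} {ys : List Y} →
        Unique xs → Unique ys → (to : X → Y) (from : Y → X) →
        (∀ {x} → x ∈ xs → to x ∈ ys × from (to x) ≡ x) →
        (∀ {y} → y ∈ ys → from y ∈ xs × to (from y) ≡ y) →
        (f : X → ℤ) (g : Y → ℤ) → (∀ {x} → x ∈ xs → f x ≡ g (to x)) →
        ∑ xs f ≡ ∑ ys g
∑-bij _≟ᴬ_ _≟ᴮ_ {xs} {ys} uxs uys to from to-inv from-inv f g f≡g = begin
  ∑ xs f                                                  ≡⟨ ∑-cong xs f≡g ⟩
  ∑ xs (λ x → g (to x))                                   ≡⟨ ∑-cong xs (λ x∈ → ∑-∈ _≟ᴮ_ uys g (proj₁ (to-inv x∈))) ⟨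
  ∑ xs (λ x → ∑ ys (λ y → ⟦ y ≟ᴮ to x ⟧ ℤ.* g y))         ≡⟨ ∑-swap xs ys _ ⟩
  ∑ ys (λ y → ∑ xs (λ x → ⟦ y ≟ᴮ to x ⟧ ℤ.* g y))         ≡⟨ ∑-cong ys (λ y∈ → ∑-cong xs (λ x∈ → cong (ℤ._* _) (transpose x∈ y∈))) ⟩
  ∑ ys (λ y → ∑ xs (λ x → ⟦ x ≟ᴬ from y ⟧ ℤ.* g y))       ≡⟨ ∑-cong ys (λ {y} y∈ → ∑-∈ _≟ᴬ_ uxs (λ _ → g y) (proj₁ (from-inv y∈))) ⟩
  ∑ ys g                                                  ∎
  where
  open ≡-Reasoning
  transpose : ∀ {x y} → x ∈ xs → y ∈ ys → ⟦ y ≟ᴮ to x ⟧ ≡ ⟦ x ≟ᴬ from y ⟧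
  transpose {x} {y} x∈ y∈ = ⟦⟧-cong (y ≟ᴮ to x) (x ≟ᴬ from y)
    (λ { refl → sym (proj₂ (to-inv x∈)) }) (λ { refl → sym (proj₂ (from-inv y∈)) })

-- Filtering first means that `to` and `from` have to be mutually inverse only where P and Q hold,
-- so both may take arbitrary values elsewhere.
∑-count-bij : (_≟ᴬ_ : DecidableEquality X) (_≟ᴮ_ : DecidableEquality Y) {xs : List X} {ys : List Y} →
              Unique xs → Unique ys → (∀ x → x ∈ xs) → (∀ y → y ∈ ys) →
              {P : X → Set} {Q : Y → Set} (P? : ∀ x → Dec (P x)) (Q? : ∀ y → Dec (Q y)) →
              (to : X → Y) (from : Y → X) →
              (∀ {x} → P x → Q (to x) × from (to x) ≡ x) →
              (∀ {y} → Q y → P (from y) × to (from y) ≡ y) →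
              ∑ xs (λ x → ⟦ P? x ⟧) ≡ ∑ ys (λ y → ⟦ Q? y ⟧)
∑-count-bij _≟ᴬ_ _≟ᴮ_ {xs} {ys} uxs uys ∈xs ∈ys P? Q? to from to-inv from-inv = begin
  ∑ xs (λ x → ⟦ P? x ⟧)           ≡⟨ length-filter≡∑ P? xs ⟨
  + length (filter P? xs)         ≡⟨ length≡∑ (filter P? xs) ⟨
  ∑ (filter P? xs) (λ _ → 1ℤ)     ≡⟨ ∑-bij _≟ᴬ_ _≟ᴮ_ (Uniqueₚ.filter⁺ P? uxs) (Uniqueₚ.filter⁺ Q? uys) to from
                                       (λ x∈ → let (q , e) = to-inv (proj₂ (∈-filter⁻ P? {xs = xs} x∈)) in ∈-filter⁺ Q? (∈ys _) q , e)
                                       (λ y∈ → let (p , e) = from-inv (proj₂ (∈-filter⁻ Q? {xs = ys} y∈)) in ∈-filter⁺ P? (∈xs _) p , e)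
                                       _ _ (λ _ → refl) ⟩
  ∑ (filter Q? ys) (λ _ → 1ℤ)     ≡⟨ length≡∑ (filter Q? ys) ⟩
  + length (filter Q? ys)         ≡⟨ length-filter≡∑ Q? ys ⟩
  ∑ ys (λ y → ⟦ Q? y ⟧)           ∎
  where open ≡-Reasoning

∑-upTo-suc : (n : ℕ) (f : ℕ → ℤ) → ∑ (upTo (suc n)) f ≡ f 0 ℤ.+ ∑ (upTo n) (f ∘ suc)
∑-upTo-suc n f = cong (λ l → f 0 ℤ.+ sumℤ l)
  (trans (Listₚ.map-applyUpTo suc f n) (sym (Listₚ.map-applyUpTo id (f ∘ suc) n)))

∑-upTo-last : (n : ℕ) (f : ℕ → ℤ) → ∑ (upTo (suc n)) f ≡ ∑ (upTo n) f ℤ.+ f n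
∑-upTo-last n f = trans (cong (λ l → ∑ l f) (sym (Listₚ.upTo-∷ʳ n)))
  (trans (∑-++ (upTo n) (n ∷ []) f) (cong (λ s → ∑ (upTo n) f ℤ.+ s) (ℤₚ.+-identityʳ (f n))))

∑-upTo-+ : (m n : ℕ) (f : ℕ → ℤ) → ∑ (upTo (m + n)) f ≡ ∑ (upTo m) f ℤ.+ ∑ (upTo n) (λ i → f (m + i))
∑-upTo-+ zero    n f = sym (ℤₚ.+-identityˡ _)
∑-upTo-+ (suc m) n f = begin
  ∑ (upTo (suc m + n)) f                                    ≡⟨ ∑-upTo-suc (m + n) f ⟩
  f 0 ℤ.+ ∑ (upTo (m + n)) (f ∘ suc)                        ≡⟨ cong (λ s → f 0 ℤ.+ s) (∑-upTo-+ m n (f ∘ suc)) ⟩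
  f 0 ℤ.+ (∑ (upTo m) (f ∘ suc) ℤ.+ rest)                   ≡⟨ ℤₚ.+-assoc (f 0) _ _ ⟨
  f 0 ℤ.+ ∑ (upTo m) (f ∘ suc) ℤ.+ rest                     ≡⟨ cong (ℤ._+ rest) (∑-upTo-suc m f) ⟨
  ∑ (upTo (suc m)) f ℤ.+ rest                               ∎
  where
  open ≡-Reasoning
  rest = ∑ (upTo n) (λ i → f (suc m + i))

∑-periodic : (q p : ℕ) (f : ℕ → ℤ) → (∀ i → f (p + i) ≡ f i) →
             ∑ (upTo (q * p)) f ≡ + q ℤ.* ∑ (upTo p) f
∑-periodic zero    p f per = sym (ℤₚ.*-zeroˡ (∑ (upTo p) f))
∑-periodic (suc q) p f per = begin
  ∑ (upTo (p + q * p)) f                                          ≡⟨ ∑-upTo-+ p (q * p) f ⟩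
  ∑ (upTo p) f ℤ.+ ∑ (upTo (q * p)) (λ i → f (p + i))             ≡⟨ cong (λ s → ∑ (upTo p) f ℤ.+ s) (∑-cong (upTo (q * p)) (λ {i} _ → per i)) ⟩
  ∑ (upTo p) f ℤ.+ ∑ (upTo (q * p)) f                             ≡⟨ cong (λ s → ∑ (upTo p) f ℤ.+ s) (∑-periodic q p f per) ⟩
  ∑ (upTo p) f ℤ.+ + q ℤ.* ∑ (upTo p) f                           ≡⟨ ℤₚ.suc-* (+ q) (∑ (upTo p) f) ⟨
  + suc q ℤ.* ∑ (upTo p) f                                        ∎
  where open ≡-Reasoning

-- Möbius inversion

m*n÷n≡m : ∀ m n → 1 ≤ n → (m * n) ÷ n ≡ m
m*n÷n≡m m (suc n) _ = m*n/n≡m m (suc n)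

∣-pos : ∀ {d m} → 1 ≤ m → d ∣ m → 1 ≤ d
∣-pos {zero}  1≤m 0∣m = contradiction (0∣⇒≡0 0∣m) (ℕₚ.m<n⇒n≢0 1≤m)
∣-pos {suc d} _   _   = s≤s z≤n

÷-cancel : ∀ {k d} → 1 ≤ k → d ∣ k → (k ÷ d) * d ≡ k
÷-cancel {k} {d} 1≤k d∣k@(divides q refl) = cong (_* d) (m*n÷n≡m q d (∣-pos 1≤k d∣k))

divisors-unique : ∀ m → Unique (divisors m)
divisors-unique m = Uniqueₚ.filter⁺ (_∣? m) (Uniqueₚ.map⁺ ℕₚ.suc-injective (Uniqueₚ.upTo⁺ m))

∈-divisors⁺ : ∀ {d m} → 1 ≤ m → d ∣ m → d ∈ divisors m
∈-divisors⁺ {d} {m} 1≤m d∣m with ∣-pos 1≤m d∣m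
... | s≤s {n = e} _ = ∈-filter⁺ (_∣? m) (∈-map⁺ suc (∈-upTo⁺ (∣⇒≤ {{ℕ.>-nonZero 1≤m}} d∣m))) d∣m

∈-divisors⁻ : ∀ {d m} → d ∈ divisors m → d ∣ m
∈-divisors⁻ {m = m} d∈ = proj₂ (∈-filter⁻ (_∣? m) {xs = map suc (upTo m)} d∈)

∑-≋ : DecidableEquality X → {xs ys : List X} → Unique xs → Unique ys →
      (∀ {x} → x ∈ xs → x ∈ ys) → (∀ {x} → x ∈ ys → x ∈ xs) →
      (f : X → ℤ) → ∑ xs f ≡ ∑ ys f
∑-≋ _≟_ uxs uys xs⊆ys ys⊆xs f =
  ∑-bij _≟_ _≟_ uxs uys id id (λ x∈ → xs⊆ys x∈ , refl) (λ y∈ → ys⊆xs y∈ , refl) f f (λ _ → refl)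

∑-split : {P : X → Set} (P? : ∀ x → Dec (P x)) (xs : List X) (f : X → ℤ) →
          ∑ xs f ≡ ∑ (filter P? xs) f ℤ.+ ∑ (filter (¬? ∘ P?) xs) f
∑-split P? []       f = refl
∑-split P? (x ∷ xs) f with P? x
... | yes _ = trans (cong (λ s → f x ℤ.+ s) (∑-split P? xs f)) (sym (ℤₚ.+-assoc (f x) _ _))
... | no  _ = trans (cong (λ s → f x ℤ.+ s) (∑-split P? xs f)) (exchange (f x) (∑ (filter P? xs) f) (∑ (filter (¬? ∘ P?) xs) f))
  where
  exchange : ∀ a b c → a ℤ.+ (b ℤ.+ c) ≡ b ℤ.+ (a ℤ.+ c)
  exchange = solve-∀

-- Square-free numbers and the Möbius function at a multiple of a prime

SquareFree : ℕ → Set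
SquareFree m = ∀ d → 2 ≤ d → ¬ (d * d ∣ m)

foldr-∧⁻ : (b : X → Bool) (xs : List X) → List.foldr _∧_ true (map b xs) ≡ true → ∀ {x} → x ∈ xs → b x ≡ true
foldr-∧⁻ b (x ∷ xs) eq x∈ with b x in bx
foldr-∧⁻ b (x ∷ xs) eq (here refl) | true = bx
foldr-∧⁻ b (x ∷ xs) eq (there x∈)  | true = foldr-∧⁻ b xs eq x∈

foldr-∧⁺ : (b : X → Bool) (xs : List X) → (∀ {x} → x ∈ xs → b x ≡ true) → List.foldr _∧_ true (map b xs) ≡ true
foldr-∧⁺ b []       _   = refl
foldr-∧⁺ b (x ∷ xs) all = cong₂ _∧_ (all (here refl)) (foldr-∧⁺ b xs (all ∘ there))

not-does⁻ : {P : Set} (p? : Dec P) → not (does p?) ≡ true → ¬ P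
not-does⁻ (no ¬p) _ = ¬p

not-does⁺ : {P : Set} (p? : Dec P) → ¬ P → not (does p?) ≡ true
not-does⁺ (yes p) ¬p = contradiction p ¬p
not-does⁺ (no _)  _  = refl

squarefree⁻ : ∀ {m} → 1 ≤ m → squarefree m ≡ true → SquareFree m
squarefree⁻ {m} 1≤m sf d@(suc (suc e)) (s≤s (s≤s z≤n)) d²∣m =
  not-does⁻ (d * d ∣? m) (foldr-∧⁻ (λ d → not (does ((d * d) ∣? m))) _ sf (∈-map⁺ (λ i → suc (suc i)) (∈-upTo⁺ e<m))) d²∣m
  where
  e<m : e < m
  e<m = ℕₚ.≤-trans (ℕₚ.≤-trans (ℕₚ.n≤1+n (suc e)) (ℕₚ.m≤m*n d d)) (∣⇒≤ {{ℕ.>-nonZero 1≤m}} d²∣m)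

squarefree⁺ : ∀ {m} → SquareFree m → squarefree m ≡ true
squarefree⁺ {m} sf = foldr-∧⁺ (λ d → not (does ((d * d) ∣? m))) _ good
  where
  good : ∀ {x} → x ∈ map (λ i → suc (suc i)) (upTo m) → not (does ((x * x) ∣? m)) ≡ true
  good x∈ with ∈-map⁻ (λ i → suc (suc i)) x∈
  ... | i , _ , refl = not-does⁺ (_ ∣? m) (sf (suc (suc i)) (s≤s (s≤s z≤n)))

mobius-squarefree : ∀ m → squarefree m ≡ true → mobius m ≡ -1ℤ ℤ.^ length (primeDivisors m)
mobius-squarefree m eq with squarefree m
mobius-squarefree _ refl | true = refl

mobius-square : ∀ m → squarefree m ≡ false → mobius m ≡ 0ℤ
mobius-square m eq with squarefree m
mobius-square _ refl | false = refl

module _ {p c : ℕ} (pp : Prime p) (1≤c : 1 ≤ c) where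
  private
    instance
      p≢0 : NonZero p
      p≢0 = prime⇒nonZero pp

    1≤p : 1 ≤ p
    1≤p = ℕ.>-nonZero⁻¹ p

    2≤p : 2 ≤ p
    2≤p = ℕ.nonTrivial⇒n>1 p {{prime⇒nonTrivial pp}}

    1≤pc : 1 ≤ p * c
    1≤pc = ℕₚ.*-mono-≤ 1≤p 1≤c

  mobius-prime-square : p ∣ c → mobius (p * c) ≡ 0ℤ
  mobius-prime-square p∣c = mobius-square (p * c) (notSquarefree refl)
    where
    notSquarefree : ∀ {b} → squarefree (p * c) ≡ b → b ≡ false
    notSquarefree {false} _  = refl
    notSquarefree {true}  eq = contradiction (*-monoʳ-∣ p p∣c) (squarefree⁻ 1≤pc eq p 2≤p)

  module _ (p∤c : ¬ p ∣ c) where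
    -- Let d² divide p c with c square-free. If p divides d, then p² divides p c and p divides c.
    -- Otherwise Euclid's lemma moves p into the cofactor of d², so that d² already divides c.
    squarefree-prime : squarefree (p * c) ≡ squarefree c
    squarefree-prime with squarefree c in eq
    ... | true  = squarefree⁺ λ d 2≤d d²∣pc → absurd d 2≤d d²∣pc
      where
      absurd : ∀ d → 2 ≤ d → ¬ (d * d ∣ p * c)
      absurd d 2≤d d²∣pc@(divides q pc≡qd²) with p ∣? d
      ... | yes (divides e refl) = p∤c (*-cancelˡ-∣ p (∣-trans (divides (e * e) (rearrange e p)) d²∣pc))
        where
        rearrange : ∀ e p → e * p * (e * p) ≡ e * e * (p * p)
        rearrange = ℕ-solve-∀
      ... | no p∤d with euclidsLemma q (d * d) pp (divides c (trans (sym pc≡qd²) (ℕₚ.*-comm p c)))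
      ... | inj₂ p∣d² = [ p∤d , p∤d ]′ (euclidsLemma d d pp p∣d²)
      ... | inj₁ (divides q′ refl) = squarefree⁻ 1≤c eq d 2≤d (divides q′ (ℕₚ.*-cancelˡ-≡ c (q′ * (d * d)) p
              (trans pc≡qd² (trans (cong (_* (d * d)) (ℕₚ.*-comm q′ p)) (ℕₚ.*-assoc p q′ (d * d))))))
    ... | false with squarefree (p * c) in eq′
    ... | false = refl
    ... | true  = contradiction (trans (sym (squarefree⁺ λ d 2≤d d²∣c → squarefree⁻ 1≤pc eq′ d 2≤d (∣-trans d²∣c (n∣m*n p)))) eq) λ ()

    -- The list on the left is increasing, so p need not be its head. Only the sets of entries are
    -- compared, and the lengths are obtained as sums of ones.
    length-primeDivisors : length (primeDivisors (p * c)) ≡ suc (length (primeDivisors c))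
    length-primeDivisors = ℤₚ.+-injective (begin
      + length (primeDivisors (p * c))                ≡⟨ length≡∑ (primeDivisors (p * c)) ⟨
      ∑ (primeDivisors (p * c)) (λ _ → 1ℤ)            ≡⟨ ∑-≋ ℕ._≟_ (unique (p * c)) unique∷ split unsplit (λ _ → 1ℤ) ⟩
      ∑ (p ∷ primeDivisors c) (λ _ → 1ℤ)              ≡⟨ length≡∑ (p ∷ primeDivisors c) ⟩
      + suc (length (primeDivisors c))                ∎)
      where
      open ≡-Reasoning
      unique : ∀ m → Unique (primeDivisors m)
      unique m = Uniqueₚ.filter⁺ prime? (divisors-unique m)
      ∈⁻ : ∀ {q m} → q ∈ primeDivisors m → q ∣ m × Prime q
      ∈⁻ {m = m} q∈ = let (q∈ds , qp) = ∈-filter⁻ prime? {xs = divisors m} q∈ in ∈-divisors⁻ q∈ds , qp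
      unique∷ : Unique (p ∷ primeDivisors c)
      unique∷ = All.tabulate (λ q∈ → λ { refl → p∤c (proj₁ (∈⁻ q∈)) }) ∷ unique c
      split : ∀ {q} → q ∈ primeDivisors (p * c) → q ∈ p ∷ primeDivisors c
      split q∈ with ∈⁻ q∈
      ... | q∣pc , qp with euclidsLemma p c qp q∣pc
      ... | inj₂ q∣c = there (∈-filter⁺ prime? (∈-divisors⁺ 1≤c q∣c) qp)
      ... | inj₁ q∣p with prime⇒irreducible pp q∣p
      ... | inj₁ refl = contradiction qp λ ()
      ... | inj₂ refl = here refl
      unsplit : ∀ {q} → q ∈ p ∷ primeDivisors c → q ∈ primeDivisors (p * c)
      unsplit (here refl) = ∈-filter⁺ prime? (∈-divisors⁺ 1≤pc (m∣m*n c)) pp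
      unsplit (there q∈)  = let (q∣c , qp) = ∈⁻ q∈ in ∈-filter⁺ prime? (∈-divisors⁺ 1≤pc (∣-trans q∣c (n∣m*n p))) qp

    mobius-prime : mobius (p * c) ≡ ℤ.- mobius c
    mobius-prime with squarefree c in eq
    ... | false = mobius-square (p * c) (trans squarefree-prime eq)
    ... | true  = trans (mobius-squarefree (p * c) (trans squarefree-prime eq))
                    (trans (cong (-1ℤ ℤ.^_) length-primeDivisors) (ℤₚ.-1*i≡-i _))

primeDivisor : ∀ {m} → 2 ≤ m → ∃ λ p → Prime p × p ∣ m
primeDivisor {m} 2≤m with factorise m {{ℕ.>-nonZero (ℕₚ.<⇒≤ 2≤m)}}
... | record { factors = []     ; isFactorisation = refl } = contradiction 2≤m λ { (s≤s ()) }
... | record { factors = p ∷ ps ; isFactorisation = refl ; factorsPrime = pp ∷ _ } = p , pp , m∣m*n _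

-- For a prime p ∣ m, the divisors d and p d with p ∤ d cancel, and those divisible by p² contribute 0.
∑-mobius-≥2 : ∀ m → 2 ≤ m → ∑ (divisors m) mobius ≡ 0ℤ
∑-mobius-≥2 _ 2≤m with primeDivisor 2≤m
... | p , pp , divides m′ refl = begin
  ∑ (divisors m) mobius                                          ≡⟨ ∑-split (p ∣?_) (divisors m) mobius ⟩
  ∑ multiples mobius ℤ.+ ∑ (filter p∤? (divisors m)) mobius      ≡⟨ cong₂ ℤ._+_ multiples-∑ (∑-≋ ℕ._≟_ (Uniqueₚ.filter⁺ p∤? (divisors-unique m)) (Uniqueₚ.filter⁺ p∤? (divisors-unique m′)) down up mobius) ⟩
  -1ℤ ℤ.* N ℤ.+ N                                                ≡⟨ cancel N ⟩
  0ℤ                                                             ∎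
  where
  open ≡-Reasoning
  m = m′ * p
  p∤? : ∀ d → Dec (¬ p ∣ d)
  p∤? d = ¬? (p ∣? d)
  multiples = filter (p ∣?_) (divisors m)
  N = ∑ (filter p∤? (divisors m′)) mobius
  cancel : ∀ a → -1ℤ ℤ.* a ℤ.+ a ≡ 0ℤ
  cancel = solve-∀
  instance
    p≢0 : NonZero p
    p≢0 = prime⇒nonZero pp
  1≤p : 1 ≤ p
  1≤p = ℕ.>-nonZero⁻¹ p
  1≤m : 1 ≤ m
  1≤m = ℕₚ.<⇒≤ 2≤m
  1≤m′ : 1 ≤ m′
  1≤m′ = ∣-pos 1≤m (m∣m*n p)

  multiples-∑ : ∑ multiples mobius ≡ -1ℤ ℤ.* N
  multiples-∑ = begin
    ∑ multiples mobius                                        ≡⟨ ∑-bij ℕ._≟_ ℕ._≟_ (divisors-unique m′) (Uniqueₚ.filter⁺ (p ∣?_) (divisors-unique m)) (p *_) (_÷ p) to-inv from-inv (λ c → mobius (p * c)) mobius (λ _ → refl) ⟨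
    ∑ (divisors m′) (λ c → mobius (p * c))                    ≡⟨ ∑-cong (divisors m′) value ⟩
    ∑ (divisors m′) (λ c → -1ℤ ℤ.* (⟦ p∤? c ⟧ ℤ.* mobius c))  ≡⟨ ∑-*ˡ (divisors m′) -1ℤ _ ⟩
    -1ℤ ℤ.* ∑ (divisors m′) (λ c → ⟦ p∤? c ⟧ ℤ.* mobius c)    ≡⟨ cong (-1ℤ ℤ.*_) (∑-filter p∤? (divisors m′) mobius) ⟨
    -1ℤ ℤ.* N                                                 ∎
    where
    to-inv : ∀ {c} → c ∈ divisors m′ → p * c ∈ multiples × (p * c) ÷ p ≡ c
    to-inv {c} c∈ = ∈-filter⁺ (p ∣?_) (∈-divisors⁺ 1≤m (subst (p * c ∣_) (ℕₚ.*-comm p m′) (*-monoʳ-∣ p (∈-divisors⁻ c∈)))) (m∣m*n c)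
                  , trans (cong (_÷ p) (ℕₚ.*-comm p c)) (m*n÷n≡m c p 1≤p)
    from-inv : ∀ {d} → d ∈ multiples → d ÷ p ∈ divisors m′ × p * (d ÷ p) ≡ d
    from-inv d∈ with ∈-filter⁻ (p ∣?_) {xs = divisors m} d∈
    ... | d∈ds , divides q refl rewrite m*n÷n≡m q p 1≤p =
      ∈-divisors⁺ 1≤m′ (*-cancelˡ-∣ p (subst₂ _∣_ (ℕₚ.*-comm q p) (ℕₚ.*-comm m′ p) (∈-divisors⁻ d∈ds))) , ℕₚ.*-comm p q
    value : ∀ {c} → c ∈ divisors m′ → mobius (p * c) ≡ -1ℤ ℤ.* (⟦ p∤? c ⟧ ℤ.* mobius c)
    value {c} c∈ with p ∣? c
    ... | yes p∣c = trans (mobius-prime-square pp (∣-pos 1≤m′ (∈-divisors⁻ c∈)) p∣c) (cong (-1ℤ ℤ.*_) (sym (ℤₚ.*-zeroˡ (mobius c))))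
    ... | no  p∤c = trans (mobius-prime pp (∣-pos 1≤m′ (∈-divisors⁻ c∈)) p∤c)
                      (sym (trans (cong (-1ℤ ℤ.*_) (ℤₚ.*-identityˡ (mobius c))) (ℤₚ.-1*i≡-i (mobius c))))

  down : ∀ {d} → d ∈ filter p∤? (divisors m) → d ∈ filter p∤? (divisors m′)
  down {d} d∈ with ∈-filter⁻ p∤? {xs = divisors m} d∈
  ... | d∈ds , p∤d with ∈-divisors⁻ d∈ds
  ... | divides q m≡qd with euclidsLemma q d pp (divides m′ (sym m≡qd))
  ... | inj₂ p∣d = contradiction p∣d p∤d
  ... | inj₁ (divides q′ refl) = ∈-filter⁺ p∤? (∈-divisors⁺ 1≤m′ (divides q′ (ℕₚ.*-cancelʳ-≡ m′ (q′ * d) p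
          (trans m≡qd (trans (ℕₚ.*-assoc q′ p d) (trans (cong (q′ *_) (ℕₚ.*-comm p d)) (sym (ℕₚ.*-assoc q′ d p)))))))) p∤d
  up : ∀ {d} → d ∈ filter p∤? (divisors m′) → d ∈ filter p∤? (divisors m)
  up {d} d∈ with ∈-filter⁻ p∤? {xs = divisors m′} d∈
  ... | d∈ds , p∤d = ∈-filter⁺ p∤? (∈-divisors⁺ 1≤m (∣-trans (∈-divisors⁻ {m = m′} d∈ds) (m∣m*n p))) p∤d

∑-mobius : ∀ m → 1 ≤ m → ∑ (divisors m) mobius ≡ ⟦ m ℕ.≟ 1 ⟧
∑-mobius (suc zero)    _ = refl
∑-mobius (suc (suc m)) _ = ∑-mobius-≥2 (suc (suc m)) (s≤s (s≤s z≤n))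

-- After expanding f and exchanging sums, the coefficient of g e is the sum of μ(k/d) over the
-- multiples d of e. The involution d ↦ k / d turns it into the sum of μ over the divisors of k / e,
-- which is 1 for e = k and 0 otherwise. The relation is assumed at the divisors of k alone, since
-- the counts below satisfy it only for divisors of n.
mobius-inversion : ∀ {k} → 1 ≤ k → (f g : ℕ → ℤ) → (∀ {d} → d ∣ k → f d ≡ ∑ (divisors d) g) →
                   ∑ (divisors k) (λ d → mobius (k ÷ d) ℤ.* f d) ≡ g k
mobius-inversion {k} 1≤k f g f≡∑g = begin
  ∑ D (λ d → mobius (k ÷ d) ℤ.* f d)                                          ≡⟨ ∑-cong D expand ⟩
  ∑ D (λ d → ∑ D (λ e → ⟦ e ∣? d ⟧ ℤ.* (mobius (k ÷ d) ℤ.* g e)))             ≡⟨ ∑-swap D D _ ⟩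
  ∑ D (λ e → ∑ D (λ d → ⟦ e ∣? d ⟧ ℤ.* (mobius (k ÷ d) ℤ.* g e)))             ≡⟨ ∑-cong D collapse ⟩
  ∑ D (λ e → ⟦ e ℕ.≟ k ⟧ ℤ.* g e)                                             ≡⟨ ∑-∈ ℕ._≟_ (divisors-unique k) g (∈-divisors⁺ 1≤k ∣-refl) ⟩
  g k                                                                         ∎
  where
  open ≡-Reasoning
  D = divisors k

  swap* : ∀ a b c → a ℤ.* (b ℤ.* c) ≡ b ℤ.* (a ℤ.* c)
  swap* = solve-∀

  expand : ∀ {d} → d ∈ D → mobius (k ÷ d) ℤ.* f d ≡ ∑ D (λ e → ⟦ e ∣? d ⟧ ℤ.* (mobius (k ÷ d) ℤ.* g e))
  expand {d} d∈ = begin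
    μ ℤ.* f d                                 ≡⟨ cong (μ ℤ.*_) (f≡∑g d∣k) ⟩
    μ ℤ.* ∑ (divisors d) g                    ≡⟨ cong (μ ℤ.*_) (∑-≋ ℕ._≟_ (divisors-unique d) (Uniqueₚ.filter⁺ (_∣? d) (divisors-unique k))
                                                  (λ e∈ → ∈-filter⁺ (_∣? d) (∈-divisors⁺ 1≤k (∣-trans (∈-divisors⁻ e∈) d∣k)) (∈-divisors⁻ e∈))
                                                  (λ e∈ → ∈-divisors⁺ (∣-pos 1≤k d∣k) (proj₂ (∈-filter⁻ (_∣? d) {xs = D} e∈))) g) ⟩
    μ ℤ.* ∑ (filter (_∣? d) D) g              ≡⟨ cong (μ ℤ.*_) (∑-filter (_∣? d) D g) ⟩
    μ ℤ.* ∑ D (λ e → ⟦ e ∣? d ⟧ ℤ.* g e)      ≡⟨ ∑-*ˡ D μ _ ⟨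
    ∑ D (λ e → μ ℤ.* (⟦ e ∣? d ⟧ ℤ.* g e))    ≡⟨ ∑-cong D (λ {e} _ → swap* μ ⟦ e ∣? d ⟧ (g e)) ⟩
    ∑ D (λ e → ⟦ e ∣? d ⟧ ℤ.* (μ ℤ.* g e))    ∎
    where
    μ = mobius (k ÷ d)
    d∣k = ∈-divisors⁻ d∈

  collapse : ∀ {e} → e ∈ D → ∑ D (λ d → ⟦ e ∣? d ⟧ ℤ.* (mobius (k ÷ d) ℤ.* g e)) ≡ ⟦ e ℕ.≟ k ⟧ ℤ.* g e
  collapse {e} e∈ = begin
    ∑ D (λ d → ⟦ e ∣? d ⟧ ℤ.* (mobius (k ÷ d) ℤ.* g e))           ≡⟨ ∑-filter (e ∣?_) D _ ⟨
    ∑ (filter (e ∣?_) D) (λ d → mobius (k ÷ d) ℤ.* g e)           ≡⟨ ∑-cong (filter (e ∣?_) D) (λ {d} _ → ℤₚ.*-comm (mobius (k ÷ d)) (g e)) ⟩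
    ∑ (filter (e ∣?_) D) (λ d → g e ℤ.* mobius (k ÷ d))           ≡⟨ ∑-*ˡ (filter (e ∣?_) D) (g e) _ ⟩
    g e ℤ.* ∑ (filter (e ∣?_) D) (λ d → mobius (k ÷ d))           ≡⟨ cong (g e ℤ.*_) (∑-bij ℕ._≟_ ℕ._≟_ (Uniqueₚ.filter⁺ (e ∣?_) (divisors-unique k)) (divisors-unique (k ÷ e))
                                                                        (k ÷_) (k ÷_) to-inv from-inv _ mobius (λ _ → refl)) ⟩
    g e ℤ.* ∑ (divisors (k ÷ e)) mobius                           ≡⟨ cong (g e ℤ.*_) (∑-mobius (k ÷ e) 1≤k÷e) ⟩
    g e ℤ.* ⟦ k ÷ e ℕ.≟ 1 ⟧                                       ≡⟨ cong (g e ℤ.*_) (⟦⟧-cong (k ÷ e ℕ.≟ 1) (e ℕ.≟ k) ÷1 1÷) ⟩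
    g e ℤ.* ⟦ e ℕ.≟ k ⟧                                           ≡⟨ ℤₚ.*-comm (g e) _ ⟩
    ⟦ e ℕ.≟ k ⟧ ℤ.* g e                                           ∎
    where
    e∣k = ∈-divisors⁻ e∈
    ke≡k : (k ÷ e) * e ≡ k
    ke≡k = ÷-cancel 1≤k e∣k
    1≤k÷e : 1 ≤ k ÷ e
    1≤k÷e = ∣-pos 1≤k (divides e (trans (sym ke≡k) (ℕₚ.*-comm (k ÷ e) e)))
    ÷1 : k ÷ e ≡ 1 → e ≡ k
    ÷1 eq = trans (sym (ℕₚ.*-identityˡ e)) (trans (cong (_* e) (sym eq)) ke≡k)
    1÷ : e ≡ k → k ÷ e ≡ 1
    1÷ refl = trans (cong (_÷ k) (sym (ℕₚ.*-identityˡ k))) (m*n÷n≡m 1 k 1≤k)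
    quotient : ∀ a d → 1 ≤ d → a * d ≡ k → k ÷ d ≡ a
    quotient a d 1≤d refl = m*n÷n≡m a d 1≤d
    to-inv : ∀ {d} → d ∈ filter (e ∣?_) D → k ÷ d ∈ divisors (k ÷ e) × k ÷ (k ÷ d) ≡ d
    to-inv d∈ with ∈-filter⁻ (e ∣?_) {xs = D} d∈
    ... | d∈D , divides q refl with ∈-divisors⁻ d∈D
    ... | r@(divides a k≡) = subst₂ (λ x y → x ∈ divisors y) (sym (quotient a (q * e) 1≤d (sym k≡))) (sym (quotient (a * q) e (∣-pos 1≤k e∣k) (trans (ℕₚ.*-assoc a q e) (sym k≡))))
              (∈-divisors⁺ 1≤aq (m∣m*n q))
            , trans (cong (k ÷_) (quotient a (q * e) 1≤d (sym k≡))) (quotient (q * e) a 1≤a (trans (ℕₚ.*-comm (q * e) a) (sym k≡)))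
      where
      1≤d : 1 ≤ q * e
      1≤d = ∣-pos 1≤k r
      1≤a : 1 ≤ a
      1≤a = ∣-pos 1≤k (divides (q * e) (trans k≡ (ℕₚ.*-comm a (q * e))))
      1≤aq : 1 ≤ a * q
      1≤aq = ∣-pos 1≤k (divides e (trans k≡ (trans (sym (ℕₚ.*-assoc a q e)) (ℕₚ.*-comm (a * q) e))))
    from-inv : ∀ {c} → c ∈ divisors (k ÷ e) → k ÷ c ∈ filter (e ∣?_) D × k ÷ (k ÷ c) ≡ c
    from-inv {c} c∈ with ∈-divisors⁻ c∈
    ... | c∣@(divides b k÷e≡bc) = subst (_∈ filter (e ∣?_) D) (sym k÷c) (∈-filter⁺ (e ∣?_) (∈-divisors⁺ 1≤k (divides c k≡cbe)) (n∣m*n b))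
            , trans (cong (k ÷_) k÷c) (quotient c (b * e) (∣-pos 1≤k (divides c k≡cbe)) (sym k≡cbe))
      where
      k≡ : b * c * e ≡ k
      k≡ = trans (cong (_* e) (sym k÷e≡bc)) ke≡k
      k≡cbe : k ≡ c * (b * e)
      k≡cbe = trans (sym k≡) (trans (cong (_* e) (ℕₚ.*-comm b c)) (ℕₚ.*-assoc c b e))
      k÷c : k ÷ c ≡ b * e
      k÷c = quotient (b * e) c (∣-pos 1≤k÷e c∣) (trans (ℕₚ.*-comm (b * e) c) (sym k≡cbe))

-- Periodic words, rotations and reflections

-- Cyclic words are handled as periodic functions on ℕ: index arithmetic needs no wrapping around,
-- and words of different lengths become comparable.
Periodic : ℕ → (ℕ → Bool) → Set
Periodic d f = ∀ i → f (i + d) ≡ f i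

Sparse : (ℕ → Bool) → Set
Sparse f = ∀ i → f i ∧ f (suc i) ≡ false

∧-false⁻ : ∀ {a b} → a ∧ b ≡ false → a ≡ true → b ≡ true → ⊥
∧-false⁻ () refl refl

∧-false⁺ : ∀ {a b} → (a ≡ true → b ≡ true → ⊥) → a ∧ b ≡ false
∧-false⁺ {true}  {true}  ab = ⊥-elim (ab refl refl)
∧-false⁺ {true}  {false} _  = refl
∧-false⁺ {false} {_}     _  = refl

periodic-* : ∀ {d f} → Periodic d f → ∀ q i → f (i + q * d) ≡ f i
periodic-* {d} {f} per zero    i = cong f (ℕₚ.+-identityʳ i)
periodic-* {d} {f} per (suc q) i = trans (cong f (sym (ℕₚ.+-assoc i d (q * d)))) (trans (periodic-* per q (i + d)) (per i))

periodic-≡ : ∀ {d f} → Periodic d f → ∀ {i j} a b → i + a * d ≡ j + b * d → f i ≡ f j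
periodic-≡ {d} {f} per {i} {j} a b eq = trans (sym (periodic-* per a i)) (trans (cong f eq) (periodic-* per b j))

periodic-% : ∀ {d f} .{{_ : NonZero d}} → Periodic d f → ∀ i → f (i % d) ≡ f i
periodic-% {d} {f} per i = trans (sym (periodic-* per (i / d) (i % d))) (cong f (sym (m≡m%n+[m/n]*n i d)))

suc-% : ∀ i d .{{_ : NonZero d}} → (suc i % d ≡ suc (i % d)) ⊎ (suc (i % d) ≡ d × suc i % d ≡ 0)
suc-% i d = Sum.map (λ lt → trans step (m<n⇒m%n≡m lt)) (λ eq → eq , trans step (trans (cong (_% d) eq) (n%n≡0 d)))
                    (ℕₚ.m≤n⇒m<n∨m≡n (m%n<n i d))
  where
  step : suc i % d ≡ suc (i % d) % d
  step = trans (cong (λ j → suc j % d) (m≡m%n+[m/n]*n i d)) ([m+kn]%n≡m%n (suc (i % d)) (i / d) d)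

-- Lucas words as cyclically sparse functions

nth : List Bool → ℕ → Bool
-- The default `false` makes `Sparse (nth xs)` impose nothing on the pair formed by the last letter
-- and the position after it.
nth []       _       = false
nth (x ∷ xs) zero    = x
nth (x ∷ xs) (suc i) = nth xs i

nth-beyond : ∀ xs {i} → length xs ≤ i → nth xs i ≡ false
nth-beyond []       _         = refl
nth-beyond (x ∷ xs) (s≤s len) = nth-beyond xs len

nth-lookup : ∀ {n} (u : Vec Bool n) i → nth (toList u) (toℕ i) ≡ lookup u i
nth-lookup (x ∷ u) Fin.zero    = refl
nth-lookup (x ∷ u) (Fin.suc i) = nth-lookup u i

lastB-nth : ∀ x xs → lastB (x ∷ xs) ≡ nth (x ∷ xs) (length xs)
lastB-nth x []       = refl
lastB-nth x (y ∷ xs) = lastB-nth y xs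

noConsec⁻ : ∀ xs → noConsec xs ≡ true → Sparse (nth xs)
noConsec⁻ []                 _  i       = refl
noConsec⁻ (x ∷ [])           _  zero    = Boolₚ.∧-zeroʳ x
noConsec⁻ (x ∷ [])           _  (suc i) = refl
noConsec⁻ (true ∷ false ∷ xs) _  zero    = refl
noConsec⁻ (true ∷ false ∷ xs) nc (suc i) = noConsec⁻ (false ∷ xs) nc i
noConsec⁻ (false ∷ y ∷ xs)   _  zero    = refl
noConsec⁻ (false ∷ y ∷ xs)   nc (suc i) = noConsec⁻ (y ∷ xs) nc i

noConsec⁺ : ∀ xs → Sparse (nth xs) → noConsec xs ≡ true
noConsec⁺ []                  _  = refl
noConsec⁺ (x ∷ [])            _  = refl
noConsec⁺ (true ∷ true ∷ xs)  sp with sp 0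
... | ()
noConsec⁺ (true ∷ false ∷ xs) sp = noConsec⁺ (false ∷ xs) (sp ∘ suc)
noConsec⁺ (false ∷ y ∷ xs)    sp = noConsec⁺ (y ∷ xs) (sp ∘ suc)

module _ {n : ℕ} .{{_ : NonZero n}} where

  at : Vec Bool n → ℕ → Bool
  at u i = lookup u (i mod n)

  toℕ-mod : ∀ i → toℕ (i mod n) ≡ i % n
  toℕ-mod i = Finₚ.toℕ-fromℕ< (m%n<n i n)

  mod-cong : ∀ {i j} → i % n ≡ j % n → i mod n ≡ j mod n
  mod-cong {i} {j} eq = Finₚ.toℕ-injective (trans (toℕ-mod i) (trans eq (sym (toℕ-mod j))))

  mod-toℕ : ∀ (i : Fin n) → toℕ i mod n ≡ i
  mod-toℕ i = Finₚ.toℕ-injective (trans (toℕ-mod (toℕ i)) (m<n⇒m%n≡m (Finₚ.toℕ<n i)))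

  at-toℕ : ∀ u (i : Fin n) → at u (toℕ i) ≡ lookup u i
  at-toℕ u i = cong (lookup u) (mod-toℕ i)

  at-periodic : ∀ u → Periodic n (at u)
  at-periodic u i = cong (lookup u) (mod-cong (trans (cong (λ j → (i + j) % n) (sym (ℕₚ.*-identityˡ n))) ([m+kn]%n≡m%n i 1 n)))

  at-nth : ∀ u i → at u i ≡ nth (toList u) (i % n)
  at-nth u i = trans (sym (nth-lookup u (i mod n))) (cong (nth (toList u)) (toℕ-mod i))

  at-nth-< : ∀ u {i} → i < n → at u i ≡ nth (toList u) i
  at-nth-< u {i} i<n = trans (at-nth u i) (cong (nth (toList u)) (m<n⇒m%n≡m i<n))

  at-ext : ∀ {u v : Vec Bool n} → (∀ i → at u i ≡ at v i) → u ≡ v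
  at-ext {u} {v} eq = trans (sym (Vecₚ.tabulate∘lookup u))
    (trans (Vecₚ.tabulate-cong (λ i → trans (sym (at-toℕ u i)) (trans (eq (toℕ i)) (at-toℕ v i)))) (Vecₚ.tabulate∘lookup v))

  word : (ℕ → Bool) → Vec Bool n
  word f = tabulate (f ∘ toℕ)

  at-word-% : ∀ f i → at (word f) i ≡ f (i % n)
  at-word-% f i = trans (Vecₚ.lookup∘tabulate (f ∘ toℕ) (i mod n)) (cong f (toℕ-mod i))

  at-word : ∀ {f} → Periodic n f → ∀ i → at (word f) i ≡ f i
  at-word {f} per i = trans (at-word-% f i) (periodic-% per i)

-- Together the two conditions of `isLucas` form a single cyclic one: a step inside the word falls
-- under `noConsec`, the step across the end under the condition on head and last letter. In length
-- 1 the letter is its own neighbour.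
isLucas⁻ : ∀ {n} .{{_ : NonZero n}} (u : Vec Bool n) → isLucas u ≡ true → Sparse (at u)
isLucas⁻ {suc m} u@(x ∷ xs) luc i with noConsec (toList u) in nc | x ∧ lastB (toList u) in hl
... | true | false with suc-% i (suc m)
... | inj₁ step = trans (cong₂ _∧_ (at-nth u i) (trans (at-nth u (suc i)) (cong (nth (toList u)) step))) (noConsec⁻ (toList u) nc (i % suc m))
... | inj₂ (last , wrap) = trans (cong₂ _∧_ at-last (trans (at-nth u (suc i)) (cong (nth (toList u)) wrap))) (trans (Boolₚ.∧-comm _ x) hl)
  where
  at-last : at u i ≡ lastB (toList u)
  at-last = trans (at-nth u i) (trans (cong (nth (toList u)) (trans (ℕₚ.suc-injective last) (sym (Vecₚ.length-toList xs)))) (sym (lastB-nth x (toList xs))))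

isLucas⁺ : ∀ {n} .{{_ : NonZero n}} (u : Vec Bool n) → Sparse (at u) → isLucas u ≡ true
isLucas⁺ {suc m} u@(x ∷ xs) sp = cong₂ _∧_ (noConsec⁺ (toList u) sparse) (cong not ends)
  where
  sparse : Sparse (nth (toList u))
  sparse k with suc k ℕ.<? suc m
  ... | yes lt = trans (sym (cong₂ _∧_ (at-nth-< u (ℕₚ.<⇒≤ lt)) (at-nth-< u lt))) (sp k)
  ... | no ¬lt = trans (cong (nth (toList u) k ∧_) (nth-beyond (toList u) (ℕₚ.≤-trans (ℕₚ.≤-reflexive (Vecₚ.length-toList u)) (ℕₚ.≮⇒≥ ¬lt)))) (Boolₚ.∧-zeroʳ _)
  ends : x ∧ lastB (toList u) ≡ false
  ends = trans (Boolₚ.∧-comm x _) (trans (cong₂ _∧_ (sym at-last) (sym at-first)) (sp m))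
    where
    at-last : at u m ≡ lastB (toList u)
    at-last = trans (at-nth-< u ℕₚ.≤-refl) (trans (cong (nth (toList u)) (sym (Vecₚ.length-toList xs))) (sym (lastB-nth x (toList xs))))
    at-first : at u (suc m) ≡ x
    at-first = at-periodic u 0

-- Enumeration of the vertices

words : ∀ n → List (Vec Bool n)
words zero    = [] ∷ []
words (suc n) = map (true ∷_) (words n) ++ map (false ∷_) (words n)

words-unique : ∀ n → Unique (words n)
words-unique zero    = [] ∷ []
words-unique (suc n) = Uniqueₚ.++⁺ (Uniqueₚ.map⁺ Vecₚ.∷-injectiveʳ (words-unique n)) (Uniqueₚ.map⁺ Vecₚ.∷-injectiveʳ (words-unique n)) disjoint
  where
  disjoint : ∀ {v} → ¬ (v ∈ map (true ∷_) (words n) × v ∈ map (false ∷_) (words n))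
  disjoint (t , f) with ∈-map⁻ (true ∷_) t | ∈-map⁻ (false ∷_) f
  ... | _ , _ , refl | _ , _ , ()

∈-words : ∀ {n} (u : Vec Bool n) → u ∈ words n
∈-words []          = here refl
∈-words (true  ∷ u) = ∈-++⁺ˡ (∈-map⁺ (true ∷_) (∈-words u))
∈-words (false ∷ u) = ∈-++⁺ʳ _ (∈-map⁺ (false ∷_) (∈-words u))

_≟ʷ_ : ∀ {n} → DecidableEquality (Vec Bool n)
_≟ʷ_ = Vecₚ.≡-dec Boolₚ._≟_

V-≡ : ∀ {n} {u v : V n} → proj₁ u ≡ proj₁ v → u ≡ v
V-≡ {u = u , p} {v = .u , q} refl = cong (u ,_) (Boolₚ.T-irrelevant p q)

opaque
  _≟ⱽ_ : ∀ {n} → DecidableEquality (V n)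
  u ≟ⱽ v = map′ V-≡ (cong proj₁) (proj₁ u ≟ʷ proj₁ v)

lucasOnly : ∀ {n} → List (Vec Bool n) → List (V n)
lucasOnly []       = []
lucasOnly (u ∷ us) with Boolₚ.T? (isLucas u)
... | yes p = (u , p) ∷ lucasOnly us
... | no  _ = lucasOnly us

∈-lucasOnly⁺ : ∀ {n} {us : List (Vec Bool n)} (v : V n) → proj₁ v ∈ us → v ∈ lucasOnly us
∈-lucasOnly⁺ {us = u ∷ us} (_ , p) (here refl) with Boolₚ.T? (isLucas u)
... | yes _ = here (V-≡ refl)
... | no ¬p = contradiction p ¬p
∈-lucasOnly⁺ {us = u ∷ us} v (there v∈) with Boolₚ.T? (isLucas u)
... | yes _ = there (∈-lucasOnly⁺ v v∈)
... | no  _ = ∈-lucasOnly⁺ v v∈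

∈-lucasOnly⁻ : ∀ {n} (us : List (Vec Bool n)) {v : V n} → v ∈ lucasOnly us → proj₁ v ∈ us
∈-lucasOnly⁻ (u ∷ us) v∈ with Boolₚ.T? (isLucas u)
∈-lucasOnly⁻ (u ∷ us) (here refl) | yes _ = here refl
∈-lucasOnly⁻ (u ∷ us) (there v∈)  | yes _ = there (∈-lucasOnly⁻ us v∈)
∈-lucasOnly⁻ (u ∷ us) v∈          | no  _ = there (∈-lucasOnly⁻ us v∈)

lucasOnly-unique : ∀ {n} {us : List (Vec Bool n)} → Unique us → Unique (lucasOnly us)
lucasOnly-unique []                          = []
lucasOnly-unique {us = u ∷ us} (u∉us ∷ uus) with Boolₚ.T? (isLucas u)
... | yes _ = All.tabulate (λ v∈ → λ { refl → All.lookup u∉us (∈-lucasOnly⁻ us v∈) refl }) ∷ lucasOnly-unique uus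
... | no  _ = lucasOnly-unique uus

opaque
  vertices : ∀ n → List (V n)
  vertices n = lucasOnly (words n)

  vertices-unique : ∀ n → Unique (vertices n)
  vertices-unique n = lucasOnly-unique (words-unique n)

  ∈-vertices : ∀ {n} (v : V n) → v ∈ vertices n
  ∈-vertices v = ∈-lucasOnly⁺ v (∈-words (proj₁ v))

-- The action of the dihedral group on the vertices

module _ {n : ℕ} .{{_ : NonZero n}} where

  infix 8 _!_
  _!_ : V n → ℕ → Bool
  v ! i = at (proj₁ v) i

  !-periodic : ∀ v → Periodic n (v !_)
  !-periodic v = at-periodic (proj₁ v)

  !-sparse : ∀ v → Sparse (v !_)
  !-sparse (u , luc) = isLucas⁻ u (Equivalence.to Boolₚ.T-≡ luc)

  !-ext : ∀ {u v} → (∀ i → u ! i ≡ v ! i) → u ≡ v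
  !-ext eq = V-≡ (at-ext eq)

  fromWord : (u : Vec Bool n) → Sparse (at u) → V n
  fromWord u sp = u , Equivalence.from Boolₚ.T-≡ (isLucas⁺ u sp)

  fromFun : (f : ℕ → Bool) → Periodic n f → Sparse f → V n
  fromFun f per sp = fromWord (word f) λ i → trans (cong₂ _∧_ (at-word {f = f} per i) (at-word {f = f} per (suc i))) (sp i)

  !-fromFun : ∀ {f} (per : Periodic n f) (sp : Sparse f) i → fromFun f per sp ! i ≡ f i
  !-fromFun per sp = at-word per

  private
    n≡ : n ≡ suc (pred n)
    n≡ = sym (ℕₚ.suc-pred n)

    rot-periodic : ∀ j v → Periodic n (λ i → v ! (i + j))
    rot-periodic j v i = trans (cong (v !_) (rearrange i n j)) (!-periodic v (i + j))
      where
      rearrange : ∀ i n j → i + n + j ≡ i + j + n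
      rearrange = ℕ-solve-∀

    rot-sparse : ∀ j v → Sparse (λ i → v ! (i + j))
    rot-sparse j v i = !-sparse v (i + j)

    ref-periodic : ∀ j v → Periodic n (λ k → v ! (pred n * (k + j)))
    ref-periodic j v k = periodic-≡ (!-periodic v) 0 (pred n) (shift (pred n) k j n)
      where
      shift : ∀ p k j n → p * (k + n + j) + 0 * n ≡ p * (k + j) + p * n
      shift = ℕ-solve-∀

    ref-sparse : ∀ j v → Sparse (λ k → v ! (pred n * (k + j)))
    -- A reflection reverses the pair: modulo n, -(k + j) is the successor of -(k + 1 + j).
    ref-sparse j v k = trans (cong (_∧ v ! (pred n * (suc k + j))) (periodic-≡ (!-periodic v) 1 0 step))
      (trans (Boolₚ.∧-comm (v ! suc (pred n * (suc k + j))) _) (!-sparse v (pred n * (suc k + j))))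
      where
      step′ : ∀ p k j → p * (k + j) + 1 * suc p ≡ suc (p * (suc k + j)) + 0
      step′ = ℕ-solve-∀
      step : pred n * (k + j) + 1 * n ≡ suc (pred n * (suc k + j)) + 0 * n
      step = trans (cong (λ m → pred n * (k + j) + 1 * m) n≡) (step′ (pred n) k j)

  opaque
    rot : ℕ → V n → V n
    rot j v = fromFun (λ i → v ! (i + j)) (rot-periodic j v) (rot-sparse j v)

    rot-! : ∀ j v i → rot j v ! i ≡ v ! (i + j)
    rot-! j v = !-fromFun (rot-periodic j v) (rot-sparse j v)

  opaque
    -- Modulo n, multiplication by pred n is negation.
    ref : ℕ → V n → V n
    ref j v = fromFun (λ k → v ! (pred n * (k + j))) (ref-periodic j v) (ref-sparse j v)

    -- The condition i + k + j ≡ 0 modulo n is symmetric in i and k and free of negation. It is the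
    -- form in which reflections are used from here on, with whichever solution i is at hand.
    ref-! : ∀ j v {i k} → n ∣ i + k + j → ref j v ! k ≡ v ! i
    ref-! j v {i} {k} (divides q eq) = trans (!-fromFun (ref-periodic j v) (ref-sparse j v) k)
      (sym (periodic-≡ (!-periodic v) (k + j) q reflected))
      where
      rearrange : ∀ i k j p → i + (k + j) * suc p ≡ i + k + j + p * (k + j)
      rearrange = ℕ-solve-∀
      open ≡-Reasoning
      reflected : i + (k + j) * n ≡ pred n * (k + j) + q * n
      reflected = begin
        i + (k + j) * n                ≡⟨ cong (λ m → i + (k + j) * m) n≡ ⟩
        i + (k + j) * suc (pred n)     ≡⟨ rearrange i k j (pred n) ⟩
        i + k + j + pred n * (k + j)   ≡⟨ cong (_+ pred n * (k + j)) eq ⟩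
        q * n + pred n * (k + j)       ≡⟨ ℕₚ.+-comm (q * n) _ ⟩
        pred n * (k + j) + q * n       ∎

  neg : ℕ → ℕ
  neg j = pred n * j

  n∣neg+ : ∀ j → n ∣ neg j + j
  n∣neg+ j = divides j (trans (ℕₚ.+-comm (pred n * j) j) (trans (cong (_* j) (sym n≡)) (ℕₚ.*-comm n j)))

  rot-∣ : ∀ {j} v → n ∣ j → rot j v ≡ v
  rot-∣ {j} v (divides q refl) = !-ext λ i → trans (rot-! j v i) (periodic-* (!-periodic v) q i)

  rot-rot : ∀ i j v → rot i (rot j v) ≡ rot (i + j) v
  rot-rot i j v = !-ext λ k → begin
    rot i (rot j v) ! k     ≡⟨ rot-! i (rot j v) k ⟩
    rot j v ! (k + i)       ≡⟨ rot-! j v (k + i) ⟩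
    v ! (k + i + j)         ≡⟨ cong (v !_) (ℕₚ.+-assoc k i j) ⟩
    v ! (k + (i + j))       ≡⟨ rot-! (i + j) v k ⟨
    rot (i + j) v ! k       ∎
    where open ≡-Reasoning

  mirror : ∀ k j → n ∣ neg (k + j) + k + j
  mirror k j = subst (n ∣_) (sym (ℕₚ.+-assoc (neg (k + j)) k j)) (n∣neg+ (k + j))

  ref-ref : ∀ j v → ref j (ref j v) ≡ v
  ref-ref j v = !-ext λ k → trans (ref-! j (ref j v) (mirror k j))
    (ref-! j v (subst (λ s → n ∣ s + j) (ℕₚ.+-comm (neg (k + j)) k) (mirror k j)))

  -- With `ref-rot` this replaces the relation s r = r⁻¹ s of the dihedral group: a rotation on
  -- either side is absorbed into the index of the reflection, so that no inverse appears.
  rot-ref : ∀ j i v → rot j (ref i v) ≡ ref (j + i) v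
  rot-ref j i v = !-ext λ k → trans (rot-! j (ref i v) k)
    (trans (ref-! i v {neg (k + (j + i))} {k + j} (subst (n ∣_) (rearrange (neg (k + (j + i))) k j i) (mirror k (j + i)))) (sym (ref-! (j + i) v (mirror k (j + i)))))
    where
    rearrange : ∀ m k j i → m + k + (j + i) ≡ m + (k + j) + i
    rearrange = ℕ-solve-∀

  ref-rot : ∀ i j v → ref (i + j) (rot j v) ≡ ref i v
  ref-rot i j v = !-ext λ k → trans (ref-! (i + j) (rot j v) (mirror k (i + j)))
    (trans (rot-! j v _) (sym (ref-! i v (subst (n ∣_) (rearrange (neg (k + (i + j))) k i j) (mirror k (i + j))))))
    where
    rearrange : ∀ m k i j → m + k + (i + j) ≡ m + j + k + i
    rearrange = ℕ-solve-∀

-- Automorphisms of the Lucas cube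

≢⇒≡not : ∀ {a b} → a ≢ b → b ≡ not a
≢⇒≡not {a} {b} a≢b = sym (trans (cong not (Boolₚ.¬-not a≢b)) (Boolₚ.not-involutive b))

lookup-ext : ∀ {n} {u v : Vec Bool n} → (∀ i → lookup u i ≡ lookup v i) → u ≡ v
lookup-ext {u = u} {v} eq = trans (sym (Vecₚ.tabulate∘lookup u)) (trans (Vecₚ.tabulate-cong eq) (Vecₚ.tabulate∘lookup v))

-- Flips and the Hamming distance

flip : ∀ {n} → Fin n → Vec Bool n → Vec Bool n
flip i u = updateAt u i not

flip-injective : ∀ {n} {i j : Fin n} (u : Vec Bool n) → flip i u ≡ flip j u → i ≡ j
flip-injective {i = i} {j} u eq with i Fin.≟ j
... | yes i≡j = i≡j
... | no  i≢j = contradiction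
  (trans (sym (Vecₚ.lookup∘updateAt i u)) (trans (cong (λ w → lookup w i) eq) (Vecₚ.lookup∘updateAt′ i j i≢j u)))
  (Boolₚ.not-¬ refl ∘ sym)

hamming-refl : ∀ {n} (u : Vec Bool n) → hamming u u ≡ 0
hamming-refl []          = refl
hamming-refl (true  ∷ u) = hamming-refl u
hamming-refl (false ∷ u) = hamming-refl u

hamming-sym : ∀ {n} (u v : Vec Bool n) → hamming u v ≡ hamming v u
hamming-sym []          []          = refl
hamming-sym (true  ∷ u) (true  ∷ v) = hamming-sym u v
hamming-sym (true  ∷ u) (false ∷ v) = cong suc (hamming-sym u v)
hamming-sym (false ∷ u) (true  ∷ v) = cong suc (hamming-sym u v)
hamming-sym (false ∷ u) (false ∷ v) = hamming-sym u v

hamming-triangle : ∀ {n} (u v w : Vec Bool n) → hamming u w ≤ hamming u v + hamming v w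
hamming-triangle []          []          []          = z≤n
hamming-triangle (true  ∷ u) (true  ∷ v) (true  ∷ w) = hamming-triangle u v w
hamming-triangle (true  ∷ u) (true  ∷ v) (false ∷ w) = ℕₚ.≤-trans (s≤s (hamming-triangle u v w)) (ℕₚ.≤-reflexive (sym (ℕₚ.+-suc _ _)))
hamming-triangle (true  ∷ u) (false ∷ v) (true  ∷ w) = ℕₚ.≤-trans (hamming-triangle u v w) (ℕₚ.+-mono-≤ (ℕₚ.n≤1+n _) (ℕₚ.n≤1+n _))
hamming-triangle (true  ∷ u) (false ∷ v) (false ∷ w) = s≤s (hamming-triangle u v w)
hamming-triangle (false ∷ u) (true  ∷ v) (true  ∷ w) = s≤s (hamming-triangle u v w)
hamming-triangle (false ∷ u) (true  ∷ v) (false ∷ w) = ℕₚ.≤-trans (hamming-triangle u v w) (ℕₚ.+-mono-≤ (ℕₚ.n≤1+n _) (ℕₚ.n≤1+n _))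
hamming-triangle (false ∷ u) (false ∷ v) (true  ∷ w) = ℕₚ.≤-trans (s≤s (hamming-triangle u v w)) (ℕₚ.≤-reflexive (sym (ℕₚ.+-suc _ _)))
hamming-triangle (false ∷ u) (false ∷ v) (false ∷ w) = hamming-triangle u v w

hamming-0 : ∀ {n} (u v : Vec Bool n) → hamming u v ≡ 0 → u ≡ v
hamming-0 []          []          _  = refl
hamming-0 (true  ∷ u) (true  ∷ v) eq = cong (true ∷_) (hamming-0 u v eq)
hamming-0 (false ∷ u) (false ∷ v) eq = cong (false ∷_) (hamming-0 u v eq)

hamming-1 : ∀ {n} (u v : Vec Bool n) → hamming u v ≡ 1 → ∃ λ i → v ≡ flip i u
hamming-1 []          []          ()
hamming-1 (true  ∷ u) (true  ∷ v) eq = let (i , e) = hamming-1 u v eq in Fin.suc i , cong (true ∷_) e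
hamming-1 (false ∷ u) (false ∷ v) eq = let (i , e) = hamming-1 u v eq in Fin.suc i , cong (false ∷_) e
hamming-1 (true  ∷ u) (false ∷ v) eq = Fin.zero , cong (false ∷_) (sym (hamming-0 u v (ℕₚ.suc-injective eq)))
hamming-1 (false ∷ u) (true  ∷ v) eq = Fin.zero , cong (true ∷_) (sym (hamming-0 u v (ℕₚ.suc-injective eq)))

hamming-suc : ∀ {n h} (u v : Vec Bool n) → hamming u v ≡ suc h → ∃ λ i → lookup u i ≢ lookup v i
hamming-suc []          []          ()
hamming-suc (true  ∷ u) (true  ∷ v) eq = let (i , d) = hamming-suc u v eq in Fin.suc i , d
hamming-suc (false ∷ u) (false ∷ v) eq = let (i , d) = hamming-suc u v eq in Fin.suc i , d
hamming-suc (true  ∷ u) (false ∷ v) eq = Fin.zero , λ ()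
hamming-suc (false ∷ u) (true  ∷ v) eq = Fin.zero , λ ()

hamming-flip-≡ : ∀ {n} (i : Fin n) (u v : Vec Bool n) → lookup u i ≡ lookup v i → hamming (flip i u) v ≡ suc (hamming u v)
hamming-flip-≡ Fin.zero    (true  ∷ u) (true  ∷ v) _  = refl
hamming-flip-≡ Fin.zero    (false ∷ u) (false ∷ v) _  = refl
hamming-flip-≡ (Fin.suc i) (true  ∷ u) (true  ∷ v) eq = hamming-flip-≡ i u v eq
hamming-flip-≡ (Fin.suc i) (true  ∷ u) (false ∷ v) eq = cong suc (hamming-flip-≡ i u v eq)
hamming-flip-≡ (Fin.suc i) (false ∷ u) (true  ∷ v) eq = cong suc (hamming-flip-≡ i u v eq)
hamming-flip-≡ (Fin.suc i) (false ∷ u) (false ∷ v) eq = hamming-flip-≡ i u v eq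

-- The flipped word agrees with v at i and flipping it again restores u, so `hamming-flip-≡` applies
-- to it.
hamming-flip-≢ : ∀ {n} (i : Fin n) (u v : Vec Bool n) → lookup u i ≢ lookup v i → hamming u v ≡ suc (hamming (flip i u) v)
hamming-flip-≢ i u v u≢v = trans (cong (λ w → hamming w v) (sym (flip-flip u)))
  (hamming-flip-≡ i (flip i u) v (trans (Vecₚ.lookup∘updateAt i u) (sym (≢⇒≡not u≢v))))
  where
  flip-flip : ∀ u → flip i (flip i u) ≡ u
  flip-flip u = trans (Vecₚ.updateAt-updateAt i u)
    (trans (Vecₚ.updateAt-cong i Boolₚ.not-involutive u) (Vecₚ.updateAt-id i u))

hamming-flip : ∀ {n} (i : Fin n) (u : Vec Bool n) → hamming u (flip i u) ≡ 1
hamming-flip i u = trans (hamming-sym u (flip i u)) (trans (hamming-flip-≡ i u u refl) (cong suc (hamming-refl u)))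

_∘ᴬ_ : ∀ {n} → Aut n → Aut n → Aut n
τ ∘ᴬ σ = record
  { perm      = Aut.perm τ ↔-∘ Aut.perm σ
  ; preserves = λ u v → mk⇔
      (Equivalence.to (Aut.preserves τ _ _) ∘ Equivalence.to (Aut.preserves σ u v))
      (Equivalence.from (Aut.preserves σ u v) ∘ Equivalence.from (Aut.preserves τ _ _))
  }

_⁻¹ᴬ : ∀ {n} → Aut n → Aut n
_⁻¹ᴬ {n} σ = record
  { perm      = ↔-sym (Aut.perm σ)
  ; preserves = λ u v → mk⇔
      (λ adj → Equivalence.from (Aut.preserves σ _ _) (subst₂ (Adj n) (sym (to-from u)) (sym (to-from v)) adj))
      (λ adj → subst₂ (Adj n) (to-from u) (to-from v) (Equivalence.to (Aut.preserves σ _ _) adj))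
  }
  where
  to-from : ∀ u → Inverse.to (Aut.perm σ) (Inverse.from (Aut.perm σ) u) ≡ u
  to-from = Inverse.strictlyInverseˡ (Aut.perm σ)

SameOrbit-refl : ∀ {n} (v : V n) → SameOrbit n v v
SameOrbit-refl v = record { perm = ↔-id _ ; preserves = λ _ _ → mk⇔ id id } , refl

SameOrbit-sym : ∀ {n} {u v : V n} → SameOrbit n u v → SameOrbit n v u
SameOrbit-sym (σ , refl) = σ ⁻¹ᴬ , Inverse.strictlyInverseʳ (Aut.perm σ) _

SameOrbit-trans : ∀ {n} {u v w : V n} → SameOrbit n u v → SameOrbit n v w → SameOrbit n u w
SameOrbit-trans (σ , refl) (τ , refl) = τ ∘ᴬ σ , refl

-- Rotations and reflections as automorphisms; distances in the Lucas cube

module _ {n : ℕ} .{{_ : NonZero n}} where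

  next : Fin n → Fin n
  next i = suc (toℕ i) mod n

  %-+-cong : ∀ {a b} c → a % n ≡ b % n → (a + c) % n ≡ (b + c) % n
  %-+-cong {a} {b} c eq = trans (%-distribˡ-+ a c n) (trans (cong (λ x → (x + c % n) % n) eq) (sym (%-distribˡ-+ b c n)))

  %-+-∣ : ∀ a {b} → n ∣ b → (a + b) % n ≡ a % n
  %-+-∣ a (divides q refl) = [m+kn]%n≡m%n a q n

  -- Adding `neg c` undoes adding c modulo n and takes the place of subtraction.
  %-+-cancel : ∀ {a b} c → (a + c) % n ≡ (b + c) % n → a % n ≡ b % n
  %-+-cancel {a} {b} c eq = trans (sym (drop a)) (trans (%-+-cong (neg c) eq) (drop b))
    where
    drop : ∀ a → (a + c + neg c) % n ≡ a % n
    drop a = trans (cong (_% n) (trans (ℕₚ.+-assoc a c (neg c)) (cong (a ℕ.+_) (ℕₚ.+-comm c (neg c))))) (%-+-∣ a (n∣neg+ c))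

  toℕ-mod-+ : ∀ a c → (toℕ (a mod n) + c) mod n ≡ (a + c) mod n
  toℕ-mod-+ a c = mod-cong (%-+-cong c (trans (cong (_% n) (toℕ-mod a)) (m%n%n≡m%n a n)))

  next-mod : ∀ i → next (i mod n) ≡ suc i mod n
  next-mod i = trans (cong (_mod n) (ℕₚ.+-comm 1 (toℕ (i mod n)))) (trans (toℕ-mod-+ i 1) (cong (_mod n) (ℕₚ.+-comm i 1)))

  sparse-next⁺ : ∀ (u : Vec Bool n) → (∀ i → lookup u i ≡ true → lookup u (next i) ≡ true → ⊥) → Sparse (at u)
  sparse-next⁺ u h i = ∧-false⁺ λ p q → h (i mod n) p (trans (cong (lookup u) (next-mod i)) q)

  sparse-next⁻ : ∀ (v : V n) i → lookup (proj₁ v) i ≡ true → lookup (proj₁ v) (next i) ≡ true → ⊥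
  sparse-next⁻ v i p q = ∧-false⁻ (!-sparse v (toℕ i)) (trans (at-toℕ (proj₁ v) i) p) q

  module _ (φ ψ : Fin n → Fin n) (φψ : ∀ i → φ (ψ i) ≡ i) (ψφ : ∀ i → ψ (φ i) ≡ i) where

    -- If u and v differ exactly at i, the words reindexed by φ differ exactly at `ψ i`. Rotations
    -- and reflections are both of this kind.
    Adj-reindex : ∀ {u v u′ v′ : V n} → (∀ k → lookup (proj₁ u′) k ≡ lookup (proj₁ u) (φ k)) →
                  (∀ k → lookup (proj₁ v′) k ≡ lookup (proj₁ v) (φ k)) → Adj n u v → Adj n u′ v′
    Adj-reindex {u} {v} {u′} {v′} u′≡ v′≡ adj with hamming-1 (proj₁ u) (proj₁ v) adj
    ... | i , v≡ = subst (λ w → hamming (proj₁ u′) w ≡ 1) (sym (lookup-ext v′≡flip)) (hamming-flip (ψ i) (proj₁ u′))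
      where
      open ≡-Reasoning
      v′≡flip : ∀ k → lookup (proj₁ v′) k ≡ lookup (flip (ψ i) (proj₁ u′)) k
      v′≡flip k with k Fin.≟ ψ i
      ... | yes refl = begin
        lookup (proj₁ v′) (ψ i)                    ≡⟨ v′≡ (ψ i) ⟩
        lookup (proj₁ v) (φ (ψ i))                 ≡⟨ cong₂ lookup v≡ (φψ i) ⟩
        lookup (flip i (proj₁ u)) i                ≡⟨ Vecₚ.lookup∘updateAt i (proj₁ u) ⟩
        not (lookup (proj₁ u) i)                   ≡⟨ cong (not ∘ lookup (proj₁ u)) (φψ i) ⟨
        not (lookup (proj₁ u) (φ (ψ i)))           ≡⟨ cong not (u′≡ (ψ i)) ⟨
        not (lookup (proj₁ u′) (ψ i))              ≡⟨ Vecₚ.lookup∘updateAt (ψ i) (proj₁ u′) ⟨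
        lookup (flip (ψ i) (proj₁ u′)) (ψ i)       ∎
      ... | no k≢ψi = begin
        lookup (proj₁ v′) k                        ≡⟨ v′≡ k ⟩
        lookup (proj₁ v) (φ k)                     ≡⟨ cong (λ w → lookup w (φ k)) v≡ ⟩
        lookup (flip i (proj₁ u)) (φ k)            ≡⟨ Vecₚ.lookup∘updateAt′ (φ k) i (λ φk≡i → k≢ψi (trans (sym (ψφ k)) (cong ψ φk≡i))) (proj₁ u) ⟩
        lookup (proj₁ u) (φ k)                     ≡⟨ u′≡ k ⟨
        lookup (proj₁ u′) k                        ≡⟨ Vecₚ.lookup∘updateAt′ k (ψ i) k≢ψi (proj₁ u′) ⟨
        lookup (flip (ψ i) (proj₁ u′)) k           ∎

  rot-Adj : ∀ j {u v : V n} → Adj n u v → Adj n (rot j u) (rot j v)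
  rot-Adj j {u} {v} = Adj-reindex (shift j) (shift (neg j)) (cancel (neg j) j (n∣neg+ j)) (cancel j (neg j) (subst (n ∣_) (ℕₚ.+-comm (neg j) j) (n∣neg+ j)))
                        {u} {v} {rot j u} {rot j v} (lookup-rot u) (lookup-rot v)
    where
    shift : ℕ → Fin n → Fin n
    shift j k = (toℕ k + j) mod n
    cancel : ∀ a b → n ∣ a + b → ∀ k → shift b (shift a k) ≡ k
    cancel a b n∣ k = trans (toℕ-mod-+ (toℕ k + a) b) (trans (mod-cong (trans (cong (_% n) (ℕₚ.+-assoc (toℕ k) a b)) (%-+-∣ (toℕ k) n∣))) (mod-toℕ k))
    lookup-rot : ∀ v k → lookup (proj₁ (rot j v)) k ≡ lookup (proj₁ v) (shift j k)
    lookup-rot v k = trans (sym (at-toℕ (proj₁ (rot j v)) k)) (rot-! j v (toℕ k))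

  ref-Adj : ∀ j {u v : V n} → Adj n u v → Adj n (ref j u) (ref j v)
  ref-Adj j {u} {v} = Adj-reindex φ φ φφ φφ {u} {v} {ref j u} {ref j v} (lookup-ref u) (lookup-ref v)
    where
    φ : Fin n → Fin n
    φ k = neg (toℕ k + j) mod n
    sum : ∀ k → (toℕ (φ k) + (toℕ k + j)) % n ≡ 0
    sum k = trans (%-+-cong (toℕ k + j) (trans (cong (_% n) (toℕ-mod (neg (toℕ k + j)))) (m%n%n≡m%n (neg (toℕ k + j)) n)))
                  (n∣m⇒m%n≡0 _ n (n∣neg+ (toℕ k + j)))
    swap : ∀ a b c → a + (b + c) ≡ b + (a + c)
    swap = ℕ-solve-∀
    φφ : ∀ k → φ (φ k) ≡ k
    -- Both k and `φ (φ k)` solve x + φ k + j ≡ 0 modulo n.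
    φφ k = Finₚ.toℕ-injective (trans (sym (m<n⇒m%n≡m (Finₚ.toℕ<n (φ (φ k)))))
      (trans (%-+-cancel (toℕ (φ k) + j) (trans (sum (φ k)) (sym (trans (cong (_% n) (swap (toℕ k) (toℕ (φ k)) j)) (sum k)))))
        (m<n⇒m%n≡m (Finₚ.toℕ<n k))))
    lookup-ref : ∀ v k → lookup (proj₁ (ref j v)) k ≡ lookup (proj₁ v) (φ k)
    lookup-ref v k = trans (sym (at-toℕ (proj₁ (ref j v)) k)) (ref-! j v {neg (toℕ k + j)} {toℕ k} (mirror (toℕ k) j))

  rotAut : ℕ → Aut n
  rotAut j = record
    { perm      = mk↔ₛ′ (rot j) (rot (neg j)) (inverse j (neg j) j∣) (inverse (neg j) j (n∣neg+ j))
    ; preserves = λ u v → mk⇔ (rot-Adj j {u} {v})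
        (subst₂ (Adj n) (inverse (neg j) j (n∣neg+ j) u) (inverse (neg j) j (n∣neg+ j) v) ∘ rot-Adj (neg j) {rot j u} {rot j v})
    }
    where
    inverse : ∀ a b → n ∣ a + b → ∀ v → rot a (rot b v) ≡ v
    inverse a b n∣ v = trans (rot-rot a b v) (rot-∣ v n∣)
    j∣ : n ∣ j + neg j
    j∣ = subst (n ∣_) (ℕₚ.+-comm (neg j) j) (n∣neg+ j)

  refAut : ℕ → Aut n
  refAut j = record
    { perm      = mk↔ₛ′ (ref j) (ref j) (ref-ref j) (ref-ref j)
    ; preserves = λ u v → mk⇔ (ref-Adj j {u} {v}) (subst₂ (Adj n) (ref-ref j u) (ref-ref j v) ∘ ref-Adj j {ref j u} {ref j v})
    }

  below : ∀ (x y : Vec Bool n) → (∀ i → lookup x i ≡ true → lookup y i ≡ true) → Sparse (at y) → Sparse (at x)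
  below x y x≤y sp i = ∧-false⁺ λ p q → ∧-false⁻ (sp i) (x≤y _ p) (x≤y _ q)

  -- Λ_n is isometric in the cube: clear the bits of u outside v first, then set the missing ones.
  towards : ∀ {h} (u v : V n) → hamming (proj₁ u) (proj₁ v) ≡ suc h →
            ∃ λ u′ → Adj n u u′ × hamming (proj₁ u′) (proj₁ v) ≡ h
  towards {h} u@(x , _) v@(y , _) eq with Finₚ.any? (λ i → (lookup x i Boolₚ.≟ true) ×-dec (lookup y i Boolₚ.≟ false))
  ... | yes (i , xi , yi) = fromWord (flip i x) (below (flip i x) x flip≤ (!-sparse u)) , hamming-flip i x
                          , ℕₚ.suc-injective (trans (sym (hamming-flip-≢ i x y λ x≡y → contradiction (trans (sym xi) (trans x≡y yi)) λ ())) eq)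
    where
    flip≤ : ∀ k → lookup (flip i x) k ≡ true → lookup x k ≡ true
    flip≤ k p with k Fin.≟ i
    ... | yes refl = xi
    ... | no  k≢i  = trans (sym (Vecₚ.lookup∘updateAt′ k i k≢i x)) p
  ... | no x≤y with hamming-suc x y eq
  ... | i , xi≢yi = fromWord (flip i x) (below (flip i x) y flip≤ (!-sparse v)) , hamming-flip i x
                  , ℕₚ.suc-injective (trans (sym (hamming-flip-≢ i x y xi≢yi)) eq)
    where
    x≤y′ : ∀ k → lookup x k ≡ true → lookup y k ≡ true
    x≤y′ k p with lookup y k in q
    ... | true  = refl
    ... | false = contradiction (k , p , q) x≤y
    flip≤ : ∀ k → lookup (flip i x) k ≡ true → lookup y k ≡ true
    flip≤ k p with k Fin.≟ i
    ... | no  k≢i  = x≤y′ k (trans (sym (Vecₚ.lookup∘updateAt′ k i k≢i x)) p)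
    ... | yes refl = trans (≢⇒≡not xi≢yi) (trans (sym (Vecₚ.lookup∘updateAt i x)) p)

  -- `towards` provides a path of length h inside Λ_n, and its image is a path of the same length.
  -- For an automorphism and its inverse the two inequalities combine to `isometry`.
  nonexpansive : (φ : V n → V n) → (∀ u v → Adj n u v → Adj n (φ u) (φ v)) →
                 ∀ h u v → hamming (proj₁ u) (proj₁ v) ≡ h → hamming (proj₁ (φ u)) (proj₁ (φ v)) ≤ h
  nonexpansive φ φ-adj zero    u v eq = ℕₚ.≤-reflexive (trans (cong (λ w → hamming (proj₁ (φ u)) (proj₁ (φ w))) (sym (V-≡ {u = u} {v} (hamming-0 _ _ eq)))) (hamming-refl (proj₁ (φ u))))
  nonexpansive φ φ-adj (suc h) u v eq with towards u v eq
  ... | u′ , adj , eq′ = ℕₚ.≤-trans (hamming-triangle (proj₁ (φ u)) (proj₁ (φ u′)) (proj₁ (φ v)))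
                           (ℕₚ.+-mono-≤ (ℕₚ.≤-reflexive (φ-adj u u′ adj)) (nonexpansive φ φ-adj h u′ v eq′))

  Dihedral : V n → V n → Set
  Dihedral u v = (∃ λ j → rot j u ≡ v) ⊎ (∃ λ j → ref j u ≡ v)

  Dihedral⇒SameOrbit : ∀ {u v} → Dihedral u v → SameOrbit n u v
  Dihedral⇒SameOrbit (inj₁ (j , eq)) = rotAut j , eq
  Dihedral⇒SameOrbit (inj₂ (j , eq)) = refAut j , eq

  zeros : Vec Bool n
  zeros = replicate n false

  lookup-zeros : ∀ i → lookup zeros i ≡ false
  lookup-zeros i = Vecₚ.lookup-replicate i false

  origin : V n
  origin = fromWord zeros λ i → cong (_∧ at zeros (suc i)) (lookup-zeros (i mod n))

  -- Every automorphism is a rotation or a reflection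

  module _ (2≤n : 2 ≤ n) where

    -- This is where n ≥ 2 enters. It makes the words with a single 1 vertices, which fails for n =
    -- 1.
    next-≢ : ∀ i → next i ≢ i
    next-≢ i eq with suc-% (toℕ i) n
    ... | inj₁ step = ℕₚ.1+n≢n (trans (cong suc (sym (m<n⇒m%n≡m (Finₚ.toℕ<n i))))
                        (trans (sym step) (trans (sym (toℕ-mod (suc (toℕ i)))) (cong toℕ eq))))
    ... | inj₂ (last , wrap) = ℕₚ.<⇒≢ 2≤n (trans (cong suc (sym (trans (m<n⇒m%n≡m (Finₚ.toℕ<n i)) i≡0))) last)
      where
      i≡0 : toℕ i ≡ 0
      i≡0 = trans (sym (cong toℕ eq)) (trans (toℕ-mod (suc (toℕ i))) wrap)

    pairWord : Fin n → Fin n → Vec Bool n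
    pairWord a b = tabulate λ k → does (k Fin.≟ a) ∨ does (k Fin.≟ b)

    pairWord⁻ : ∀ {a b} k → lookup (pairWord a b) k ≡ true → k ≡ a ⊎ k ≡ b
    pairWord⁻ {a} {b} k p with k Fin.≟ a | k Fin.≟ b | trans (sym (Vecₚ.lookup∘tabulate (λ k → does (k Fin.≟ a) ∨ does (k Fin.≟ b)) k)) p
    ... | yes k≡a | _       | _ = inj₁ k≡a
    ... | no _    | yes k≡b | _ = inj₂ k≡b

    pairWord-first : ∀ a b → lookup (pairWord a b) a ≡ true
    pairWord-first a b with a Fin.≟ a | Vecₚ.lookup∘tabulate (λ k → does (k Fin.≟ a) ∨ does (k Fin.≟ b)) a
    ... | yes _  | eq = eq
    ... | no a≢a | _  = contradiction refl a≢a

    pairWord-second : ∀ a b → lookup (pairWord a b) b ≡ true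
    pairWord-second a b with b Fin.≟ b | Vecₚ.lookup∘tabulate (λ k → does (k Fin.≟ a) ∨ does (k Fin.≟ b)) b
    ... | yes _  | eq = trans eq (Boolₚ.∨-zeroʳ _)
    ... | no b≢b | _  = contradiction refl b≢b

    pair : (a b : Fin n) → b ≢ next a → a ≢ next b → V n
    pair a b b≢ a≢ = fromWord (pairWord a b) (sparse-next⁺ (pairWord a b) λ i p q → clash (pairWord⁻ i p) (pairWord⁻ (next i) q))
      where
      clash : ∀ {i} → i ≡ a ⊎ i ≡ b → next i ≡ a ⊎ next i ≡ b → ⊥
      clash (inj₁ refl) (inj₁ q) = next-≢ _ q
      clash (inj₁ refl) (inj₂ q) = b≢ (sym q)
      clash (inj₂ refl) (inj₁ q) = a≢ (sym q)
      clash (inj₂ refl) (inj₂ q) = next-≢ _ q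

    flip-zeros⁻ : ∀ i k → lookup (flip i zeros) k ≡ true → k ≡ i
    flip-zeros⁻ i k p with k Fin.≟ i
    ... | yes k≡i = k≡i
    ... | no  k≢i = contradiction (trans (sym p) (trans (Vecₚ.lookup∘updateAt′ k i k≢i zeros) (lookup-zeros k))) λ ()

    unit : Fin n → V n
    unit i = fromWord (flip i zeros) (sparse-next⁺ (flip i zeros) λ k p q → next-≢ k (trans (flip-zeros⁻ i _ q) (sym (flip-zeros⁻ i k p))))

    module _ (σ : Aut n) where
      private
        f g : V n → V n
        f = Inverse.to (Aut.perm σ)
        g = Inverse.from (Aut.perm σ)

        fg : ∀ v → f (g v) ≡ v
        fg = Inverse.strictlyInverseˡ (Aut.perm σ)

        gf : ∀ v → g (f v) ≡ v
        gf = Inverse.strictlyInverseʳ (Aut.perm σ)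

        f-adj : ∀ u v → Adj n u v → Adj n (f u) (f v)
        f-adj u v = Equivalence.to (Aut.preserves σ u v)

        g-adj : ∀ u v → Adj n u v → Adj n (g u) (g v)
        g-adj u v = Equivalence.to (Aut.preserves (σ ⁻¹ᴬ) u v)

        f-injective : ∀ {u v} → f u ≡ f v → u ≡ v
        f-injective {u} {v} eq = trans (sym (gf u)) (trans (cong g eq) (gf v))

      isometry : ∀ u v → hamming (proj₁ (f u)) (proj₁ (f v)) ≡ hamming (proj₁ u) (proj₁ v)
      isometry u v = ℕₚ.≤-antisym (nonexpansive f f-adj _ u v refl)
        (subst₂ (λ a b → hamming (proj₁ a) (proj₁ b) ≤ hamming (proj₁ (f u)) (proj₁ (f v))) (gf u) (gf v)
          (nonexpansive g g-adj _ (f u) (f v) refl))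

      private
        neighbour : ∀ i → ∃ λ k → proj₁ (f (unit i)) ≡ flip k (proj₁ (f origin))
        neighbour i = hamming-1 _ _ (f-adj origin (unit i) (hamming-flip i zeros))

      -- The position at which `f (unit i)` differs from `f origin`. It is defined before `f origin`
      -- is known, because the injectivity of π is what shows that `f origin` is the origin.
      π : Fin n → Fin n
      π i = proj₁ (neighbour i)

      π-injective : ∀ {i j} → π i ≡ π j → i ≡ j
      π-injective {i} {j} eq = flip-injective zeros (cong proj₁ (f-injective {unit i} {unit j} (V-≡
        (trans (proj₂ (neighbour i)) (trans (cong (λ k → flip k (proj₁ (f origin))) eq) (sym (proj₂ (neighbour j))))))))

      -- The origin is the only vertex of degree n: in a vertex with a 1 at l, the bit after l cannot be flipped.
      lookup-f-origin : ∀ l → lookup (proj₁ (f origin)) l ≡ false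
      lookup-f-origin l with lookup (proj₁ (f origin)) l in vl
      ... | false = refl
      -- If `f origin` had a 1 at l, flipping the letter after l would put two 1s side by side. So π
      -- would miss `next l` and embed n positions into n - 1.
      ... | true  = contradiction (Finₚ.injective⇒≤ {f = punched} punched-injective) (too-small refl)
        where
        v = proj₁ (f origin)
        vl⁺ : lookup v (next l) ≡ false
        vl⁺ with lookup v (next l) in q
        ... | false = refl
        ... | true  = ⊥-elim (sparse-next⁻ (f origin) l vl q)
        missed : ∀ i → next l ≢ π i
        missed i eq = sparse-next⁻ (f (unit i)) l
          (trans (cong (λ w → lookup w l) fe) (trans (Vecₚ.lookup∘updateAt′ l (next l) (λ e → next-≢ l (sym e)) v) vl))
          (trans (cong (λ w → lookup w (next l)) fe) (trans (Vecₚ.lookup∘updateAt (next l) v) (cong not vl⁺)))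
          where
          fe : proj₁ (f (unit i)) ≡ flip (next l) v
          fe = trans (proj₂ (neighbour i)) (cong (λ k → flip k v) (sym eq))
        n≡ : n ≡ suc (pred n)
        n≡ = sym (ℕₚ.suc-pred n)
        cast-≢ : ∀ {a b : Fin n} → a ≢ b → subst Fin n≡ a ≢ subst Fin n≡ b
        cast-≢ a≢b eq = a≢b (subst-injective n≡ eq)
        punched : Fin n → Fin (pred n)
        punched i = Fin.punchOut (cast-≢ (missed i))
        punched-injective : ∀ {i j} → punched i ≡ punched j → i ≡ j
        punched-injective {i} {j} eq = π-injective (subst-injective n≡ (Finₚ.punchOut-injective (cast-≢ (missed i)) (cast-≢ (missed j)) eq))
        too-small : ∀ {m} → m ≡ n → ¬ (m ≤ pred n)
        too-small refl = ℕₚ.<⇒≱ (ℕₚ.≤-reflexive (sym n≡))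

      f-origin : f origin ≡ origin
      f-origin = V-≡ (lookup-ext λ i → trans (lookup-f-origin i) (sym (lookup-zeros i)))

      f-unit : ∀ i → f (unit i) ≡ unit (π i)
      f-unit i = V-≡ (trans (proj₂ (neighbour i)) (cong (λ v → flip (π i) (proj₁ v)) f-origin))

      private
        unit-isometry : ∀ v i → hamming (flip (π i) zeros) (proj₁ (f v)) ≡ hamming (flip i zeros) (proj₁ v)
        unit-isometry v i = trans (cong (λ w → hamming (proj₁ w) (proj₁ (f v))) (sym (f-unit i))) (isometry (unit i) v)

        origin-isometry : ∀ v → hamming zeros (proj₁ (f v)) ≡ hamming zeros (proj₁ v)
        origin-isometry v = trans (cong (λ w → hamming (proj₁ w) (proj₁ (f v))) (sym f-origin)) (isometry origin v)

        further : ∀ i {w} → lookup w i ≡ false → hamming (flip i zeros) w ≡ suc (hamming zeros w)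
        further i {w} wi = hamming-flip-≡ i zeros w (trans (lookup-zeros i) (sym wi))

        closer : ∀ i {w} → lookup w i ≡ true → hamming zeros w ≡ suc (hamming (flip i zeros) w)
        closer i {w} wi = hamming-flip-≢ i zeros w λ eq → contradiction (trans (sym (lookup-zeros i)) (trans eq wi)) λ ()

        2+≢ : ∀ {m} → m ≢ suc (suc m)
        2+≢ ()

      -- A word has a 1 at i iff it is nearer to the unit at i than to the origin, and f respects
      -- both distances. A disagreement between the two letters would make some m equal to m + 2.
      lookup-f : ∀ v i → lookup (proj₁ (f v)) (π i) ≡ lookup (proj₁ v) i
      lookup-f v i with lookup (proj₁ (f v)) (π i) in p | lookup (proj₁ v) i in q
      ... | true  | true  = refl
      ... | false | false = refl
      ... | true  | false = contradiction (trans (sym (origin-isometry v)) (trans (closer (π i) p) (cong suc (trans (unit-isometry v i) (further i q))))) 2+≢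
      ... | false | true  = contradiction (trans (sym (unit-isometry v i)) (trans (further (π i) p) (cong suc (trans (origin-isometry v) (closer i q))))) 2+≢

      private
        q : ℕ → Fin n
        q i = π (i mod n)

      -- Otherwise the two image positions support a Lucas word `w`, and by `lookup-f` its preimage
      -- has 1s at the neighbouring positions i and i + 1.
      adjacent : ∀ i → q (suc i) ≡ next (q i) ⊎ q i ≡ next (q (suc i))
      adjacent i with q (suc i) Fin.≟ next (q i) | q i Fin.≟ next (q (suc i))
      ... | yes up | _        = inj₁ up
      ... | no _   | yes down = inj₂ down
      ... | no ¬up | no ¬down = ⊥-elim (sparse-next⁻ v (i mod n) (bit (i mod n) (pairWord-first (q i) (q (suc i))))
              (trans (cong (lookup (proj₁ v)) (next-mod i)) (bit (suc i mod n) (pairWord-second (q i) (q (suc i))))))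
        where
        w = pair (q i) (q (suc i)) ¬up ¬down
        v = g w
        bit : ∀ k → lookup (proj₁ w) (π k) ≡ true → lookup (proj₁ v) k ≡ true
        bit k p = trans (sym (lookup-f v k)) (trans (cong (λ x → lookup (proj₁ x) (π k)) (fg w)) p)

      next-injective : ∀ {i j} → next i ≡ next j → i ≡ j
      next-injective {i} {j} eq = Finₚ.toℕ-injective (trans (sym (m<n⇒m%n≡m (Finₚ.toℕ<n i)))
        (trans (%-+-cancel 1 (trans (cong (_% n) (ℕₚ.+-comm (toℕ i) 1)) (trans (trans (sym (toℕ-mod (suc (toℕ i)))) (trans (cong toℕ eq) (toℕ-mod (suc (toℕ j))))) (cong (_% n) (ℕₚ.+-comm 1 (toℕ j))))))
          (m<n⇒m%n≡m (Finₚ.toℕ<n j))))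

      -- Only for n = 2 can a step be undone by the following one, and then next is an involution.
      fold-back : ∀ {i} → q (suc (suc i)) ≡ q i → ∀ x → next (next x) ≡ x
      fold-back {i} eq x = trans (next-mod (suc (toℕ x))) (trans (mod-cong two-steps) (mod-toℕ x))
        where
        %-eq : suc (suc i) % n ≡ i % n
        %-eq = trans (sym (toℕ-mod (suc (suc i)))) (trans (cong toℕ (π-injective eq)) (toℕ-mod i))
        n∣2 : 2 % n ≡ 0 % n
        n∣2 = %-+-cancel i %-eq
        two-steps : suc (suc (toℕ x)) % n ≡ toℕ x % n
        two-steps = %-+-cong (toℕ x) n∣2

      -- A walk with steps ±1 that turned back would return to `q i` after two steps. By injectivity
      -- of π this forces n to divide 2, and then a step down is also a step up.
      ascending : q 1 ≡ next (q 0) → ∀ i → q (suc i) ≡ next (q i)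
      ascending up zero = up
      ascending up (suc i) with adjacent (suc i)
      ... | inj₁ up′  = up′
      ... | inj₂ down = trans back (trans (sym (fold-back {i} back (q i))) (cong next (sym (ascending up i))))
        where
        back : q (suc (suc i)) ≡ q i
        back = sym (next-injective (trans (sym (ascending up i)) down))

      descending : q 0 ≡ next (q 1) → ∀ i → q i ≡ next (q (suc i))
      descending down zero = down
      descending down (suc i) with adjacent (suc i)
      ... | inj₂ down′ = down′
      ... | inj₁ up    = trans (sym (fold-back {i} back (q (suc i)))) (cong next (sym up))
        where
        back : q (suc (suc i)) ≡ q i
        back = trans up (sym (descending down i))

      -- `lookup-f` expresses the letters of v by those of `f v`, hence the direction. An ascending
      -- walk has `q i` ≡ i + c and is a rotation; a descending one keeps `q i` + i ≡ c and is a
      -- reflection.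
      dihedral : ∀ v → Dihedral (f v) v
      dihedral v with adjacent 0
      ... | inj₁ up = inj₁ (c , !-ext λ i → trans (rot-! c (f v) i) (trans (cong (lookup (proj₁ (f v))) (sym (position i))) (lookup-f v (i mod n))))
        where
        c = toℕ (q 0)
        position : ∀ i → q i ≡ (i + c) mod n
        position zero    = sym (mod-toℕ (q 0))
        position (suc i) = trans (ascending up i) (trans (cong next (position i)) (next-mod (i + c)))
      ... | inj₂ down = inj₂ (neg c , !-ext λ i → trans (ref-! (neg c) (f v) {toℕ (q i)} {i} (opposite i))
                          (trans (at-toℕ (proj₁ (f v)) (q i)) (lookup-f v (i mod n))))
        where
        c = toℕ (q 0)
        position : ∀ i → (toℕ (q i) + i) % n ≡ c % n
        position zero    = cong (_% n) (ℕₚ.+-identityʳ c)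
        position (suc i) = trans (cong (_% n) (ℕₚ.+-suc (toℕ (q (suc i))) i))
          (trans (%-+-cong i (trans (sym (m%n%n≡m%n (suc (toℕ (q (suc i)))) n)) (cong (_% n) (sym (toℕ-mod (suc (toℕ (q (suc i)))))))))
            (trans (cong (λ k → (toℕ k + i) % n) (sym (descending down i))) (position i)))
        opposite : ∀ i → n ∣ toℕ (q i) + i + neg c
        opposite i = m%n≡0⇒n∣m _ n (trans (%-+-cong (neg c) (position i))
          (n∣m⇒m%n≡0 _ n (subst (n ∣_) (ℕₚ.+-comm (neg c) c) (n∣neg+ c))))

-- In length 1 the letter is its own cyclic neighbour and must be 0. This settles the case n = 1,
-- which `dihedral` leaves out.
V₁-irrelevant : (u v : V 1) → u ≡ v
V₁-irrelevant u v = !-ext λ i → trans (vanish u i) (sym (vanish v i))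
  where
  only : (i j : Fin 1) → i ≡ j
  only Fin.zero Fin.zero = refl
  vanish : ∀ (u : V 1) i → u ! i ≡ false
  vanish u i = trans (sym (Boolₚ.∧-idem (u ! i))) (trans (cong (λ k → u ! i ∧ lookup (proj₁ u) k) (only (i mod 1) (suc i mod 1))) (!-sparse u i))

SameOrbit⇒Dihedral : ∀ {n} .{{_ : NonZero n}} {u v : V n} → SameOrbit n u v → Dihedral u v
SameOrbit⇒Dihedral {suc zero}    {u} {v} _ = inj₁ (0 , V₁-irrelevant (rot 0 u) v)
SameOrbit⇒Dihedral {suc (suc n)} {u} {v} u~v with SameOrbit-sym u~v
... | σ , refl = dihedral (s≤s (s≤s z≤n)) σ v

-- Counting fixed words

-- The word a h b has no two consecutive 1s. A border letter `true` forces the adjacent letter of h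
-- to be 0, while a border letter `false` is no constraint.
good : ∀ {m} → Bool → Vec Bool m → Bool → Bool
good a []      b = not (a ∧ b)
good a (x ∷ h) b = not (a ∧ x) ∧ good x h b

not-true⁻ : ∀ {a} → not a ≡ true → a ≡ false
not-true⁻ {false} _ = refl

∧-true⁻ : ∀ {a b} → a ∧ b ≡ true → a ≡ true × b ≡ true
∧-true⁻ {true} {true} _ = refl , refl

good⁻ : ∀ {m} a (h : Vec Bool m) b → good a h b ≡ true →
        Sparse (nth (a ∷ toList h)) × nth (a ∷ toList h) m ∧ b ≡ false
good⁻ a [] b g = (λ { zero → Boolₚ.∧-zeroʳ a ; (suc i) → refl }) , not-true⁻ g
good⁻ a (x ∷ h) b g with ∧-true⁻ {not (a ∧ x)} g
... | ax , g′ with good⁻ x h b g′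
... | sp , end = (λ { zero → not-true⁻ ax ; (suc i) → sp i }) , end

good⁺ : ∀ {m} a (h : Vec Bool m) b → Sparse (nth (a ∷ toList h)) → nth (a ∷ toList h) m ∧ b ≡ false →
        good a h b ≡ true
good⁺ a []      b sp end = cong not end
good⁺ a (x ∷ h) b sp end = cong₂ _∧_ (cong not (sp 0)) (good⁺ x h b (sp ∘ suc) end)

-- Without constraint there are F (m + 2) linear words of length m, and each border letter 1 fixes
-- one letter and lowers the index by one.
room : Bool → Bool → ℕ
room false false = 2
room false true  = 1
room true  false = 1
room true  true  = 0

∑-words-suc : ∀ m (f : Vec Bool (suc m) → ℤ) →
              ∑ (words (suc m)) f ≡ ∑ (words m) (λ h → f (true ∷ h)) ℤ.+ ∑ (words m) (λ h → f (false ∷ h))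
∑-words-suc m f = trans (∑-++ (map (true ∷_) (words m)) (map (false ∷_) (words m)) f)
                        (cong₂ ℤ._+_ (∑-map (true ∷_) (words m) f) (∑-map (false ∷_) (words m) f))

count-good : ∀ m a b → ∑ (words m) (λ h → ⟦ good a h b Boolₚ.≟ true ⟧) ≡ + fib (room a b + m)
count-good zero    false false = refl
count-good zero    false true  = refl
count-good zero    true  false = refl
count-good zero    true  true  = refl
count-good (suc m) false b     = trans (∑-words-suc m _) (trans (cong₂ ℤ._+_ (count-good m true b) (count-good m false b)) (step b))
  where
  step : ∀ b → + fib (room true b + m) ℤ.+ + fib (room false b + m) ≡ + fib (room false b + suc m)
  step false = cong +_ (trans (ℕₚ.+-comm (fib (1 + m)) (fib (2 + m))) (cong (λ k → fib (2 + k)) (sym (ℕₚ.+-suc 0 m))))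
  step true  = cong +_ (ℕₚ.+-comm (fib m) (fib (1 + m)))
count-good (suc m) true  b     = trans (∑-words-suc m _) (trans (cong₂ ℤ._+_ (∑-zero (words m)) (count-good m false b)) (trans (ℤₚ.+-identityˡ _) (step b)))
  where
  step : ∀ b → + fib (room false b + m) ≡ + fib (room true b + suc m)
  step false = refl
  step true  = refl

isLucas-good : ∀ {m} x (h : Vec Bool m) → isLucas (x ∷ h) ≡ good x h x
isLucas-good x h = ends x h x
  where
  ends : ∀ {m} x (h : Vec Bool m) y → noConsec (x ∷ toList h) ∧ not (y ∧ lastB (x ∷ toList h)) ≡ good x h y
  ends x     []          y = cong not (Boolₚ.∧-comm y x)
  ends true  (true  ∷ h) y = refl
  ends true  (false ∷ h) y = ends false h y
  ends false (z     ∷ h) y = ends z h y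

fib-lucas : ∀ m → fib m + fib (2 + m) ≡ lucas (suc m)
fib-lucas zero          = refl
fib-lucas (suc zero)    = refl
fib-lucas (suc (suc m)) = trans (rearrange (fib (suc m)) (fib m) (fib (3 + m)) (fib (2 + m)))
                                (cong₂ _+_ (fib-lucas (suc m)) (fib-lucas m))
  where
  rearrange : ∀ a b c d → a + b + (c + d) ≡ a + c + (b + d)
  rearrange = ℕ-solve-∀

-- The first letter x is also the right neighbour of the last one, so the rest has border x on both
-- sides: F m words start with 1 and F (m + 2) with 0.
count-lucas : ∀ m → ∑ (words (suc m)) (λ u → ⟦ isLucas u Boolₚ.≟ true ⟧) ≡ + lucas (suc m)
count-lucas m = begin
  ∑ (words (suc m)) (λ u → ⟦ isLucas u Boolₚ.≟ true ⟧)              ≡⟨ ∑-words-suc m _ ⟩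
  count true ℤ.+ count false                                        ≡⟨ cong₂ ℤ._+_ (closed true) (closed false) ⟩
  + (fib m + fib (2 + m))                                           ≡⟨ cong +_ (fib-lucas m) ⟩
  + lucas (suc m)                                                   ∎
  where
  open ≡-Reasoning
  count : Bool → ℤ
  count x = ∑ (words m) (λ h → ⟦ isLucas (x ∷ h) Boolₚ.≟ true ⟧)
  closed : ∀ x → count x ≡ + fib (room x x + m)
  closed x = trans (∑-cong (words m) (λ {h} _ → cong (λ b → ⟦ b Boolₚ.≟ true ⟧) (isLucas-good x h))) (count-good m x x)

∑-lucasOnly : ∀ {n} (us : List (Vec Bool n)) → ∑ (lucasOnly us) (λ _ → 1ℤ) ≡ ∑ us (λ u → ⟦ isLucas u Boolₚ.≟ true ⟧)
∑-lucasOnly []       = refl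
∑-lucasOnly (u ∷ us) with Boolₚ.T? (isLucas u)
... | yes p = cong₂ ℤ._+_ (sym (⟦⟧-yes (isLucas u Boolₚ.≟ true) (Equivalence.to Boolₚ.T-≡ p))) (∑-lucasOnly us)
... | no ¬p = trans (∑-lucasOnly us) (sym (trans (cong (λ s → s ℤ.+ ∑ us (λ u → ⟦ isLucas u Boolₚ.≟ true ⟧))
                (⟦⟧-no (isLucas u Boolₚ.≟ true) (¬p ∘ Equivalence.from Boolₚ.T-≡))) (ℤₚ.+-identityˡ _)))

opaque
  unfolding vertices

  ∑-vertices : ∀ n → ∑ (vertices n) (λ _ → 1ℤ) ≡ ∑ (words n) (λ u → ⟦ isLucas u Boolₚ.≟ true ⟧)
  ∑-vertices n = ∑-lucasOnly (words n)

-- Words fixed by a rotation or by a reflection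

module _ {n : ℕ} .{{_ : NonZero n}} where

  opaque
    -- Makes maps into the vertices total. The default `origin` does occur, for instance when a word
    -- that is not periodic is cut to length d, but only where `∑-count-bij` requires nothing.
    clip : Vec Bool n → V n
    clip u with Boolₚ.T? (isLucas u)
    ... | yes p = u , p
    ... | no _  = origin

    clip-sparse : ∀ u → Sparse (at u) → proj₁ (clip u) ≡ u
    clip-sparse u sp with Boolₚ.T? (isLucas u)
    ... | yes _ = refl
    ... | no ¬p = contradiction (Equivalence.from Boolₚ.T-≡ (isLucas⁺ u sp)) ¬p

  clip-! : ∀ {f} → Periodic n f → Sparse f → ∀ i → clip (word f) ! i ≡ f i
  clip-! {f} per sp i = trans (cong (λ u → at u i) (clip-sparse (word f) sparse)) (at-word per i)
    where
    sparse : Sparse (at (word f))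
    sparse i = trans (cong₂ _∧_ (at-word {f = f} per i) (at-word {f = f} per (suc i))) (sp i)

  rot-fixed⁻ : ∀ {d v} → rot d v ≡ v → Periodic d (v !_)
  rot-fixed⁻ {d} {v} eq i = trans (sym (rot-! d v i)) (cong (_! i) eq)

  rot-fixed⁺ : ∀ {d v} → Periodic d (v !_) → rot d v ≡ v
  rot-fixed⁺ {d} {v} per = !-ext λ i → trans (rot-! d v i) (per i)

  Periodic-∣ : ∀ {d f} → d ∣ n → Periodic d f → Periodic n f
  Periodic-∣ (divides q refl) per = periodic-* per q

-- Sparseness of a function on ℕ does not mention its period, so a word of length n fixed by the
-- shift by d is the repetition of a Lucas word of length d.
count-rot-fixed : ∀ {n d} .{{_ : NonZero n}} .{{_ : NonZero d}} → d ∣ n →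
                  ∑ (vertices n) (λ v → ⟦ rot d v ≟ⱽ v ⟧) ≡ + lucas d
count-rot-fixed {n} {d@(suc d-1)} d∣n = begin
  ∑ (vertices n) (λ v → ⟦ rot d v ≟ⱽ v ⟧)    ≡⟨ ∑-count-bij _≟ⱽ_ _≟ⱽ_ (vertices-unique n) (vertices-unique d) ∈-vertices ∈-vertices
                                                  (λ v → rot d v ≟ⱽ v) (λ _ → yes tt) restrict repeat to-inv from-inv ⟩
  ∑ (vertices d) (λ _ → 1ℤ)                  ≡⟨ ∑-vertices d ⟩
  ∑ (words d) (λ u → ⟦ isLucas u Boolₚ.≟ true ⟧) ≡⟨ count-lucas d-1 ⟩
  + lucas d                                  ∎
  where
  open ≡-Reasoning
  restrict : V n → V d
  restrict v = clip (word (v !_))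
  repeat : V d → V n
  repeat u = clip (word (u !_))
  repeat-! : ∀ u i → repeat u ! i ≡ u ! i
  repeat-! u = clip-! (Periodic-∣ d∣n (!-periodic u)) (!-sparse u)
  to-inv : ∀ {v : V n} → rot d v ≡ v → ⊤ × repeat (restrict v) ≡ v
  to-inv {v} eq = tt , !-ext λ i → trans (repeat-! (restrict v) i) (clip-! (rot-fixed⁻ eq) (!-sparse v) i)
  from-inv : ∀ {u : V d} → ⊤ → rot d (repeat u) ≡ repeat u × restrict (repeat u) ≡ u
  from-inv {u} _ = rot-fixed⁺ per , !-ext λ i → trans (clip-! per (!-sparse (repeat u)) i) (repeat-! u i)
    where
    per : Periodic d (repeat u !_)
    per i = trans (repeat-! u (i + d)) (trans (!-periodic u i) (sym (repeat-! u i)))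

-- For d ∣ n these correspond to the Lucas words of length d fixed by the j-th reflection of ℤ/d.
-- They are counted inside `V n`, where all d can be treated together.
palindromes : ∀ {n} .{{_ : NonZero n}} → ℕ → ℕ → ℤ
palindromes {n} d j = ∑ (vertices n) (λ v → ⟦ (rot d v ≟ⱽ v) ×-dec (ref j v ≟ⱽ v) ⟧)

-- Words folded along the reflection i ↦ −a − i of ℤ/d, which is bent at M + b/2: their values on 0 … M determine them.
module Fold (M : ℕ) (a b : Bool) where
  ⌊_⌋ : Bool → ℕ
  ⌊ false ⌋ = 0
  ⌊ true  ⌋ = 1

  -- The letters a and b tell the kind of the two bends. At `false` the reflection fixes a position;
  -- at `true` it exchanges two neighbours, which therefore both carry 0. That is exactly the effect
  -- of a border letter in `good a h b`.
  d : ℕ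
  d = M + M + ⌊ b ⌋ + ⌊ a ⌋

  ⌊⌋≤1 : ∀ c → ⌊ c ⌋ ≤ 1
  ⌊⌋≤1 false = z≤n
  ⌊⌋≤1 true  = ℕₚ.≤-refl

  Symmetric : (ℕ → Bool) → Set
  Symmetric f = ∀ i k → d ∣ i + k + ⌊ a ⌋ → f i ≡ f k

  module _ .{{_ : NonZero d}} where

    M<d : M < d
    M<d = subst (M <_) (sym (ℕₚ.+-assoc (M + M) ⌊ b ⌋ ⌊ a ⌋))
            (half M (⌊ b ⌋ + ⌊ a ⌋) (subst (0 <_) (ℕₚ.+-assoc (M + M) ⌊ b ⌋ ⌊ a ⌋) (ℕ.>-nonZero⁻¹ d)))
      where
      half : ∀ m c → 0 < m + m + c → m < m + m + c
      half zero    c 0<c = 0<c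
      half (suc m) c _   = ℕₚ.≤-trans (ℕₚ.≤-trans (s≤s (s≤s (ℕₚ.m≤m+n m m))) (ℕₚ.≤-reflexive (cong suc (sym (ℕₚ.+-suc m m))))) (ℕₚ.m≤m+n _ c)

    fold : ℕ → ℕ
    fold r with r ℕ.≤? M
    ... | yes _ = r
    ... | no  _ = d ∸ ⌊ a ⌋ ∸ r

    fold-≤ : ∀ {r} → r ≤ M → fold r ≡ r
    fold-≤ {r} r≤M with r ℕ.≤? M
    ... | yes _  = refl
    ... | no r≰M = contradiction r≤M r≰M

    reflect : ∀ {r s} → r + s + ⌊ a ⌋ ≡ d → d ∸ ⌊ a ⌋ ∸ s ≡ r
    reflect {r} {s} eq = trans (cong (λ e → e ∸ ⌊ a ⌋ ∸ s) (sym eq)) (trans (cong (_∸ s) (ℕₚ.m+n∸n≡m (r + s) ⌊ a ⌋)) (ℕₚ.m+n∸n≡m r s))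

    folded-sum : ∀ r s → r + s + ⌊ a ⌋ ≡ d → r + s ≡ M + M + ⌊ b ⌋
    folded-sum r s = ℕₚ.+-cancelʳ-≡ ⌊ a ⌋ (r + s) (M + M + ⌊ b ⌋)

    -- Here r + s = 2 M + b. If only one of them is at most M, it is the fold of the other. If both
    -- are, then r = s = M; and they cannot both exceed M, as the sum would be at least 2 M + 2.
    fold-sym : ∀ r s → r + s + ⌊ a ⌋ ≡ d → fold r ≡ fold s
    fold-sym r s eq with r ℕ.≤? M | s ℕ.≤? M
    ... | yes r≤M | no _    = sym (reflect eq)
    ... | no _    | yes s≤M = reflect (trans (cong (_+ ⌊ a ⌋) (ℕₚ.+-comm s r)) eq)
    ... | yes r≤M | yes s≤M = trans (tight r≤M s≤M sum≥) (sym (tight s≤M r≤M (ℕₚ.≤-trans sum≥ (ℕₚ.≤-reflexive (ℕₚ.+-comm r s)))))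
      where
      sum≥ : M + M ≤ r + s
      sum≥ = ℕₚ.≤-trans (ℕₚ.m≤m+n (M + M) ⌊ b ⌋) (ℕₚ.≤-reflexive (sym (folded-sum r s eq)))
      tight : ∀ {x y} → x ≤ M → y ≤ M → M + M ≤ x + y → x ≡ M
      tight {x} {y} x≤M y≤M le = ℕₚ.≤-antisym x≤M (ℕₚ.+-cancelʳ-≤ M M x (ℕₚ.≤-trans le (ℕₚ.+-monoʳ-≤ x y≤M)))
    ... | no r≰M  | no s≰M  = contradiction
      (ℕₚ.≤-trans (ℕₚ.+-mono-≤ (ℕₚ.≰⇒> r≰M) (ℕₚ.≰⇒> s≰M)) (ℕₚ.≤-trans (ℕₚ.≤-reflexive (folded-sum r s eq)) (ℕₚ.+-monoʳ-≤ (M + M) (⌊⌋≤1 b))))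
      (ℕₚ.<⇒≱ (ℕₚ.≤-reflexive (count M)))
      where
      count : ∀ M → suc (M + M + 1) ≡ suc M + suc M
      count = ℕ-solve-∀

    -- For residues the sum r + s + a is at most 2 d - 1, so it is 0 or d, and it is 0 only if r = s
    -- = 0.
    residues : ∀ {r s} → r < d → s < d → d ∣ r + s + ⌊ a ⌋ → r ≡ s ⊎ r + s + ⌊ a ⌋ ≡ d
    residues {r} {s} r<d s<d (divides zero          eq) = inj₁ (trans (ℕₚ.m+n≡0⇒m≡0 r r+s≡0) (sym (ℕₚ.m+n≡0⇒n≡0 r r+s≡0)))
      where
      r+s≡0 : r + s ≡ 0
      r+s≡0 = ℕₚ.m+n≡0⇒m≡0 (r + s) eq
    residues {r} {s} r<d s<d (divides (suc zero)    eq) = inj₂ (trans eq (ℕₚ.+-identityʳ d))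
    residues {r} {s} r<d s<d (divides (suc (suc q)) eq) = contradiction
      (ℕₚ.≤-trans (s≤s (ℕₚ.≤-trans (ℕₚ.+-monoʳ-≤ (r + s) (⌊⌋≤1 a)) (ℕₚ.≤-reflexive (ℕₚ.+-comm (r + s) 1))))
        (ℕₚ.≤-trans (ℕₚ.≤-reflexive (sym (ℕₚ.+-suc (suc r) s))) (ℕₚ.≤-trans (ℕₚ.+-mono-≤ r<d s<d) (ℕₚ.m≤m+n (d + d) (q * d)))))
      (ℕₚ.≤⇒≯ (ℕₚ.≤-reflexive (sym (trans eq (sym (ℕₚ.+-assoc d d (q * d)))))))

    ≡-residue : ∀ f → Periodic d f → Symmetric f → ∀ i → f (fold (i % d)) ≡ f i
    ≡-residue f per symm i = trans (unfold (i % d) (m%n<n i d)) (periodic-% per i)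
      where
      unfold : ∀ r → r < d → f (fold r) ≡ f r
      unfold r r<d with r ℕ.≤? M
      ... | yes _  = refl
      ... | no r≰M = symm _ r (divides 1 (trans (trans (cong (_+ ⌊ a ⌋) (ℕₚ.m∸n+n≡m r≤)) (ℕₚ.m∸n+n≡m a≤d)) (sym (ℕₚ.*-identityˡ d))))
        where
        a≤d : ⌊ a ⌋ ≤ d
        a≤d = ℕₚ.m≤n+m ⌊ a ⌋ (M + M + ⌊ b ⌋)
        ≤-drop : ∀ c {e} → r < e + ⌊ c ⌋ → r ≤ e
        ≤-drop false {e} lt = ℕₚ.<⇒≤ (ℕₚ.≤-trans lt (ℕₚ.≤-reflexive (ℕₚ.+-identityʳ e)))
        ≤-drop true  {e} lt = ℕₚ.≤-pred (ℕₚ.≤-trans lt (ℕₚ.≤-reflexive (ℕₚ.+-comm e 1)))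
        r≤ : r ≤ d ∸ ⌊ a ⌋
        r≤ = ℕₚ.≤-trans (≤-drop a r<d) (ℕₚ.≤-reflexive (sym (ℕₚ.m+n∸n≡m (M + M + ⌊ b ⌋) ⌊ a ⌋)))

    fold≤M : ∀ {r} → r < d → fold r ≤ M
    fold≤M {r} r<d with r ℕ.≤? M
    ... | yes r≤M = r≤M
    ... | no r≰M  = ℕₚ.≤-trans (ℕₚ.∸-monoʳ-≤ (d ∸ ⌊ a ⌋) (ℕₚ.≰⇒> r≰M)) (ℕₚ.≤-trans (ℕₚ.≤-reflexive (cong (_∸ suc M) (ℕₚ.m+n∸n≡m (M + M + ⌊ b ⌋) ⌊ a ⌋)))
        (ℕₚ.≤-trans (ℕₚ.∸-monoˡ-≤ (suc M) (ℕₚ.≤-trans (ℕₚ.+-monoʳ-≤ (M + M) (⌊⌋≤1 b)) (ℕₚ.≤-reflexive (count M)))) (ℕₚ.≤-reflexive (ℕₚ.m+n∸n≡m M (suc M)))))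
      where
      count : ∀ M → M + M + 1 ≡ M + suc M
      count = ℕ-solve-∀

    unfolded : Vec Bool (suc M) → ℕ → Bool
    unfolded h i = nth (toList h) (fold (i % d))

    module _ (h : Vec Bool (suc M)) where
      private
        F H : ℕ → Bool
        F = unfolded h
        H = nth (toList h)

      unfolded-≤ : ∀ {i} → i ≤ M → F i ≡ H i
      unfolded-≤ i≤M = cong H (trans (cong fold (m<n⇒m%n≡m (ℕₚ.≤-<-trans i≤M M<d))) (fold-≤ i≤M))

      unfolded-periodic : Periodic d F
      unfolded-periodic i = cong (H ∘ fold) (trans (cong (λ e → (i + e) % d) (sym (ℕₚ.*-identityˡ d))) ([m+kn]%n≡m%n i 1 d))

      unfolded-symmetric : Symmetric F
      unfolded-symmetric i k d∣ with residues (m%n<n i d) (m%n<n k d) residue-∣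
        where
        open ≡-Reasoning
        residue-∣ : d ∣ i % d + k % d + ⌊ a ⌋
        residue-∣ = m%n≡0⇒n∣m _ d (begin
          (i % d + k % d + ⌊ a ⌋) % d               ≡⟨ %-+-cong {d} ⌊ a ⌋ (%-distribˡ-+ i k d) ⟨
          (i + k + ⌊ a ⌋) % d                       ≡⟨ n∣m⇒m%n≡0 _ d d∣ ⟩
          0                                         ∎)
      ... | inj₁ eq = cong (H ∘ fold) eq
      ... | inj₂ eq = cong H (fold-sym (i % d) (k % d) eq)

      -- A pair of neighbours r, r + 1 modulo d either lies in 0 ... M, or is the mirror image of
      -- such a pair, or crosses a bend. Crossing happens at d - 1 with a = `true` or at M with b =
      -- `true`, and there the border letter has put a 0.
      unfolded-sparse : good a h b ≡ true → Sparse F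
      unfolded-sparse g i = trans (sym (cong₂ _∧_ (periodic-% unfolded-periodic i) wrap)) (reduced (i % d) (m%n<n i d))
        where
        wrap : F (suc (i % d)) ≡ F (suc i)
        wrap = trans (sym (periodic-* unfolded-periodic (i / d) (suc (i % d)))) (cong (F ∘ suc) (sym (m≡m%n+[m/n]*n i d)))
        sparse = proj₁ (good⁻ a h b g)
        middle = proj₂ (good⁻ a h b g)
        inner : ∀ {r} → r < M → F r ∧ F (suc r) ≡ false
        inner {r} r<M = trans (cong₂ _∧_ (unfolded-≤ (ℕₚ.<⇒≤ r<M)) (unfolded-≤ r<M)) (sparse (suc r))
        left : a ≡ true → F 0 ≡ false
        left eq = trans (unfolded-≤ z≤n) (trans (cong (_∧ H 0) (sym eq)) (sparse 0))
        right : b ≡ true → F M ≡ false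
        right eq = trans (unfolded-≤ ℕₚ.≤-refl) (trans (sym (Boolₚ.∧-identityʳ (H M))) (trans (cong (H M ∧_) (sym eq)) middle))
        opposite : ∀ r s → r + s + ⌊ a ⌋ ≡ d → F r ≡ F s
        opposite r s eq = unfolded-symmetric r s (divides 1 (trans eq (sym (ℕₚ.*-identityˡ d))))
        squeeze : ∀ {x y} → M ≤ x → M ≤ y → x + y ≡ M + M → x ≡ M
        squeeze {x} M≤x M≤y e = ℕₚ.≤-antisym (ℕₚ.+-cancelʳ-≤ M x M (ℕₚ.≤-trans (ℕₚ.+-monoʳ-≤ x M≤y) (ℕₚ.≤-reflexive e))) M≤x
        middle-only : ∀ c {r s} → M ≤ r → M ≤ s → suc r + s ≡ M + M + ⌊ c ⌋ → c ≡ true × s ≡ M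
        middle-only true  {r} {s} M≤r M≤s eq = refl , squeeze M≤s M≤r (trans (ℕₚ.+-comm s r) (ℕₚ.suc-injective (trans eq (ℕₚ.+-comm (M + M) 1))))
        middle-only false {r} {s} M≤r M≤s eq = contradiction (ℕₚ.≤-trans (ℕₚ.+-mono-≤ (s≤s M≤r) M≤s) (ℕₚ.≤-reflexive (trans eq (ℕₚ.+-identityʳ (M + M)))))
          (ℕₚ.<⇒≱ ℕₚ.≤-refl)
        last-only : ∀ c {r} → r < d → ¬ (suc r + ⌊ c ⌋ ≤ d) → c ≡ true × r + 0 + ⌊ c ⌋ ≡ d
        last-only false {r} r<d ≰ = contradiction (ℕₚ.≤-trans (ℕₚ.≤-reflexive (ℕₚ.+-identityʳ (suc r))) r<d) ≰
        last-only true  {r} r<d ≰ = refl , ℕₚ.≤-antisym (ℕₚ.≤-trans (ℕₚ.≤-reflexive r+1) r<d)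
            (ℕₚ.≤-trans (ℕₚ.≤-pred (ℕₚ.≤-trans (ℕₚ.≰⇒> ≰) (ℕₚ.≤-reflexive (ℕₚ.+-comm (suc r) 1)))) (ℕₚ.≤-reflexive (sym r+1)))
          where
          r+1 : r + 0 + 1 ≡ suc r
          r+1 = trans (cong (_+ 1) (ℕₚ.+-identityʳ r)) (ℕₚ.+-comm r 1)
        rearrange : ∀ s r c → suc r + s + c ≡ s + (suc r + c)
        rearrange = ℕ-solve-∀
        reduced : ∀ r → r < d → F r ∧ F (suc r) ≡ false
        reduced r r<d with r ℕ.<? M
        ... | yes r<M = inner r<M
        ... | no r≮M with suc r + ⌊ a ⌋ ℕ.≤? d
        ... | no ≰   = let (a≡true , r+a≡d) = last-only a r<d ≰ in
                       cong (_∧ F (suc r)) (trans (opposite r 0 r+a≡d) (left a≡true))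
        ... | yes le with d ∸ (suc r + ⌊ a ⌋) | trans (rearrange (d ∸ (suc r + ⌊ a ⌋)) r ⌊ a ⌋) (ℕₚ.m∸n+n≡m le)
        ... | s | eq with s ℕ.<? M
        ... | yes s<M = trans (cong₂ _∧_ (opposite r (suc s) (trans (cong (_+ ⌊ a ⌋) (ℕₚ.+-suc r s)) eq)) (opposite (suc r) s eq))
                          (trans (Boolₚ.∧-comm (F (suc s)) (F s)) (inner s<M))
        ... | no s≮M = let (b≡true , s≡M) = middle-only b (ℕₚ.≮⇒≥ r≮M) (ℕₚ.≮⇒≥ s≮M) (ℕₚ.+-cancelʳ-≡ ⌊ a ⌋ (suc r + s) _ eq) in
                       trans (cong (F r ∧_) (trans (opposite (suc r) s eq) (trans (cong F s≡M) (right b≡true)))) (Boolₚ.∧-zeroʳ (F r))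

  module _ {n : ℕ} .{{_ : NonZero n}} .{{_ : NonZero d}} (d∣n : d ∣ n) where

    private
      Symmetric⁺ : ∀ {v : V n} → Symmetric (v !_) → ref ⌊ a ⌋ v ≡ v
      Symmetric⁺ {v} symm = !-ext λ k → trans (ref-! ⌊ a ⌋ v {neg (k + ⌊ a ⌋)} {k} (mirror k ⌊ a ⌋)) (symm _ k (∣-trans d∣n (mirror k ⌊ a ⌋)))

      -- `ref` knows index sums divisible by n, whereas `Symmetric` asks for all those divisible by
      -- d. The solutions i and `i′` agree modulo d, so periodicity identifies their letters.
      Symmetric⁻ : ∀ {v : V n} → Periodic d (v !_) → ref ⌊ a ⌋ v ≡ v → Symmetric (v !_)
      Symmetric⁻ {v} per eq i k (divides q i+k+a≡) with ∣-trans d∣n (mirror {n} k ⌊ a ⌋)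
      ... | divides q′ i′+k+a≡ = trans (periodic-≡ per q′ q swapped)
              (trans (sym (ref-! ⌊ a ⌋ v {i′} {k} (mirror k ⌊ a ⌋))) (cong (_! k) eq))
        where
        i′ = neg {n} (k + ⌊ a ⌋)
        exchange : ∀ i i′ k a → i + (i′ + k + a) ≡ i′ + (i + k + a)
        exchange = ℕ-solve-∀
        swapped : i + q′ * d ≡ i′ + q * d
        swapped = trans (cong (i ℕ.+_) (sym i′+k+a≡)) (trans (exchange i i′ k ⌊ a ⌋) (cong (i′ ℕ.+_) i+k+a≡))

      half : V n → Vec Bool (suc M)
      half v = word (v !_)

      nth-half : ∀ (v : V n) {k} → k ≤ M → nth (toList (half v)) k ≡ v ! k
      nth-half v {k} k≤M = trans (sym (at-nth-< (half v) (s≤s k≤M))) (trans (at-word-% {suc M} (v !_) k) (cong (v !_) (m<n⇒m%n≡m (s≤s k≤M))))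

      unfold : Vec Bool (suc M) → V n
      unfold h = clip (word (unfolded h))

      unfold-half : ∀ (v : V n) → Periodic d (v !_) → Symmetric (v !_) → ∀ i → unfolded (half v) i ≡ v ! i
      unfold-half v per symm i = trans (nth-half v (fold≤M (m%n<n i d))) (≡-residue (v !_) per symm i)

      -- At a bend of kind `true` two neighbouring letters are equal, so by sparseness both are 0
      -- (`double`). This is the border condition of `good`.
      half-good : ∀ (v : V n) → Periodic d (v !_) → Symmetric (v !_) → good a (half v) b ≡ true
      half-good v per symm = good⁺ a (half v) b sparse (right b refl)
        where
        double : ∀ {i} → v ! i ≡ v ! suc i → v ! i ≡ false
        double {i} eq = trans (sym (Boolₚ.∧-idem (v ! i))) (trans (cong (v ! i ∧_) eq) (!-sparse v i))
        left : ∀ c → a ≡ c → c ∧ v ! 0 ≡ false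
        left false _   = refl
        left true  a≡c = trans (sym closing) (double (trans closing opening))
          where
          closes : pred d + 0 + ⌊ a ⌋ ≡ d
          closes = trans (cong₂ (λ x c → x + ⌊ c ⌋) (ℕₚ.+-identityʳ (pred d)) a≡c) (trans (ℕₚ.+-comm (pred d) 1) (ℕₚ.suc-pred d))
          closing : v ! pred d ≡ v ! 0
          closing = symm (pred d) 0 (divides 1 (trans closes (sym (ℕₚ.*-identityˡ d))))
          opening : v ! 0 ≡ v ! suc (pred d)
          opening = trans (sym (per 0)) (cong (v !_) (sym (ℕₚ.suc-pred d)))
        right : ∀ c → b ≡ c → nth (toList (half v)) M ∧ c ≡ false
        right false _   = Boolₚ.∧-zeroʳ _
        right true  b≡c = trans (Boolₚ.∧-identityʳ _) (trans (nth-half v ℕₚ.≤-refl) (double (symm M (suc M) (divides 1 middle))))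
          where
          middle : M + suc M + ⌊ a ⌋ ≡ 1 * d
          middle = trans (cong (_+ ⌊ a ⌋) (trans (trans (ℕₚ.+-suc M M) (ℕₚ.+-comm 1 (M + M))) (cong (λ c → M + M + ⌊ c ⌋) (sym b≡c)))) (sym (ℕₚ.*-identityˡ d))
        sparse : Sparse (nth (a ∷ toList (half v)))
        sparse zero    = trans (cong (a ∧_) (nth-half v z≤n)) (left a refl)
        sparse (suc k) with suc k ℕ.≤? M
        ... | yes k<M = trans (cong₂ _∧_ (nth-half v (ℕₚ.<⇒≤ k<M)) (nth-half v k<M)) (!-sparse v k)
        ... | no k≮M  = trans (cong (nth (toList (half v)) k ∧_) (nth-beyond (toList (half v)) (ℕₚ.≤-trans (ℕₚ.≤-reflexive (Vecₚ.length-toList (half v))) (ℕₚ.≰⇒> k≮M)))) (Boolₚ.∧-zeroʳ _)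

    count-palindromes : palindromes {n} d ⌊ a ⌋ ≡ + fib (room a b + suc M)
    count-palindromes = trans (∑-count-bij _≟ⱽ_ _≟ʷ_ (vertices-unique n) (words-unique (suc M)) ∈-vertices ∈-words
        (λ v → (rot d v ≟ⱽ v) ×-dec (ref ⌊ a ⌋ v ≟ⱽ v)) (λ h → good a h b Boolₚ.≟ true) half unfold to-inv from-inv) (count-good (suc M) a b)
      where
      to-inv : ∀ {v : V n} → rot d v ≡ v × ref ⌊ a ⌋ v ≡ v → good a (half v) b ≡ true × unfold (half v) ≡ v
      to-inv {v} (r , s) = g , !-ext λ i →
        trans (clip-! (Periodic-∣ d∣n (unfolded-periodic (half v))) (unfolded-sparse (half v) g) i) (unfold-half v per symm i)
        where
        per = rot-fixed⁻ {v = v} r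
        symm = Symmetric⁻ {v} per s
        g = half-good v per symm
      from-inv : ∀ {h} → good a h b ≡ true → (rot d (unfold h) ≡ unfold h × ref ⌊ a ⌋ (unfold h) ≡ unfold h) × half (unfold h) ≡ h
      from-inv {h} g = (rot-fixed⁺ (λ i → trans (unfold-! (i + d)) (trans (unfolded-periodic h i) (sym (unfold-! i))))
                     , Symmetric⁺ (λ i k d∣ → trans (unfold-! i) (trans (unfolded-symmetric h i k d∣) (sym (unfold-! k)))))
                     , lookup-ext λ k → trans (sym (nth-lookup (half (unfold h)) k)) (trans (nth-half (unfold h) (ℕₚ.≤-pred (Finₚ.toℕ<n k)))
                         (trans (unfold-! (toℕ k)) (trans (unfolded-≤ h (ℕₚ.≤-pred (Finₚ.toℕ<n k))) (nth-lookup h k))))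
        where
        unfold-! : ∀ i → unfold h ! i ≡ unfolded h i
        unfold-! = clip-! (Periodic-∣ d∣n (unfolded-periodic h)) (unfolded-sparse h g)

even⊎odd : ∀ d → (∃ λ m → d ≡ m + m) ⊎ (∃ λ m → d ≡ suc (m + m))
even⊎odd zero    = inj₁ (0 , refl)
even⊎odd (suc d) with even⊎odd d
... | inj₁ (m , refl) = inj₂ (m , refl)
... | inj₂ (m , refl) = inj₁ (suc m , cong suc (sym (ℕₚ.+-suc m m)))

half-even : ∀ m → (m + m) / 2 ≡ m
half-even m = trans (cong (_/ 2) (double m)) (m*n/n≡m m 2)
  where
  double : ∀ m → m + m ≡ m * 2
  double = ℕ-solve-∀

half-odd : ∀ m → suc (m + m) / 2 ≡ m
half-odd m = trans (+-distrib-/-∣ʳ 1 {m + m} {2} (divides m (double m))) (half-even m)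
  where
  double : ∀ m → m + m ≡ m * 2
  double = ℕ-solve-∀

module _ {n : ℕ} .{{_ : NonZero n}} where

  -- For d = 2 m + 1 each reflection has one bend of each kind, giving F (m + 2) twice. For d = 2 m
  -- the reflection 0 fixes two positions and 1 fixes none, giving F (m + 3) + F m = 2 F (m + 2). In
  -- the last count the half has m letters, hence M = m - 1.
  palindromes-0+1 : ∀ d .{{_ : NonZero d}} → d ∣ n → palindromes {n} d 0 ℤ.+ palindromes {n} d 1 ≡ + 2 ℤ.* + fib (d / 2 + 2)
  palindromes-0+1 d d∣n with even⊎odd d
  ... | inj₂ (m , refl) = begin
    palindromes {n} d 0 ℤ.+ palindromes {n} d 1                     ≡⟨ cong₂ ℤ._+_ (transport d₀ 0 count₀) (transport d₁ 1 count₁) ⟩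
    + fib (1 + suc m) ℤ.+ + fib (1 + suc m)                         ≡⟨ double (+ fib (2 + m)) ⟩
    + 2 ℤ.* + fib (2 + m)                                           ≡⟨ cong (λ k → + 2 ℤ.* + fib k) (trans (cong (_+ 2) (half-odd m)) (ℕₚ.+-comm m 2)) ⟨
    + 2 ℤ.* + fib (suc (m + m) / 2 + 2)                             ∎
    where
    open ≡-Reasoning
    double : ∀ x → x ℤ.+ x ≡ + 2 ℤ.* x
    double = solve-∀
    d₀ : m + m + 1 + 0 ≡ suc (m + m)
    d₀ = trans (ℕₚ.+-identityʳ (m + m + 1)) (ℕₚ.+-comm (m + m) 1)
    d₁ : m + m + 0 + 1 ≡ suc (m + m)
    d₁ = trans (ℕₚ.+-comm (m + m + 0) 1) (cong suc (ℕₚ.+-identityʳ (m + m)))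
    transport : ∀ {e x} → e ≡ suc (m + m) → ∀ j → (.{{_ : NonZero e}} → e ∣ n → palindromes {n} e j ≡ x) → palindromes {n} (suc (m + m)) j ≡ x
    transport refl j count = count d∣n
    count₀ : .{{_ : NonZero (m + m + 1 + 0)}} → m + m + 1 + 0 ∣ n → _
    count₀ = Fold.count-palindromes m false true
    count₁ : .{{_ : NonZero (m + m + 0 + 1)}} → m + m + 0 + 1 ∣ n → _
    count₁ = Fold.count-palindromes m true false
  ... | inj₁ (zero , refl) = contradiction (ℕ.>-nonZero⁻¹ 0) λ ()
  ... | inj₁ (m@(suc l) , refl) = begin
    palindromes {n} d 0 ℤ.+ palindromes {n} d 1                     ≡⟨ cong₂ ℤ._+_ (transport d₀ 0 count₀) (transport d₁ 1 count₁) ⟩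
    + (fib (1 + (2 + m)) + fib m)                                   ≡⟨ cong +_ (rearrange (fib (2 + m)) (fib (1 + m)) (fib m)) ⟩
    + (2 * fib (2 + m))                                             ≡⟨ ℤₚ.pos-* 2 (fib (2 + m)) ⟩
    + 2 ℤ.* + fib (2 + m)                                           ≡⟨ cong (λ k → + 2 ℤ.* + fib k) (trans (cong (_+ 2) (half-even m)) (ℕₚ.+-comm m 2)) ⟨
    + 2 ℤ.* + fib ((m + m) / 2 + 2)                                 ∎
    where
    open ≡-Reasoning
    rearrange : ∀ x y z → x + y + z ≡ x + (y + z + 0)
    rearrange = ℕ-solve-∀
    d₀ : m + m + 0 + 0 ≡ m + m
    d₀ = trans (ℕₚ.+-identityʳ (m + m + 0)) (ℕₚ.+-identityʳ (m + m))
    d₁ : l + l + 1 + 1 ≡ m + m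
    d₁ = trans (trans (ℕₚ.+-assoc (l + l) 1 1) (ℕₚ.+-comm (l + l) 2)) (cong suc (sym (ℕₚ.+-suc l l)))
    transport : ∀ {e x} → e ≡ m + m → ∀ j → (.{{_ : NonZero e}} → e ∣ n → palindromes {n} e j ≡ x) → palindromes {n} (m + m) j ≡ x
    transport refl j count = count d∣n
    count₀ : .{{_ : NonZero (m + m + 0 + 0)}} → m + m + 0 + 0 ∣ n → _
    count₀ = Fold.count-palindromes m false false
    count₁ : .{{_ : NonZero (l + l + 1 + 1)}} → l + l + 1 + 1 ∣ n → _
    count₁ = Fold.count-palindromes l true true

  rot-injective : ∀ j {u v : V n} → rot j u ≡ rot j v → u ≡ v
  rot-injective j {u} {v} eq = trans (sym (undo u)) (trans (cong (rot (neg j)) eq) (undo v))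
    where
    undo : ∀ v → rot (neg j) (rot j v) ≡ v
    undo v = trans (rot-rot (neg j) j v) (rot-∣ v (n∣neg+ j))

  rot-comm : ∀ i j (v : V n) → rot i (rot j v) ≡ rot j (rot i v)
  rot-comm i j v = trans (rot-rot i j v) (trans (cong (λ k → rot k v) (ℕₚ.+-comm i j)) (sym (rot-rot j i v)))

  -- If v is fixed by ref j, then rot 1 v is fixed by ref (j + 2).
  palindromes-2+ : ∀ d j → palindromes {n} d (suc (suc j)) ≡ palindromes {n} d j
  palindromes-2+ d j = sym (∑-bij _≟ⱽ_ _≟ⱽ_ (vertices-unique n) (vertices-unique n) (rot 1) (rot (neg 1))
      (λ {v} _ → ∈-vertices _ , trans (rot-rot (neg 1) 1 v) (rot-∣ v (n∣neg+ 1)))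
      (λ {v} _ → ∈-vertices _ , trans (rot-rot 1 (neg 1) v) (rot-∣ v (subst (n ∣_) (ℕₚ.+-comm (neg 1) 1) (n∣neg+ 1))))
      _ _ (λ {v} _ → ⟦⟧-cong ((rot d v ≟ⱽ v) ×-dec (ref j v ≟ⱽ v)) ((rot d (rot 1 v) ≟ⱽ rot 1 v) ×-dec (ref (2 + j) (rot 1 v) ≟ⱽ rot 1 v)) to from))
    where
    conjugate : ∀ v → ref (2 + j) (rot 1 v) ≡ rot 1 (ref j v)
    conjugate v = trans (cong (λ k → ref k (rot 1 v)) (ℕₚ.+-comm 1 (suc j))) (trans (ref-rot (suc j) 1 v) (sym (rot-ref 1 j v)))
    to : ∀ {v} → rot d v ≡ v × ref j v ≡ v → rot d (rot 1 v) ≡ rot 1 v × ref (2 + j) (rot 1 v) ≡ rot 1 v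
    to {v} (r , s) = trans (rot-comm d 1 v) (cong (rot 1) r) , trans (conjugate v) (cong (rot 1) s)
    from : ∀ {v} → rot d (rot 1 v) ≡ rot 1 v × ref (2 + j) (rot 1 v) ≡ rot 1 v → rot d v ≡ v × ref j v ≡ v
    from {v} (r , s) = rot-injective 1 (trans (rot-comm 1 d v) r) , rot-injective 1 (trans (sym (conjugate v)) s)

  ref-period : ∀ {p} {v : V n} j → rot p v ≡ v → ref (j + p) v ≡ ref j v
  ref-period {p} {v} j eq = trans (cong (ref (j + p)) (sym eq)) (ref-rot j p v)

  palindromes-period : ∀ d → palindromes {n} d d ≡ palindromes {n} d 0
  palindromes-period d = ∑-cong (vertices n) λ {v} _ → ⟦⟧-cong ((rot d v ≟ⱽ v) ×-dec (ref d v ≟ⱽ v)) ((rot d v ≟ⱽ v) ×-dec (ref 0 v ≟ⱽ v))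
    (λ { (r , s) → r , trans (sym (ref-period 0 r)) s }) (λ { (r , s) → r , trans (ref-period 0 r) s })

  -- Consecutive counts have a constant sum, so twice the cyclic sum is d times that constant.
  ∑-palindromes : ∀ d .{{_ : NonZero d}} → d ∣ n → ∑ (upTo d) (palindromes {n} d) ≡ + d ℤ.* + fib (d / 2 + 2)
  ∑-palindromes d d∣n = ℤₚ.*-cancelˡ-≡ (+ 2) _ _ (begin
    + 2 ℤ.* ∑ (upTo d) c                                    ≡⟨ double (∑ (upTo d) c) ⟩
    ∑ (upTo d) c ℤ.+ ∑ (upTo d) c                           ≡⟨ cong (λ s → ∑ (upTo d) c ℤ.+ s) shift ⟨
    ∑ (upTo d) c ℤ.+ ∑ (upTo d) (λ j → c (suc j))           ≡⟨ ∑-+ (upTo d) c (λ j → c (suc j)) ⟨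
    ∑ (upTo d) (λ j → c j ℤ.+ c (suc j))                    ≡⟨ ∑-cong (upTo d) (λ {j} _ → constant j) ⟩
    ∑ (upTo d) (λ _ → + 2 ℤ.* F)                            ≡⟨ ∑-const (upTo d) (+ 2 ℤ.* F) ⟩
    + length (upTo d) ℤ.* (+ 2 ℤ.* F)                       ≡⟨ cong (λ l → + l ℤ.* (+ 2 ℤ.* F)) (Listₚ.length-upTo d) ⟩
    + d ℤ.* (+ 2 ℤ.* F)                                     ≡⟨ exchange (+ d) F ⟩
    + 2 ℤ.* (+ d ℤ.* F)                                     ∎)
    where
    open ≡-Reasoning
    c : ℕ → ℤ
    c = palindromes {n} d
    F = + fib (d / 2 + 2)
    double : ∀ x → + 2 ℤ.* x ≡ x ℤ.+ x
    double = solve-∀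
    exchange : ∀ x y → x ℤ.* (+ 2 ℤ.* y) ≡ + 2 ℤ.* (x ℤ.* y)
    exchange = solve-∀
    constant : ∀ j → c j ℤ.+ c (suc j) ≡ + 2 ℤ.* F
    constant zero    = palindromes-0+1 d d∣n
    constant (suc j) = trans (cong (λ x → c (suc j) ℤ.+ x) (palindromes-2+ d j)) (trans (ℤₚ.+-comm (c (suc j)) (c j)) (constant j))
    shift : ∑ (upTo d) (λ j → c (suc j)) ≡ ∑ (upTo d) c
    shift = ∙-cancelˡ ℤₚ.+-0-abelianGroup (c 0) _ _ (trans (sym (∑-upTo-suc d c)) (trans (∑-upTo-last d c)
      (trans (cong (λ x → ∑ (upTo d) c ℤ.+ x) (palindromes-period d)) (ℤₚ.+-comm (∑ (upTo d) c) (c 0)))))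

-- Orbit sizes

∑-one : DecidableEquality X → {xs : List X} → Unique xs → {P : X → Set} (P? : ∀ x → Dec (P x)) {x₀ : X} →
        x₀ ∈ xs → P x₀ → (∀ {x} → x ∈ xs → P x → x ≡ x₀) → ∑ xs (λ x → ⟦ P? x ⟧) ≡ 1ℤ
∑-one _≟_ {xs} uxs P? {x₀} x₀∈ px₀ only = trans
  (∑-cong xs λ {x} x∈ → trans (⟦⟧-cong (P? x) (x ≟ x₀) (only x∈) (λ { refl → px₀ })) (sym (ℤₚ.*-identityʳ ⟦ x ≟ x₀ ⟧)))
  (∑-∈ _≟_ uxs (λ _ → 1ℤ) x₀∈)

∑-none : (xs : List X) {P : X → Set} (P? : ∀ x → Dec (P x)) → (∀ {x} → x ∈ xs → ¬ P x) → ∑ xs (λ x → ⟦ P? x ⟧) ≡ 0ℤ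
∑-none xs P? none = trans (∑-cong xs λ {x} x∈ → ⟦⟧-no (P? x) (none x∈)) (∑-zero xs)

-- Representatives of the classes of a decidable equivalence relation

module Representatives (_≟_ : DecidableEquality X) (_~_ : X → X → Set) (_~?_ : ∀ x y → Dec (x ~ y))
  (~-refl : ∀ x → x ~ x) (~-sym : ∀ {x y} → x ~ y → y ~ x) (~-trans : ∀ {x y z} → x ~ y → y ~ z → x ~ z)
  {P : X → Set} (P? : ∀ x → Dec (P x)) (P-resp : ∀ {x y} → x ~ y → P x → P y) where

  representatives : List X → List X
  representatives []       = []
  representatives (x ∷ xs) with P? x | any? (_~? x) (representatives xs)
  ... | yes _ | no _  = x ∷ representatives xs
  ... | yes _ | yes _ = representatives xs
  ... | no _  | _     = representatives xs

  representatives-P : ∀ xs → All P (representatives xs)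
  representatives-P []       = []
  representatives-P (x ∷ xs) with P? x | any? (_~? x) (representatives xs)
  ... | yes p | no _  = p ∷ representatives-P xs
  ... | yes _ | yes _ = representatives-P xs
  ... | no _  | _     = representatives-P xs

  representatives-distinct : ∀ xs → AllPairs (λ r s → ¬ r ~ s) (representatives xs)
  representatives-distinct []       = []
  representatives-distinct (x ∷ xs) with P? x | any? (_~? x) (representatives xs)
  ... | yes _ | no new = All.tabulate (λ r∈ x~r → new (lose r∈ (~-sym x~r))) ∷ representatives-distinct xs
  ... | yes _ | yes _  = representatives-distinct xs
  ... | no _  | _      = representatives-distinct xs

  representatives-complete : ∀ {xs x} → x ∈ xs → P x → Any (_~ x) (representatives xs)
  representatives-complete {x ∷ xs} x∈ p with P? x | any? (_~? x) (representatives xs)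
  representatives-complete {x ∷ xs} (here refl) p | yes _ | no _    = here (~-refl x)
  representatives-complete {x ∷ xs} (here refl) p | yes _ | yes old = old
  representatives-complete {x ∷ xs} (here refl) p | no ¬p | _       = contradiction p ¬p
  representatives-complete {x ∷ xs} (there x∈)  p | yes _ | no _    = there (representatives-complete x∈ p)
  representatives-complete {x ∷ xs} (there x∈)  p | yes _ | yes _   = representatives-complete x∈ p
  representatives-complete {x ∷ xs} (there x∈)  p | no _  | _       = representatives-complete x∈ p

  distinct-injective : ∀ {rs} → AllPairs (λ r s → ¬ r ~ s) rs → ∀ {r s} → r ∈ rs → s ∈ rs → r ~ s → r ≡ s
  distinct-injective (_   ∷ _)  (here refl) (here refl) _   = refl
  distinct-injective (r≁  ∷ _)  (here refl) (there s∈)  r~s = contradiction r~s (All.lookup r≁ s∈)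
  distinct-injective (s≁  ∷ _)  (there r∈)  (here refl) r~s = contradiction (~-sym r~s) (All.lookup s≁ r∈)
  distinct-injective (_   ∷ ds) (there r∈)  (there s∈)  r~s = distinct-injective ds r∈ s∈ r~s

  -- The bracket of P x equals the number of representatives equivalent to x, which is one or none.
  -- Exchanging the sums then adds up the class sizes.
  count-representatives : ∀ {xs} → (∀ x → x ∈ xs) → {s : ℤ} → (∀ {x} → P x → ∑ xs (λ y → ⟦ x ~? y ⟧) ≡ s) →
                          ∑ xs (λ x → ⟦ P? x ⟧) ≡ + length (representatives xs) ℤ.* s
  count-representatives {xs} ∈xs {s} class-size = begin
    ∑ xs (λ x → ⟦ P? x ⟧)                       ≡⟨ ∑-cong xs (λ {x} _ → exactly-one x) ⟩
    ∑ xs (λ x → ∑ rs (λ r → ⟦ r ~? x ⟧))        ≡⟨ ∑-swap xs rs _ ⟩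
    ∑ rs (λ r → ∑ xs (λ x → ⟦ r ~? x ⟧))        ≡⟨ ∑-cong rs (λ r∈ → class-size (All.lookup (representatives-P xs) r∈)) ⟩
    ∑ rs (λ _ → s)                              ≡⟨ ∑-const rs s ⟩
    + length rs ℤ.* s                           ∎
    where
    open ≡-Reasoning
    rs = representatives xs
    rs-distinct = representatives-distinct xs
    rs-unique : Unique rs
    rs-unique = AllPairs.map (λ { {r} ¬r~s refl → ¬r~s (~-refl r) }) rs-distinct
    exactly-one : ∀ x → ⟦ P? x ⟧ ≡ ∑ rs (λ r → ⟦ r ~? x ⟧)
    exactly-one x with P? x
    ... | no ¬p = sym (∑-none rs (_~? x) λ r∈ r~x → ¬p (P-resp r~x (All.lookup (representatives-P xs) r∈)))
    ... | yes p with find (representatives-complete (∈xs x) p)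
    ... | r , r∈ , r~x = sym (∑-one _≟_ rs-unique (_~? x) r∈ r~x λ s∈ s~x → distinct-injective rs-distinct s∈ r∈ (~-trans s~x (~-sym r~x)))

least : {P : ℕ → Set} → (∀ i → Dec (P i)) → ∀ m → P m → ∃ λ p → P p × (∀ {j} → j < p → ¬ P j)
least {P} P? m pm = search m 0 (λ ()) (subst P (sym (ℕₚ.+-identityʳ m)) pm)
  where
  search : ∀ fuel k → (∀ {j} → j < k → ¬ P j) → P (fuel + k) → ∃ λ p → P p × (∀ {j} → j < p → ¬ P j)
  search zero       k below pk = k , pk , below
  search (suc fuel) k below p  with P? k
  ... | yes pk = k , pk , below
  ... | no ¬pk = search fuel (suc k) below′ (subst P (sym (ℕₚ.+-suc fuel k)) p)
    where
    below′ : ∀ {j} → j < suc k → ¬ P j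
    below′ j<1+k with ℕₚ.m≤n⇒m<n∨m≡n (ℕₚ.≤-pred j<1+k)
    ... | inj₁ j<k  = below j<k
    ... | inj₂ refl = ¬pk

-- Least periods, chirality and the sizes of orbits

module _ {n : ℕ} .{{_ : NonZero n}} where

  private
    -- The search is for the predecessor of the period, which rules out the trivial shift by 0; it
    -- succeeds at `pred n` at the latest.
    leastPeriod : (v : V n) → ∃ λ p → rot (suc p) v ≡ v × (∀ {j} → j < p → rot (suc j) v ≢ v)
    leastPeriod v = least (λ p → rot (suc p) v ≟ⱽ v) (pred n) (rot-∣ v (divides 1 (trans (ℕₚ.suc-pred n) (sym (ℕₚ.*-identityˡ n)))))

  opaque
    period : V n → ℕ
    period v = suc (proj₁ (leastPeriod v))

    instance
      period-nonZero : ∀ {v} → NonZero (period v)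
      period-nonZero = _

    rot-period : ∀ v → rot (period v) v ≡ v
    rot-period v = proj₁ (proj₂ (leastPeriod v))

    period-least : ∀ {v r} → r < period v → rot r v ≡ v → r ≡ 0
    period-least {r = zero}      _         _  = refl
    period-least {v} {r = suc r} (s≤s r<p) eq = contradiction eq (proj₂ (proj₂ (leastPeriod v)) r<p)

  rot-* : ∀ {p} {v : V n} q → rot p v ≡ v → rot (q * p) v ≡ v
  rot-* q eq = rot-fixed⁺ λ i → periodic-* (rot-fixed⁻ eq) q i

  rot-% : ∀ {p} .{{_ : NonZero p}} {v : V n} j → rot p v ≡ v → rot (j % p) v ≡ rot j v
  rot-% {p} {v} j eq = begin
    rot (j % p) v                       ≡⟨ cong (rot (j % p)) (rot-* (j / p) eq) ⟨
    rot (j % p) (rot (j / p * p) v)     ≡⟨ rot-rot (j % p) (j / p * p) v ⟩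
    rot (j % p + j / p * p) v           ≡⟨ cong (λ k → rot k v) (m≡m%n+[m/n]*n j p) ⟨
    rot j v                             ∎
    where open ≡-Reasoning

  ref-% : ∀ {p} .{{_ : NonZero p}} {v : V n} j → rot p v ≡ v → ref (j % p) v ≡ ref j v
  ref-% {p} {v} j eq = trans (sym (ref-period (j % p) (rot-* (j / p) eq))) (cong (λ k → ref k v) (sym (m≡m%n+[m/n]*n j p)))

  period⇒rot : ∀ {v : V n} {j} → period v ∣ j → rot j v ≡ v
  period⇒rot {v} (divides q refl) = rot-* q (rot-period v)

  rot⇒period : ∀ {v : V n} {j} → rot j v ≡ v → period v ∣ j
  rot⇒period {v} {j} eq = m%n≡0⇒n∣m j (period v) (period-least (m%n<n j (period v)) (trans (rot-% j (rot-period v)) eq))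

  period∣n : ∀ v → period v ∣ n
  period∣n v = rot⇒period (rot-∣ v ∣-refl)

  opaque
    Dihedral? : ∀ u v → Dec (Dihedral {n} u v)
    Dihedral? u v = map′ to from (Finₚ.any? λ (j : Fin n) → (rot (toℕ j) u ≟ⱽ v) ⊎-dec (ref (toℕ j) u ≟ⱽ v))
      where
      rot-n : rot n u ≡ u
      rot-n = rot-∣ u ∣-refl
      to : (∃ λ (j : Fin n) → rot (toℕ j) u ≡ v ⊎ ref (toℕ j) u ≡ v) → Dihedral u v
      to (j , inj₁ eq) = inj₁ (toℕ j , eq)
      to (j , inj₂ eq) = inj₂ (toℕ j , eq)
      from : Dihedral u v → ∃ λ (j : Fin n) → rot (toℕ j) u ≡ v ⊎ ref (toℕ j) u ≡ v
      from (inj₁ (j , eq)) = j mod n , inj₁ (trans (trans (cong (λ k → rot k u) (toℕ-mod j)) (rot-% j rot-n)) eq)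
      from (inj₂ (j , eq)) = j mod n , inj₂ (trans (trans (cong (λ k → ref k u) (toℕ-mod j)) (ref-% j rot-n)) eq)

  Dihedral-refl : ∀ (v : V n) → Dihedral v v
  Dihedral-refl v = SameOrbit⇒Dihedral (SameOrbit-refl v)

  Dihedral-sym : ∀ {u v : V n} → Dihedral u v → Dihedral v u
  Dihedral-sym = SameOrbit⇒Dihedral ∘ SameOrbit-sym ∘ Dihedral⇒SameOrbit

  Dihedral-trans : ∀ {u v w : V n} → Dihedral u v → Dihedral v w → Dihedral u w
  Dihedral-trans p q = SameOrbit⇒Dihedral (SameOrbit-trans (Dihedral⇒SameOrbit p) (Dihedral⇒SameOrbit q))

  Achiral : V n → Set
  Achiral v = ∃ λ j → ref j v ≡ v

  opaque
    Achiral? : ∀ v → Dec (Achiral v)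
    Achiral? v = map′ (λ (j , eq) → toℕ j , eq)
      (λ (j , eq) → j mod n , trans (trans (cong (λ k → ref k v) (toℕ-mod j)) (ref-% j (rot-∣ v ∣-refl))) eq)
      (Finₚ.any? λ (j : Fin n) → ref (toℕ j) v ≟ⱽ v)

  rot≡ref⇒Achiral : ∀ {v i j} → rot i v ≡ ref j v → Achiral v
  rot≡ref⇒Achiral {v} {i} {j} eq = neg i + j , (begin
    ref (neg i + j) v        ≡⟨ rot-ref (neg i) j v ⟨
    rot (neg i) (ref j v)    ≡⟨ cong (rot (neg i)) eq ⟨
    rot (neg i) (rot i v)    ≡⟨ rot-rot (neg i) i v ⟩
    rot (neg i + i) v        ≡⟨ rot-∣ v (n∣neg+ i) ⟩
    v                        ∎)
    where open ≡-Reasoning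

  -- Any two reflections differ by a rotation, so once a reflection fixes v, all the others act on v
  -- as rotations.
  Achiral⇒ref≡rot : ∀ {v} → Achiral v → ∀ j → ∃ λ t → ref j v ≡ rot t v
  Achiral⇒ref≡rot {v} (j₀ , eq) j = j + neg j₀ , (begin
    ref j v                        ≡⟨ ref-period j (rot-∣ v (n∣neg+ j₀)) ⟨
    ref (j + (neg j₀ + j₀)) v      ≡⟨ cong (λ k → ref k v) (ℕₚ.+-assoc j (neg j₀) j₀) ⟨
    ref (j + neg j₀ + j₀) v        ≡⟨ rot-ref (j + neg j₀) j₀ v ⟨
    rot (j + neg j₀) (ref j₀ v)    ≡⟨ cong (rot (j + neg j₀)) eq ⟩
    rot (j + neg j₀) v             ∎)
    where open ≡-Reasoning

  ref-shift : ∀ {v} i t → ref (t + i) v ≡ ref i v → rot t v ≡ v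
  ref-shift {v} i t eq = begin
    rot t v                                ≡⟨ ref-ref (i + t) (rot t v) ⟨
    ref (i + t) (ref (i + t) (rot t v))    ≡⟨ cong (ref (i + t)) (ref-rot i t v) ⟩
    ref (i + t) (ref i v)                  ≡⟨ cong (ref (i + t)) eq ⟨
    ref (i + t) (ref (t + i) v)            ≡⟨ cong (λ k → ref (i + t) (ref k v)) (ℕₚ.+-comm t i) ⟩
    ref (i + t) (ref (i + t) v)            ≡⟨ ref-ref (i + t) v ⟩
    v                                      ∎
    where open ≡-Reasoning

  private
    small-multiple : ∀ {p t} → p ∣ t → t < p → t ≡ 0
    small-multiple {t = zero}  _   _   = refl
    small-multiple {t = suc t} p∣t t<p = contradiction (∣⇒≤ p∣t) (ℕₚ.<⇒≱ t<p)

    -- Equal values at i ≤ j make j - i a period of v; being smaller than the least one, it is 0.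
    -- This serves rotations and reflections alike.
    injective-below : ∀ {v} (f : ℕ → V n) → (∀ i t → f (t + i) ≡ f i → rot t v ≡ v) →
                      ∀ {i j} → i < period v → j < period v → f i ≡ f j → i ≡ j
    injective-below {v} f shift {i} {j} i<p j<p eq = [ (λ i≤j → ordered i≤j j<p eq) , (λ j≤i → sym (ordered j≤i i<p (sym eq))) ]′ (ℕₚ.≤-total i j)
      where
      ordered : ∀ {i j} → i ≤ j → j < period v → f i ≡ f j → i ≡ j
      ordered {i} {j} i≤j j<p eq = ℕₚ.≤-antisym i≤j (ℕₚ.m∸n≡0⇒m≤n (small-multiple (rot⇒period (shift i (j ∸ i) (trans (cong f (ℕₚ.m∸n+n≡m i≤j)) (sym eq)))) (ℕₚ.≤-<-trans (ℕₚ.m∸n≤m j i) j<p)))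

    rot-shift : ∀ {v : V n} i t → rot (t + i) v ≡ rot i v → rot t v ≡ v
    rot-shift {v} i t eq = rot-injective i (trans (rot-rot i t v) (trans (cong (λ k → rot k v) (ℕₚ.+-comm i t)) eq))

  rot-injective-below : ∀ {v : V n} {i j} → i < period v → j < period v → rot i v ≡ rot j v → i ≡ j
  rot-injective-below {v} = injective-below (λ i → rot i v) rot-shift

  ref-injective-below : ∀ {v : V n} {i j} → i < period v → j < period v → ref i v ≡ ref j v → i ≡ j
  ref-injective-below {v} = injective-below (λ i → ref i v) ref-shift

  ∑-rots : (v u : V n) → ℤ
  ∑-rots v u = ∑ (upTo (period v)) (λ j → ⟦ rot j v ≟ⱽ u ⟧)

  ∑-refs : (v u : V n) → ℤ
  ∑-refs v u = ∑ (upTo (period v)) (λ j → ⟦ ref j v ≟ⱽ u ⟧)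

  private
    ∑-hit : ∀ {v u} (f : ℕ → V n) → (∀ {i j} → i < period v → j < period v → f i ≡ f j → i ≡ j) →
            ∀ j → j < period v → f j ≡ u → ∑ (upTo (period v)) (λ j → ⟦ f j ≟ⱽ u ⟧) ≡ 1ℤ
    ∑-hit {v} {u} f inj j j<p eq = ∑-one ℕ._≟_ (Uniqueₚ.upTo⁺ (period v)) (λ j → f j ≟ⱽ u) (∈-upTo⁺ j<p) eq
      λ i∈ eq′ → inj (∈-upTo⁻ i∈) j<p (trans eq′ (sym eq))

  ∑-rots-1 : ∀ {v u} j → rot j v ≡ u → ∑-rots v u ≡ 1ℤ
  ∑-rots-1 {v} {u} j eq = ∑-hit {v} (λ j → rot j v) rot-injective-below (j % period v) (m%n<n j (period v)) (trans (rot-% j (rot-period v)) eq)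

  ∑-refs-1 : ∀ {v u} j → ref j v ≡ u → ∑-refs v u ≡ 1ℤ
  ∑-refs-1 {v} {u} j eq = ∑-hit {v} (λ j → ref j v) ref-injective-below (j % period v) (m%n<n j (period v)) (trans (ref-% j (rot-period v)) eq)

  private
    ∑-transversal : ∀ p (f : ℕ → V n) → ∑ (vertices n) (λ u → ∑ (upTo p) (λ j → ⟦ f j ≟ⱽ u ⟧)) ≡ + p
    ∑-transversal p f = begin
      ∑ (vertices n) (λ u → ∑ (upTo p) (λ j → ⟦ f j ≟ⱽ u ⟧))    ≡⟨ ∑-swap (vertices n) (upTo p) _ ⟩
      ∑ (upTo p) (λ j → ∑ (vertices n) (λ u → ⟦ f j ≟ⱽ u ⟧))    ≡⟨ ∑-cong (upTo p) (λ {j} _ → ∑-one _≟ⱽ_ (vertices-unique n) (f j ≟ⱽ_) (∈-vertices (f j)) refl (λ _ → sym)) ⟩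
      ∑ (upTo p) (λ _ → 1ℤ)                                     ≡⟨ length≡∑ (upTo p) ⟩
      + length (upTo p)                                         ≡⟨ cong +_ (Listₚ.length-upTo p) ⟩
      + p                                                       ∎
      where open ≡-Reasoning

  orbitSize : V n → ℤ
  orbitSize v = ∑ (vertices n) (λ u → ⟦ Dihedral? v u ⟧)

  -- The rotations alone exhaust the orbit, and each of its words is reached by exactly one rotation
  -- index below the period.
  orbitSize-achiral : ∀ {v} → Achiral v → orbitSize v ≡ + period v
  orbitSize-achiral {v} ach = trans (∑-cong (vertices n) λ {u} _ → exactly-one u) (∑-transversal (period v) (λ j → rot j v))
    where
    exactly-one : ∀ u → ⟦ Dihedral? v u ⟧ ≡ ∑-rots v u
    exactly-one u with Dihedral? v u
    ... | yes (inj₁ (j , eq)) = sym (∑-rots-1 j eq)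
    ... | yes (inj₂ (j , eq)) = let (t , eq′) = Achiral⇒ref≡rot ach j in sym (∑-rots-1 t (trans (sym eq′) eq))
    ... | no ¬d = sym (∑-none (upTo (period v)) (λ j → rot j v ≟ⱽ u) λ {j} _ eq → ¬d (inj₁ (j , eq)))

  -- Each word of the orbit is reached either by one rotation or by one reflection with index below
  -- the period, never by both, since `rot i v` ≡ `ref j v` would yield a reflection fixing v.
  orbitSize-chiral : ∀ {v} → ¬ Achiral v → orbitSize v ≡ + (period v + period v)
  orbitSize-chiral {v} ¬ach = begin
    orbitSize v                                                                ≡⟨ ∑-cong (vertices n) (λ {u} _ → exactly-one u) ⟩
    ∑ (vertices n) (λ u → ∑-rots v u ℤ.+ ∑-refs v u)                           ≡⟨ ∑-+ (vertices n) (∑-rots v) (∑-refs v) ⟩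
    ∑ (vertices n) (∑-rots v) ℤ.+ ∑ (vertices n) (∑-refs v)                    ≡⟨ cong₂ ℤ._+_ (∑-transversal (period v) (λ j → rot j v)) (∑-transversal (period v) (λ j → ref j v)) ⟩
    + (period v + period v)                                                    ∎
    where
    open ≡-Reasoning
    exactly-one : ∀ u → ⟦ Dihedral? v u ⟧ ≡ ∑-rots v u ℤ.+ ∑-refs v u
    exactly-one u with Dihedral? v u
    ... | yes (inj₁ (i , eq)) = sym (cong₂ ℤ._+_ (∑-rots-1 i eq) (∑-none (upTo (period v)) (λ j → ref j v ≟ⱽ u) λ {j} _ eq′ → ¬ach (rot≡ref⇒Achiral {v} {i} {j} (trans eq (sym eq′)))))
    ... | yes (inj₂ (j , eq)) = sym (cong₂ ℤ._+_ (∑-none (upTo (period v)) (λ i → rot i v ≟ⱽ u) λ {i} _ eq′ → ¬ach (rot≡ref⇒Achiral {v} {i} {j} (trans eq′ (sym eq)))) (∑-refs-1 j eq))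
    ... | no ¬d = sym (cong₂ ℤ._+_ (∑-none (upTo (period v)) (λ j → rot j v ≟ⱽ u) λ {j} _ eq → ¬d (inj₁ (j , eq)))
                                   (∑-none (upTo (period v)) (λ j → ref j v ≟ⱽ u) λ {j} _ eq → ¬d (inj₂ (j , eq))))

  private
    period-∣ : ∀ {u v : V n} → Dihedral u v → period v ∣ period u
    period-∣ {u} (inj₁ (j , refl)) = rot⇒period (trans (rot-comm (period u) j u) (cong (rot j) (rot-period u)))
    period-∣ {u} (inj₂ (j , refl)) = rot⇒period (trans (rot-ref (period u) j u)
      (trans (cong (λ k → ref k u) (ℕₚ.+-comm (period u) j)) (ref-period j (rot-period u))))

  period-resp : ∀ {u v : V n} → Dihedral u v → period u ≡ period v
  period-resp u~v = ∣-antisym (period-∣ (Dihedral-sym u~v)) (period-∣ u~v)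

  Achiral-rot : ∀ {v} j → Achiral v → Achiral (rot j v)
  -- Conjugating `ref j₀` by `rot j` gives the reflection with index j₀ + 2 j.
  Achiral-rot {v} j (j₀ , eq) = (j + j₀) + j , (begin
    ref (j + j₀ + j) (rot j v)    ≡⟨ ref-rot (j + j₀) j v ⟩
    ref (j + j₀) v                ≡⟨ rot-ref j j₀ v ⟨
    rot j (ref j₀ v)              ≡⟨ cong (rot j) eq ⟩
    rot j v                       ∎)
    where open ≡-Reasoning

  Achiral-resp : ∀ {u v : V n} → Dihedral u v → Achiral u → Achiral v
  Achiral-resp (inj₁ (j , refl)) ach = Achiral-rot j ach
  Achiral-resp (inj₂ (j , refl)) ach with Achiral⇒ref≡rot ach j
  ... | t , eq = subst Achiral (sym eq) (Achiral-rot t ach)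

  orbitSize-resp : ∀ {u v : V n} → Dihedral u v → orbitSize u ≡ orbitSize v
  orbitSize-resp {u} {v} u~v = ∑-cong (vertices n) λ {w} _ →
    ⟦⟧-cong (Dihedral? u w) (Dihedral? v w) (Dihedral-trans (Dihedral-sym u~v)) (Dihedral-trans u~v)

  OrbitSize⁺ : ∀ {v : V n} {k} → orbitSize v ≡ + k → OrbitSize n v k
  OrbitSize⁺ {v} eq = filter (Dihedral? v) (vertices n)
    , ℤₚ.+-injective (trans (length-filter≡∑ (Dihedral? v) (vertices n)) eq)
    , Uniqueₚ.filter⁺ (Dihedral? v) (vertices-unique n)
    , λ w → mk⇔ (λ w∈ → Dihedral⇒SameOrbit (proj₂ (∈-filter⁻ (Dihedral? v) {xs = vertices n} w∈)))
                (λ v~w → ∈-filter⁺ (Dihedral? v) (∈-vertices w) (SameOrbit⇒Dihedral v~w))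

  OrbitSize⁻ : ∀ {v : V n} {k} → OrbitSize n v k → orbitSize v ≡ + k
  OrbitSize⁻ {v} (ws , refl , uws , orbit) = begin
    orbitSize v                                       ≡⟨ length-filter≡∑ (Dihedral? v) (vertices n) ⟨
    + length (filter (Dihedral? v) (vertices n))      ≡⟨ length≡∑ (filter (Dihedral? v) (vertices n)) ⟨
    ∑ (filter (Dihedral? v) (vertices n)) (λ _ → 1ℤ)  ≡⟨ ∑-≋ _≟ⱽ_ (Uniqueₚ.filter⁺ (Dihedral? v) (vertices-unique n)) uws
                                                          (λ {w} w∈ → Equivalence.from (orbit w) (Dihedral⇒SameOrbit (proj₂ (∈-filter⁻ (Dihedral? v) {xs = vertices n} w∈))))
                                                          (λ {w} w∈ → ∈-filter⁺ (Dihedral? v) (∈-vertices w) (SameOrbit⇒Dihedral (Equivalence.to (orbit w) w∈))) _ ⟩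
    ∑ ws (λ _ → 1ℤ)                                   ≡⟨ length≡∑ ws ⟩
    + length ws                                       ∎
    where open ≡-Reasoning

-- Orbit counts

-- For k = 2 m one has k / (2 d) = m / d, which brings the second sum into the shape of
-- `mobius-inversion` at m.
secondSum-double : ∀ m → secondSum (m + m) ≡
  ∑ (divisors m) (λ d → mobius (m ÷ d) ℤ.* (+ lucas d ℤ.- + (m * fib (d / 2 + 2))))
secondSum-double zero       = refl
secondSum-double m@(suc m-1) = trans (cong S (half-even m)) (∑-cong (divisors m) λ {d} d∈ → cong (λ q → mobius q ℤ.* (+ lucas d ℤ.- + (m * fib (d / 2 + 2)))) (quotient d (∈-divisors⁻ d∈)))
  where
  S : ℕ → ℤ
  S h = ∑ (divisors h) (λ d → mobius ((m + m) ÷ (2 * d)) ℤ.* (+ lucas d ℤ.- + (h * fib (d / 2 + 2))))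
  quotient : ∀ d → d ∣ m → (m + m) ÷ (2 * d) ≡ m ÷ d
  quotient d d∣m@(divides q m≡qd) = trans (cong (_÷ (2 * d)) (trans (cong₂ _+_ m≡qd m≡qd) (double q d)))
    (trans (m*n÷n≡m q (2 * d) (ℕₚ.≤-trans 1≤d (ℕₚ.m≤m+n d _))) (sym (trans (cong (_÷ d) m≡qd) (m*n÷n≡m q d 1≤d))))
    where
    1≤d : 1 ≤ d
    1≤d = ∣-pos (s≤s z≤n) d∣m
    double : ∀ q d → q * d + q * d ≡ q * (2 * d)
    double = ℕ-solve-∀

module _ {n : ℕ} .{{_ : NonZero n}} where

  #period #achiral #chiral : ℕ → ℤ
  #period  e = ∑ (vertices n) (λ v → ⟦ period v ℕ.≟ e ⟧)
  #achiral e = ∑ (vertices n) (λ v → ⟦ Achiral? v ×-dec (period v ℕ.≟ e) ⟧)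
  #chiral  e = ∑ (vertices n) (λ v → ⟦ ¬? (Achiral? v) ×-dec (period v ℕ.≟ e) ⟧)

  #period-split : ∀ e → #period e ≡ #achiral e ℤ.+ #chiral e
  #period-split e = trans (∑-cong (vertices n) λ {v} _ → split v) (∑-+ (vertices n) _ _)
    where
    split : ∀ (v : V n) → ⟦ period v ℕ.≟ e ⟧ ≡ ⟦ Achiral? v ×-dec (period v ℕ.≟ e) ⟧ ℤ.+ ⟦ ¬? (Achiral? v) ×-dec (period v ℕ.≟ e) ⟧
    split v with Achiral? v
    ... | yes _ = sym (ℤₚ.+-identityʳ _)
    ... | no _  = sym (ℤₚ.+-identityˡ _)

  #achiral-∤ : ∀ {k} → ¬ k ∣ n → #achiral k ≡ 0ℤ
  #achiral-∤ {k} k∤n = ∑-none (vertices n) (λ v → Achiral? v ×-dec (period v ℕ.≟ k)) λ { {v} _ (_ , refl) → k∤n (period∣n v) }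

  private
    module AchiralOrbits (e : ℕ) = Representatives _≟ⱽ_ (Dihedral {n}) Dihedral? Dihedral-refl Dihedral-sym Dihedral-trans
      (λ v → Achiral? v ×-dec (period v ℕ.≟ e)) (λ u~v (ach , eq) → Achiral-resp u~v ach , trans (sym (period-resp u~v)) eq)

    module Orbits (k : ℕ) = Representatives _≟ⱽ_ (Dihedral {n}) Dihedral? Dihedral-refl Dihedral-sym Dihedral-trans
      (λ v → orbitSize v ℤ.≟ + k) (λ u~v eq → trans (sym (orbitSize-resp u~v)) eq)

  #achiralOrbits : ℕ → ℤ
  #achiralOrbits e = + length (AchiralOrbits.representatives e (vertices n))

  #achiral-orbits : ∀ e → #achiral e ≡ #achiralOrbits e ℤ.* + e
  #achiral-orbits e = AchiralOrbits.count-representatives e ∈-vertices λ { (ach , refl) → orbitSize-achiral ach }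

  -- A word is fixed by the shift by d iff its least period divides d, so it is counted at exactly
  -- one divisor of d.
  ∑-#period : ∀ {d} .{{_ : NonZero d}} → d ∣ n → + lucas d ≡ ∑ (divisors d) #period
  ∑-#period {d} d∣n = begin
    + lucas d                                                                 ≡⟨ count-rot-fixed d∣n ⟨
    ∑ (vertices n) (λ v → ⟦ rot d v ≟ⱽ v ⟧)                                   ≡⟨ ∑-cong (vertices n) (λ {v} _ → classify v) ⟩
    ∑ (vertices n) (λ v → ∑ (divisors d) (λ e → ⟦ period v ℕ.≟ e ⟧))          ≡⟨ ∑-swap (vertices n) (divisors d) _ ⟩
    ∑ (divisors d) #period                                                    ∎
    where
    open ≡-Reasoning
    classify : ∀ (v : V n) → ⟦ rot d v ≟ⱽ v ⟧ ≡ ∑ (divisors d) (λ e → ⟦ period v ℕ.≟ e ⟧)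
    classify v with rot d v ≟ⱽ v
    ... | yes eq = sym (∑-one ℕ._≟_ (divisors-unique d) (period v ℕ.≟_) (∈-divisors⁺ (ℕ.>-nonZero⁻¹ d) (rot⇒period eq)) refl (λ _ → sym))
    ... | no neq = sym (∑-none (divisors d) (period v ℕ.≟_) λ { e∈ refl → neq (period⇒rot (∈-divisors⁻ e∈)) })

  -- Multiplied by d, both sides count the pairs (v , j) with j < d such that v is d-periodic and fixed by ref j.
  ∑-#achiralOrbits : ∀ {d} .{{_ : NonZero d}} → d ∣ n → + fib (d / 2 + 2) ≡ ∑ (divisors d) #achiralOrbits
  ∑-#achiralOrbits {d} d∣n = ℤₚ.*-cancelˡ-≡ (+ d) _ _ {{d≢0}} (begin
    + d ℤ.* + fib (d / 2 + 2)                                                                                   ≡⟨ ∑-palindromes d d∣n ⟨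
    ∑ (upTo d) (palindromes {n} d)                                                                              ≡⟨ ∑-swap (upTo d) (vertices n) _ ⟩
    ∑ (vertices n) (λ v → ∑ (upTo d) (λ j → ⟦ (rot d v ≟ⱽ v) ×-dec (ref j v ≟ⱽ v) ⟧))                           ≡⟨ ∑-cong (vertices n) (λ {v} _ → classify v (period v ∣? d) (Achiral? v)) ⟩
    ∑ (vertices n) (λ v → ∑ (divisors d) (λ e → + (d ÷ e) ℤ.* ⟦ Achiral? v ×-dec (period v ℕ.≟ e) ⟧))           ≡⟨ ∑-swap (vertices n) (divisors d) _ ⟩
    ∑ (divisors d) (λ e → ∑ (vertices n) (λ v → + (d ÷ e) ℤ.* ⟦ Achiral? v ×-dec (period v ℕ.≟ e) ⟧))           ≡⟨ ∑-cong (divisors d) (λ {e} e∈ → collect e (∈-divisors⁻ e∈)) ⟩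
    ∑ (divisors d) (λ e → + d ℤ.* #achiralOrbits e)                                                             ≡⟨ ∑-*ˡ (divisors d) (+ d) #achiralOrbits ⟩
    + d ℤ.* ∑ (divisors d) #achiralOrbits                                                                       ∎)
    where
    open ≡-Reasoning
    d≢0 : ℤ.NonZero (+ d)
    d≢0 = ℕ.≢-nonZero (ℕ.≢-nonZero⁻¹ d)
    1≤d : 1 ≤ d
    1≤d = ℕ.>-nonZero⁻¹ d
    collect : ∀ e → e ∣ d → ∑ (vertices n) (λ v → + (d ÷ e) ℤ.* ⟦ Achiral? v ×-dec (period v ℕ.≟ e) ⟧) ≡ + d ℤ.* #achiralOrbits e
    collect e e∣d = begin
      ∑ (vertices n) (λ v → + (d ÷ e) ℤ.* ⟦ Achiral? v ×-dec (period v ℕ.≟ e) ⟧)   ≡⟨ ∑-*ˡ (vertices n) (+ (d ÷ e)) _ ⟩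
      + (d ÷ e) ℤ.* #achiral e                                                     ≡⟨ cong (+ (d ÷ e) ℤ.*_) (#achiral-orbits e) ⟩
      + (d ÷ e) ℤ.* (#achiralOrbits e ℤ.* + e)                                     ≡⟨ rearrange (+ (d ÷ e)) (#achiralOrbits e) (+ e) ⟩
      + (d ÷ e) ℤ.* + e ℤ.* #achiralOrbits e                                       ≡⟨ cong (ℤ._* #achiralOrbits e) (trans (sym (ℤₚ.pos-* (d ÷ e) e)) (cong +_ (÷-cancel 1≤d e∣d))) ⟩
      + d ℤ.* #achiralOrbits e                                                     ∎
      where
      rearrange : ∀ x y z → x ℤ.* (y ℤ.* z) ≡ x ℤ.* z ℤ.* y
      rearrange = solve-∀
    Fixed? : ∀ (v : V n) j → Dec (rot d v ≡ v × ref j v ≡ v)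
    Fixed? v j = (rot d v ≟ⱽ v) ×-dec (ref j v ≟ⱽ v)
    Type? : ∀ (v : V n) e → Dec (Achiral v × period v ≡ e)
    Type? v e = Achiral? v ×-dec (period v ℕ.≟ e)
    vanish : ∀ (v : V n) → (∀ e → e ∣ d → ¬ (Achiral v × period v ≡ e)) → ∑ (divisors d) (λ e → + (d ÷ e) ℤ.* ⟦ Type? v e ⟧) ≡ 0ℤ
    vanish v none = trans (∑-cong (divisors d) λ {e} e∈ → trans (cong (+ (d ÷ e) ℤ.*_) (⟦⟧-no (Type? v e) (none e (∈-divisors⁻ e∈)))) (ℤₚ.*-zeroʳ (+ (d ÷ e))))
                          (∑-zero (divisors d))
    classify : ∀ (v : V n) → Dec (period v ∣ d) → Dec (Achiral v) →
               ∑ (upTo d) (λ j → ⟦ Fixed? v j ⟧) ≡ ∑ (divisors d) (λ e → + (d ÷ e) ℤ.* ⟦ Type? v e ⟧)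
    classify v (no p∤d) _ = trans (∑-none (upTo d) (Fixed? v) λ { _ (eq , _) → p∤d (rot⇒period eq) })
                             (sym (vanish v λ { e e∣d (_ , refl) → p∤d e∣d }))
    classify v (yes _) (no ¬ach) = trans (∑-none (upTo d) (Fixed? v) λ { {j} _ (_ , eq) → ¬ach (j , eq) })
                                  (sym (vanish v λ e _ (ach , _) → ¬ach ach))
    -- The condition `ref j v` ≡ v is periodic in j with the period of v and holds once in each
    -- period, hence for q of the d indices.
    classify v (yes p∣d@(divides q d≡qp)) (yes ach@(j₀ , eq₀)) = begin
      ∑ (upTo d) (λ j → ⟦ Fixed? v j ⟧)                                        ≡⟨ ∑-cong (upTo d) (λ {j} _ → ⟦⟧-cong (Fixed? v j) (ref j v ≟ⱽ v) proj₂ (period⇒rot p∣d ,_)) ⟩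
      ∑ (upTo d) (λ j → ⟦ ref j v ≟ⱽ v ⟧)                                      ≡⟨ cong (λ m → ∑ (upTo m) (λ j → ⟦ ref j v ≟ⱽ v ⟧)) d≡qp ⟩
      ∑ (upTo (q * period v)) (λ j → ⟦ ref j v ≟ⱽ v ⟧)                         ≡⟨ ∑-periodic q (period v) _ (λ j → cong (λ u → ⟦ u ≟ⱽ v ⟧) (trans (cong (λ k → ref k v) (ℕₚ.+-comm (period v) j)) (ref-period j (rot-period v)))) ⟩
      + q ℤ.* ∑-refs v v                                                       ≡⟨ cong (+ q ℤ.*_) (∑-refs-1 j₀ eq₀) ⟩
      + q ℤ.* 1ℤ                                                               ≡⟨ ℤₚ.*-identityʳ (+ q) ⟩
      + q                                                                      ≡⟨ cong +_ (trans (cong (_÷ period v) d≡qp) (m*n÷n≡m q (period v) (ℕ.>-nonZero⁻¹ (period v)))) ⟨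
      + (d ÷ period v)                                                         ≡⟨ ∑-∈ ℕ._≟_ (divisors-unique d) (λ e → + (d ÷ e)) (∈-divisors⁺ 1≤d p∣d) ⟨
      ∑ (divisors d) (λ e → ⟦ e ℕ.≟ period v ⟧ ℤ.* + (d ÷ e))                  ≡⟨ ∑-cong (divisors d) (λ {e} _ → trans (ℤₚ.*-comm ⟦ e ℕ.≟ period v ⟧ (+ (d ÷ e)))
                                                                                     (cong (+ (d ÷ e) ℤ.*_) (⟦⟧-cong (e ℕ.≟ period v) (Type? v e) (λ eq → ach , sym eq) (sym ∘ proj₂)))) ⟩
      ∑ (divisors d) (λ e → + (d ÷ e) ℤ.* ⟦ Type? v e ⟧)                       ∎

  -- The Fibonacci numbers already count classes, not words; hence this sum carries no factor 1/k.
  firstSum-achiralOrbits : ∀ {k} → 1 ≤ k → k ∣ n → firstSum k ≡ #achiralOrbits k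
  firstSum-achiralOrbits 1≤k k∣n = mobius-inversion 1≤k _ #achiralOrbits
    λ d∣k → ∑-#achiralOrbits {{ℕ.>-nonZero (∣-pos 1≤k d∣k)}} (∣-trans d∣k k∣n)

  -- The factor m stays fixed during the inversion. The result is the number of words of period m
  -- minus m times the number of achiral classes of period m, that is, minus the number of achiral
  -- words.
  secondSum-chiral : ∀ {m} → 1 ≤ m → m ∣ n → secondSum (m + m) ≡ #chiral m
  secondSum-chiral {m} 1≤m m∣n = begin
    secondSum (m + m)                                       ≡⟨ secondSum-double m ⟩
    ∑ (divisors m) (λ d → mobius (m ÷ d) ℤ.* h d)           ≡⟨ mobius-inversion 1≤m h g (λ d∣m → h≡∑g d∣m) ⟩
    #period m ℤ.+ ℤ.- + m ℤ.* #achiralOrbits m              ≡⟨ cong₂ (λ x y → x ℤ.+ y) (#period-split m) (trans (swap-neg (+ m) (#achiralOrbits m)) (cong ℤ.-_ (sym (#achiral-orbits m)))) ⟩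
    #achiral m ℤ.+ #chiral m ℤ.+ ℤ.- #achiral m             ≡⟨ cancel (#achiral m) (#chiral m) ⟩
    #chiral m                                               ∎
    where
    open ≡-Reasoning
    h g : ℕ → ℤ
    h d = + lucas d ℤ.- + (m * fib (d / 2 + 2))
    g e = #period e ℤ.+ ℤ.- + m ℤ.* #achiralOrbits e
    swap-neg : ∀ x y → ℤ.- x ℤ.* y ≡ ℤ.- (y ℤ.* x)
    swap-neg = solve-∀
    neg-* : ∀ x y → ℤ.- (x ℤ.* y) ≡ ℤ.- x ℤ.* y
    neg-* = solve-∀
    cancel : ∀ x y → x ℤ.+ y ℤ.+ ℤ.- x ≡ y
    cancel = solve-∀
    h≡∑g : ∀ {d} → d ∣ m → h d ≡ ∑ (divisors d) g
    h≡∑g {d} d∣m = begin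
      + lucas d ℤ.- + (m * fib (d / 2 + 2))                                             ≡⟨ cong (λ x → + lucas d ℤ.- x) (ℤₚ.pos-* m (fib (d / 2 + 2))) ⟩
      + lucas d ℤ.- + m ℤ.* + fib (d / 2 + 2)                                           ≡⟨ cong (λ x → + lucas d ℤ.+ x) (neg-* (+ m) (+ fib (d / 2 + 2))) ⟩
      + lucas d ℤ.+ ℤ.- + m ℤ.* + fib (d / 2 + 2)                                       ≡⟨ cong₂ (λ x y → x ℤ.+ ℤ.- + m ℤ.* y) (∑-#period d∣n) (∑-#achiralOrbits d∣n) ⟩
      ∑ (divisors d) #period ℤ.+ ℤ.- + m ℤ.* ∑ (divisors d) #achiralOrbits              ≡⟨ cong (λ x → ∑ (divisors d) #period ℤ.+ x) (∑-*ˡ (divisors d) (ℤ.- + m) #achiralOrbits) ⟨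
      ∑ (divisors d) #period ℤ.+ ∑ (divisors d) (λ e → ℤ.- + m ℤ.* #achiralOrbits e)    ≡⟨ ∑-+ (divisors d) #period _ ⟨
      ∑ (divisors d) g                                                                  ∎
      where
      instance
        d≢0 : NonZero d
        d≢0 = ℕ.>-nonZero (∣-pos 1≤m d∣m)
      d∣n : d ∣ n
      d∣n = ∣-trans d∣m m∣n

  orbitCount : ℕ → ℕ
  orbitCount k = length (Orbits.representatives k (vertices n))

  isOrbitCount : ∀ k → IsOrbitCount n k (orbitCount k)
  isOrbitCount k = representatives (vertices n) , refl
    , All.map (λ {r} → OrbitSize⁺ {v = r}) (representatives-P (vertices n))
    , AllPairs.map (λ ¬r~s → ¬r~s ∘ SameOrbit⇒Dihedral) (representatives-distinct (vertices n))
    , λ v size → Any.map Dihedral⇒SameOrbit (representatives-complete (∈-vertices v) (OrbitSize⁻ size))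
    where open Orbits k

  -- Both sides count the words lying in orbits of size k: the achiral ones of period k and the
  -- chiral ones of period p with 2 p = k.
  orbitCount-* : ∀ k → + orbitCount k ℤ.* + k ≡
    #achiral k ℤ.+ ∑ (vertices n) (λ v → ⟦ ¬? (Achiral? v) ×-dec (period v + period v ℕ.≟ k) ⟧)
  orbitCount-* k = trans (sym (Orbits.count-representatives k ∈-vertices id))
    (trans (∑-cong (vertices n) λ {v} _ → split v) (∑-+ (vertices n) _ _))
    where
    split : ∀ (v : V n) → ⟦ orbitSize v ℤ.≟ + k ⟧ ≡ ⟦ Achiral? v ×-dec (period v ℕ.≟ k) ⟧ ℤ.+ ⟦ ¬? (Achiral? v) ×-dec (period v + period v ℕ.≟ k) ⟧
    split v with Achiral? v
    ... | yes ach = trans (⟦⟧-cong (orbitSize v ℤ.≟ + k) (period v ℕ.≟ k) (λ eq → ℤₚ.+-injective (trans (sym (orbitSize-achiral ach)) eq)) (λ eq → trans (orbitSize-achiral ach) (cong +_ eq)))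
                          (sym (ℤₚ.+-identityʳ _))
    ... | no ¬ach = trans (⟦⟧-cong (orbitSize v ℤ.≟ + k) (period v + period v ℕ.≟ k) (λ eq → ℤₚ.+-injective (trans (sym (orbitSize-chiral ¬ach)) eq)) (λ eq → trans (orbitSize-chiral ¬ach) (cong +_ eq)))
                          (sym (ℤₚ.+-identityˡ _))

  -- Orbits of chiral words have even size. Only achiral words remain, in classes of k words each,
  -- and k cancels.
  orbitCount-odd : ∀ m → let k = suc (m + m) in + orbitCount k ≡ #achiralOrbits k
  orbitCount-odd m = ℤₚ.*-cancelʳ-≡ _ _ (+ k) (begin
    + orbitCount k ℤ.* + k          ≡⟨ orbitCount-* k ⟩
    #achiral k ℤ.+ ∑ (vertices n) (λ v → ⟦ ¬? (Achiral? v) ×-dec (period v + period v ℕ.≟ k) ⟧)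
                                    ≡⟨ cong (λ x → #achiral k ℤ.+ x) (∑-none (vertices n) (λ v → ¬? (Achiral? v) ×-dec (period v + period v ℕ.≟ k)) λ { {v} _ (_ , eq) → parity (period v) eq }) ⟩
    #achiral k ℤ.+ 0ℤ               ≡⟨ ℤₚ.+-identityʳ (#achiral k) ⟩
    #achiral k                      ≡⟨ #achiral-orbits k ⟩
    #achiralOrbits k ℤ.* + k        ∎)
    where
    open ≡-Reasoning
    k = suc (m + m)
    parity : ∀ p → p + p ≢ k
    parity p eq = ℕₚ.m≢1+m+n (m + m) (trans (cong (λ x → x + x) (sym p≡m)) (trans eq (sym (ℕₚ.+-identityʳ k))))
      where
      p≡m : p ≡ m
      p≡m = trans (sym (half-even p)) (trans (cong (_/ 2) eq) (half-odd m))

  orbitCount-even : ∀ m → let k = m + m in + orbitCount k ℤ.* + k ≡ #achiral k ℤ.+ #chiral m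
  orbitCount-even m = trans (orbitCount-* (m + m)) (cong (λ x → #achiral (m + m) ℤ.+ x) (∑-cong (vertices n) λ {v} _ →
    ⟦⟧-cong (¬? (Achiral? v) ×-dec (period v + period v ℕ.≟ m + m)) (¬? (Achiral? v) ×-dec (period v ℕ.≟ m))
      (λ (¬ach , eq) → ¬ach , trans (sym (half-even (period v))) (trans (cong (_/ 2) eq) (half-even m)))
      (λ (¬ach , eq) → ¬ach , cong (λ p → p + p) eq)))

-- Division by k and the three cases

fraction : ∀ (N a b : ℤ) k-1 → N ℤ.* + suc k-1 ≡ a ℤ.* + suc k-1 ℤ.+ b → N ℚ./ 1 ≡ a ℚ./ 1 ℚ.+ b ℚ./ suc k-1
-- Normalised fractions hide their denominators, so the equation is checked on unnormalised ones by
-- cross multiplication.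
fraction N a b k-1 eq = ℚₚ.toℚᵘ-injective (ℚᵘₚ.≃-trans (ℚₚ.toℚᵘ-fromℚᵘ (mkℚᵘ N 0)) (ℚᵘₚ.≃-trans (*≡* cross)
  (ℚᵘₚ.≃-sym (ℚᵘₚ.≃-trans (ℚₚ.toℚᵘ-homo-+ (a ℚ./ 1) (b ℚ./ suc k-1)) (ℚᵘₚ.+-cong (ℚₚ.toℚᵘ-fromℚᵘ (mkℚᵘ a 0)) (ℚₚ.toℚᵘ-fromℚᵘ (mkℚᵘ b k-1)))))))
  where
  open ≡-Reasoning
  k = + suc k-1
  cross : N ℤ.* (1ℤ ℤ.* k) ≡ (a ℤ.* k ℤ.+ b ℤ.* 1ℤ) ℤ.* 1ℤ
  cross = begin
    N ℤ.* (1ℤ ℤ.* k)                      ≡⟨ cong (N ℤ.*_) (ℤₚ.*-identityˡ k) ⟩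
    N ℤ.* k                               ≡⟨ eq ⟩
    a ℤ.* k ℤ.+ b                         ≡⟨ cong (λ x → a ℤ.* k ℤ.+ x) (ℤₚ.*-identityʳ b) ⟨
    a ℤ.* k ℤ.+ b ℤ.* 1ℤ                  ≡⟨ ℤₚ.*-identityʳ _ ⟨
    (a ℤ.* k ℤ.+ b ℤ.* 1ℤ) ℤ.* 1ℤ         ∎

-- For k = 2 m + 1 one has n = k n - m (2 n).
odd-∣ : ∀ {n} m → suc (m + m) ∣ 2 * n → suc (m + m) ∣ n
odd-∣ {n} m k∣2n = ∣m+n∣m⇒∣n (divides n (rearrange n m)) (∣-trans k∣2n (n∣m*n m))
  where
  rearrange : ∀ n m → m * (2 * n) + n ≡ n * suc (m + m)
  rearrange = ℕ-solve-∀

theorem5p8 : (n k : ℕ) → 1 ≤ n → 1 ≤ k → k ∣ 2 * n →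
    Σ ℕ (λ N → IsOrbitCount n k N ×
    ((k ∣ n → ¬ (2 ∣ k) → ℕtoℚ N ≡ A k) ×
    (k ∣ n → 2 ∣ k → ℕtoℚ N ≡ A k ℚ.+ B k) ×
    (¬ (k ∣ n) → ℕtoℚ N ≡ B k)))
theorem5p8 n@(suc _) k 1≤n 1≤k k∣2n with even⊎odd k
-- An odd divisor of 2 n divides n, so only the first case can occur.
... | inj₂ (m , refl) = orbitCount k , isOrbitCount k
    , (λ k∣n _ → cong (ℚ._/ 1) (trans (orbitCount-odd m) (sym (firstSum-achiralOrbits 1≤k k∣n))))
    , (λ _ 2∣k → contradiction (∣m+n∣m⇒∣n (subst (2 ∣_) (ℕₚ.+-comm 1 (m + m)) 2∣k) (divides m (double m))) λ 2∣1 → ℕₚ.<⇒≱ ℕₚ.≤-refl (∣⇒≤ 2∣1))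
    , (λ k∤n → contradiction (odd-∣ m k∣2n) k∤n)
  where
  double : ∀ m → m + m ≡ m * 2
  double = ℕ-solve-∀
... | inj₁ (m@(suc m-1) , refl) = orbitCount k , isOrbitCount k
    , (λ _ ¬2∣k → contradiction (divides m (double m)) ¬2∣k)
    , (λ k∣n _ → fraction (+ orbitCount k) (firstSum k) (secondSum k) _ (total (trans (#achiral-orbits k) (cong (ℤ._* + k) (sym (firstSum-achiralOrbits 1≤k k∣n))))))
    -- A period divides n, so no achiral word has period k here, and `fraction` is used with 0 for
    -- the achiral part.
    , (λ k∤n → trans (fraction (+ orbitCount k) 0ℤ (secondSum k) _ (total (#achiral-∤ k∤n))) (ℚₚ.+-identityˡ _))
  where
  double : ∀ m → m + m ≡ m * 2
  double = ℕ-solve-∀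
  m∣n : m ∣ n
  m∣n = *-cancelˡ-∣ 2 (subst (_∣ 2 * n) (trans (double m) (ℕₚ.*-comm m 2)) k∣2n)
  total : ∀ {a} → #achiral {n} k ≡ a → + orbitCount {n} k ℤ.* + k ≡ a ℤ.+ secondSum k
  total eq = trans (orbitCount-even m) (cong₂ ℤ._+_ eq (sym (secondSum-chiral (s≤s z≤n) m∣n)))
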